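{- Let $d\ge3$ be an integer, $c_d>0$ a constant, and $\varepsilon\in(0,1]$. The following are equivalent. (a) There is a constant $\gamma>0$ such that for infinitely many $n$ there is an $\mathbb{F}_2$-linear code $\mathcal{C}_n\subseteq\mathbb{F}_2^n$ of dimension at least $n-c_d\log_2n$ and minimum distance at least $d$ that is $(\varepsilon,\gamma\varepsilon)$-locally testable. (b) There is a constant $\gamma'>0$ such that for infinitely many $h$ there exist a Cayley graph $\mathcal{G}_h=\mathrm{Cay}(\mathbb{F}_2^h,\mathcal{D})$ and a set $\mathcal{B}^*$ of generators for $(\mathbb{F}_2^h)^*$ such that the elements of $\mathcal{B}^*$ are $d$-wise independent, $|\mathcal{B}^*|\ge2^{h/c_d}$, and $\mathcal{B}^*$ is an $(\varepsilon,\gamma'\varepsilon)$-spectrum generator for $\mathcal{G}_h$.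
   Context: For a linear code $\mathcal{C}\subseteq\mathbb{F}_2^n$ with dual code $\mathcal{C}^\perp$, a tester is a probability distribution $\mathcal{D}_0$ on $\mathcal{C}^\perp$. The code is $(\varepsilon,\delta)$-locally testable if it has a tester $\mathcal{D}_0$ with smoothness $\varepsilon$, i.e. $\Pr_{\alpha\leftarrow\mathcal{D}_0}[\alpha_i=1]\le\varepsilon$ for all $i\in[n]$, and soundness $\delta$, i.e. $\Pr_{\alpha\leftarrow\mathcal{D}_0}[\alpha\cdot v=1]\ge\delta\, d(v,\mathcal{C})$ for all $v\in\mathbb{F}_2^n$, where $d(v,\mathcal{C})$ is the minimum Hamming distance from $v$ to $\mathcal{C}$. $(\mathbb{F}_2^h)^*$ is the space of linear functions $b:\mathbb{F}_2^h\to\mathbb{F}_2$. For a probability distribution $\mathcal{D}$ on $\mathbb{F}_2^h$, $\mathrm{Cay}(\mathbb{F}_2^h,\mathcal{D})$ is the weighted graph on $\mathbb{F}_2^h$ where edge $(\alpha,\beta)$ has weight $\mathcal{D}(\alpha+\beta)$; its eigenvalues are $\lambda(b)=\mathbf{E}_{\alpha\leftarrow\mathcal{D}}[(-1)^{b(\alpha)}]$, $b\in(\mathbb{F}_2^h)^*$. A set of vectors is $d$-wise independent if every subset of fewer than $d$ of them is linearly independent over $\mathbb{F}_2$. For a set $\mathcal{B}^*$ spanning $(\mathbb{F}_2^h)^*$, $\mathrm{rank}_{\mathcal{B}^*}(a)$ is the least number of elements of $\mathcal{B}^*$ summing to $a$. $\mathcal{B}^*$ is a $(\mu,\nu)$-spectrum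 generator for $\mathrm{Cay}(\mathbb{F}_2^h,\mathcal{D})$ if $\lambda(b)\ge1-\mu$ for every $b\in\mathcal{B}^*$ and $\lambda(a)\le1-\nu\cdot\mathrm{rank}_{\mathcal{B}^*}(a)$ for every $a\in(\mathbb{F}_2^h)^*$. -}

module Defs where

open import Algebra.Definitions.RawMonoid using (sum)
open import Algebra.Module.Bundles.Raw using (RawLeftModule)
open import Data.Bool.Base using (Bool; true; false; _∧_; _xor_; if_then_else_)
import Data.Bool.Properties as Bool
open import Data.Fin.Base using (Fin)
open import Data.Fin.Subset using (Subset; ∣_∣)
open import Data.Integer.Base as ℤ using (ℤ; +_; -[1+_]; +[1+_])
import Data.Integer.Properties as ℤ
import Data.Integer.Tactic.RingSolver as ℤ-Solver
open import Data.Nat.Base as ℕ using (ℕ; zero; suc)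
open import Data.Nat.Induction using (<-rec)
open import Data.Nat.Logarithm using (⌊log₂_⌋; ⌊log₂⌋-mono-≤; ⌊log₂⌊n/2⌋⌋≡⌊log₂n⌋∸1; ⌊log₂[2^n]⌋≡n)
import Data.Nat.Properties as ℕ
import Data.Nat.Tactic.RingSolver as ℕ-Solver
open import Data.Product.Base using (_×_; _,_; ∃; proj₁; proj₂)
open import Data.Rational.Base as ℚ using (ℚ; mkℚ; 0ℚ; 1ℚ; ½; toℚᵘ; ↥_; ↧ₙ_)
import Data.Rational.Properties as ℚ
open import Data.Rational.Solver using (module +-*-Solver)
open import Data.Rational.Unnormalised.Base as ℚᵘ using (mkℚᵘ)
import Data.Rational.Unnormalised.Properties as ℚᵘ
open import Data.Sum.Base using (inj₁; inj₂)
open import Data.Vec.Base using (Vec; []; _∷_; foldr′; lookup; map; replicate; zipWith)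
open import Function.Base using (_∘_; id)
open import Function.Definitions using (Injective)
open import Level using (0ℓ)
open import Relation.Binary.PropositionalEquality
open import Relation.Nullary.Decidable using (yes; no; does)
open import Relation.Nullary.Negation using (¬_; contradiction)
open import Relation.Unary using (Pred; Decidable)

------------------------------------------------------------------------
-- Real numbers

-- Real numbers are Cauchy sequences of rationals, with equality and order
-- defined on representatives.

record ℝ : Set where
  field
    seq    : ℕ → ℚ
    cauchy : ∀ δ → 0ℚ ℚ.< δ →
             ∃ λ N → ∀ m n → N ℕ.≤ m → N ℕ.≤ n → ℚ.∣ seq m ℚ.- seq n ∣ ℚ.≤ δ

open ℝ

infix 4 _≈_ _≤_ _<_

_≈_ _≤_ _<_ : ℝ → ℝ → Set
x ≈ y = ∀ δ → 0ℚ ℚ.< δ → ∃ λ N → ∀ n → N ℕ.≤ n → ℚ.∣ seq x n ℚ.- seq y n ∣ ℚ.≤ δ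
x ≤ y = ∀ δ → 0ℚ ℚ.< δ → ∃ λ N → ∀ n → N ℕ.≤ n → seq x n ℚ.≤ seq y n ℚ.+ δ
x < y = ∃ λ δ → 0ℚ ℚ.< δ × ∃ λ N → ∀ n → N ℕ.≤ n → seq x n ℚ.+ δ ℚ.≤ seq y n

-- Rational bookkeeping for the Cauchy conditions below.

half>0 : ∀ {δ} → 0ℚ ℚ.< δ → 0ℚ ℚ.< ½ ℚ.* δ
half>0 {δ} 0<δ = ℚ.positive⁻¹ (½ ℚ.* δ)
  where instance
    _ = ℚ.positive 0<δ
    _ = ℚ.pos*pos⇒pos ½ δ

halves : ∀ δ → ½ ℚ.* δ ℚ.+ ½ ℚ.* δ ≡ δ
halves δ = trans (sym (ℚ.*-distribʳ-+ δ ½ ½)) (ℚ.*-identityˡ δ)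

≤-half+half : ∀ {a b c} δ → a ℚ.≤ b ℚ.+ c → b ℚ.≤ ½ ℚ.* δ → c ℚ.≤ ½ ℚ.* δ → a ℚ.≤ δ
≤-half+half δ a≤b+c b≤ c≤ =
  ℚ.≤-trans a≤b+c (ℚ.≤-trans (ℚ.+-mono-≤ b≤ c≤) (ℚ.≤-reflexive (halves δ)))

p-q≤⇒p≤q+ : ∀ p q r → p ℚ.- q ℚ.≤ r → p ℚ.≤ q ℚ.+ r
p-q≤⇒p≤q+ p q r h = ℚ.≤-trans (ℚ.≤-reflexive eq) (ℚ.+-monoʳ-≤ q h)
  where
  eq : p ≡ q ℚ.+ (p ℚ.- q)
  eq = solve 2 (λ p q → p := q :+ (p :- q)) refl p q
    where open +-*-Solver

p≤q+⇒p-q≤ : ∀ p q r → p ℚ.≤ q ℚ.+ r → p ℚ.- q ℚ.≤ r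
p≤q+⇒p-q≤ p q r h = ℚ.≤-trans (ℚ.+-monoˡ-≤ (ℚ.- q) h) (ℚ.≤-reflexive eq)
  where
  eq : q ℚ.+ r ℚ.- q ≡ r
  eq = solve 2 (λ q r → q :+ r :- q := r) refl q r
    where open +-*-Solver

p≤∣p∣ : ∀ p → p ℚ.≤ ℚ.∣ p ∣
p≤∣p∣ p with ℚ.≤-total 0ℚ p
... | inj₁ 0≤p = ℚ.≤-reflexive (sym (ℚ.0≤p⇒∣p∣≡p 0≤p))
... | inj₂ p≤0 = ℚ.≤-trans p≤0 (ℚ.0≤∣p∣ p)

∣p-q∣≤⇒p≤q+ : ∀ p q r → ℚ.∣ p ℚ.- q ∣ ℚ.≤ r → p ℚ.≤ q ℚ.+ r
∣p-q∣≤⇒p≤q+ p q r h = p-q≤⇒p≤q+ p q r (ℚ.≤-trans (p≤∣p∣ (p ℚ.- q)) h)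

∣p-q∣≤ : ∀ p q r → p ℚ.≤ q ℚ.+ r → q ℚ.≤ p ℚ.+ r → ℚ.∣ p ℚ.- q ∣ ℚ.≤ r
∣p-q∣≤ p q r p≤ q≤ with ℚ.∣p∣≡p∨∣p∣≡-p (p ℚ.- q)
... | inj₁ eq = ℚ.≤-trans (ℚ.≤-reflexive eq) (p≤q+⇒p-q≤ p q r p≤)
... | inj₂ eq = ℚ.≤-trans (ℚ.≤-reflexive (trans eq (swap p q))) (p≤q+⇒p-q≤ q p r q≤)
  where
  swap : ∀ p q → ℚ.- (p ℚ.- q) ≡ q ℚ.- p
  swap = solve 2 (λ p q → :- (p :- q) := q :- p) refl
    where open +-*-Solver

-- Since the bound is symmetric in the two indices, one inequality is enough.
real : (s : ℕ → ℚ) →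
       (∀ δ → 0ℚ ℚ.< δ → ∃ λ N → ∀ m n → N ℕ.≤ m → N ℕ.≤ n → s m ℚ.≤ s n ℚ.+ δ) → ℝ
real s h .seq = s
real s h .cauchy δ 0<δ with h δ 0<δ
... | N , bound = N , λ m n N≤m N≤n →
  ∣p-q∣≤ (s m) (s n) δ (bound m n N≤m N≤n) (bound n m N≤n N≤m)

rational : ℚ → ℝ
rational p = real (λ _ → p) λ δ 0<δ → 0 , λ _ _ _ _ →
  ℚ.≤-trans (ℚ.≤-reflexive (sym (ℚ.+-identityʳ p))) (ℚ.+-monoʳ-≤ p (ℚ.<⇒≤ 0<δ))

fromℕ : ℕ → ℝ
fromℕ n = rational (+ n ℚ./ 1)

0ℝ 1ℝ : ℝ
0ℝ = fromℕ 0
1ℝ = fromℕ 1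

infix  8 -_
infixl 7 _*_
infixl 6 _+_ _-_

_+_ : ℝ → ℝ → ℝ
(x + y) .seq n = seq x n ℚ.+ seq y n
(x + y) .cauchy δ 0<δ with cauchy x (½ ℚ.* δ) (half>0 0<δ) | cauchy y (½ ℚ.* δ) (half>0 0<δ)
... | M , x-close | N , y-close = M ℕ.⊔ N , λ m n p q → ≤-half+half δ
  (ℚ.≤-trans (ℚ.≤-reflexive (cong ℚ.∣_∣ (regroup (seq x m) (seq y m) (seq x n) (seq y n))))
             (ℚ.∣p+q∣≤∣p∣+∣q∣ (seq x m ℚ.- seq x n) (seq y m ℚ.- seq y n)))
  (x-close m n (ℕ.m⊔n≤o⇒m≤o M N p) (ℕ.m⊔n≤o⇒m≤o M N q))
  (y-close m n (ℕ.m⊔n≤o⇒n≤o M N p) (ℕ.m⊔n≤o⇒n≤o M N q))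
  where
  regroup : ∀ a b c d → a ℚ.+ b ℚ.- (c ℚ.+ d) ≡ (a ℚ.- c) ℚ.+ (b ℚ.- d)
  regroup = solve 4 (λ a b c d → a :+ b :- (c :+ d) := (a :- c) :+ (b :- d)) refl
    where open +-*-Solver

-_ : ℝ → ℝ
(- x) .seq n = ℚ.- seq x n
(- x) .cauchy δ 0<δ with cauchy x δ 0<δ
... | N , close = N , λ m n p q →
  ℚ.≤-trans (ℚ.≤-reflexive (trans (cong ℚ.∣_∣ (flip (seq x m) (seq x n))) (ℚ.∣-p∣≡∣p∣ _)))
            (close m n p q)
  where
  flip : ∀ a b → ℚ.- a ℚ.- ℚ.- b ≡ ℚ.- (a ℚ.- b)
  flip = solve 2 (λ a b → :- a :- :- b := :- (a :- b)) refl
    where open +-*-Solver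

_-_ : ℝ → ℝ → ℝ
x - y = x + (- y)

bounded : ∀ x → ∃ λ B → 0ℚ ℚ.< B × ∃ λ N → ∀ n → N ℕ.≤ n → ℚ.∣ seq x n ∣ ℚ.≤ B
bounded x with cauchy x 1ℚ (ℚ.positive⁻¹ 1ℚ)
... | N , close = B , ℚ.positive⁻¹ B , N , λ n N≤n →
  ℚ.≤-trans (ℚ.≤-reflexive (cong ℚ.∣_∣ (split (seq x n) a)))
  (ℚ.≤-trans (ℚ.∣p+q∣≤∣p∣+∣q∣ (seq x n ℚ.- a) a) (ℚ.+-monoˡ-≤ ℚ.∣ a ∣ (close n N N≤n ℕ.≤-refl)))
  where
  a B : ℚ
  a = seq x N
  B = 1ℚ ℚ.+ ℚ.∣ a ∣
  instance
    _ = ℚ.∣-∣-nonNeg a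
    _ = ℚ.pos+nonNeg⇒pos 1ℚ ℚ.∣ a ∣
  split : ∀ p q → p ≡ p ℚ.- q ℚ.+ q
  split = solve 2 (λ p q → p := p :- q :+ q) refl
    where open +-*-Solver

-- B · (δ / B) ≤ δ
scale : ∀ B → 0ℚ ℚ.< B → ∀ δ → 0ℚ ℚ.< δ →
        ∃ λ η → 0ℚ ℚ.< η × (∀ p q → 0ℚ ℚ.≤ q → p ℚ.≤ B → q ℚ.≤ η → p ℚ.* q ℚ.≤ δ)
scale B 0<B δ 0<δ = η , ℚ.positive⁻¹ η , λ p q 0≤q p≤B q≤η →
  ℚ.≤-trans (ℚ.*-monoʳ-≤-nonNeg q {{ℚ.nonNegative 0≤q}} p≤B)
  (ℚ.≤-trans (ℚ.*-monoˡ-≤-nonNeg B {{ℚ.pos⇒nonNeg B}} q≤η) (ℚ.≤-reflexive cancel))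
  where
  instance
    _ = ℚ.positive 0<B
    _ = ℚ.positive 0<δ
    _ = ℚ.pos⇒nonZero B
    _ = ℚ.1/pos⇒pos B
  η : ℚ
  η = ℚ.1/ B ℚ.* δ
  instance
    _ = ℚ.pos*pos⇒pos (ℚ.1/ B) δ
  cancel : B ℚ.* η ≡ δ
  cancel = trans (sym (ℚ.*-assoc B (ℚ.1/ B) δ))
                 (trans (cong (ℚ._* δ) (ℚ.*-inverseʳ B)) (ℚ.*-identityˡ δ))

*-distance : ∀ a b c d → ℚ.∣ a ℚ.* c ℚ.- b ℚ.* d ∣ ℚ.≤
             ℚ.∣ a ∣ ℚ.* ℚ.∣ c ℚ.- d ∣ ℚ.+ ℚ.∣ d ∣ ℚ.* ℚ.∣ a ℚ.- b ∣
*-distance a b c d = begin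
  ℚ.∣ a ℚ.* c ℚ.- b ℚ.* d ∣                                 ≡⟨ cong ℚ.∣_∣ (regroup a b c d) ⟩
  ℚ.∣ a ℚ.* (c ℚ.- d) ℚ.+ d ℚ.* (a ℚ.- b) ∣                 ≤⟨ ℚ.∣p+q∣≤∣p∣+∣q∣ (a ℚ.* (c ℚ.- d)) (d ℚ.* (a ℚ.- b)) ⟩
  ℚ.∣ a ℚ.* (c ℚ.- d) ∣ ℚ.+ ℚ.∣ d ℚ.* (a ℚ.- b) ∣           ≡⟨ cong₂ ℚ._+_ (ℚ.∣p*q∣≡∣p∣*∣q∣ a (c ℚ.- d)) (ℚ.∣p*q∣≡∣p∣*∣q∣ d (a ℚ.- b)) ⟩
  ℚ.∣ a ∣ ℚ.* ℚ.∣ c ℚ.- d ∣ ℚ.+ ℚ.∣ d ∣ ℚ.* ℚ.∣ a ℚ.- b ∣   ∎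
  where
  open ℚ.≤-Reasoning
  regroup : ∀ a b c d → a ℚ.* c ℚ.- b ℚ.* d ≡ a ℚ.* (c ℚ.- d) ℚ.+ d ℚ.* (a ℚ.- b)
  regroup = solve 4 (λ a b c d → a :* c :- b :* d := a :* (c :- d) :+ d :* (a :- b)) refl
    where open +-*-Solver

_*_ : ℝ → ℝ → ℝ
(x * y) .seq n = seq x n ℚ.* seq y n
(x * y) .cauchy δ 0<δ =
  let A , 0<A , N₁ , x≤A     = bounded x
      B , 0<B , N₂ , y≤B     = bounded y
      η , 0<η , A-scale      = scale A 0<A (½ ℚ.* δ) (half>0 0<δ)
      θ , 0<θ , B-scale      = scale B 0<B (½ ℚ.* δ) (half>0 0<δ)
      N₃ , y-close           = cauchy y η 0<η
      N₄ , x-close           = cauchy x θ 0<θ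
  in N₁ ℕ.⊔ N₂ ℕ.⊔ (N₃ ℕ.⊔ N₄) , λ m n p q →
    let p₁₂ = ℕ.m⊔n≤o⇒m≤o (N₁ ℕ.⊔ N₂) (N₃ ℕ.⊔ N₄) p
        p₃₄ = ℕ.m⊔n≤o⇒n≤o (N₁ ℕ.⊔ N₂) (N₃ ℕ.⊔ N₄) p
        q₁₂ = ℕ.m⊔n≤o⇒m≤o (N₁ ℕ.⊔ N₂) (N₃ ℕ.⊔ N₄) q
        q₃₄ = ℕ.m⊔n≤o⇒n≤o (N₁ ℕ.⊔ N₂) (N₃ ℕ.⊔ N₄) q
    in ≤-half+half δ (*-distance (seq x m) (seq x n) (seq y m) (seq y n))
      (A-scale ℚ.∣ seq x m ∣ ℚ.∣ seq y m ℚ.- seq y n ∣ (ℚ.0≤∣p∣ (seq y m ℚ.- seq y n))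
        (x≤A m (ℕ.m⊔n≤o⇒m≤o N₁ N₂ p₁₂))
        (y-close m n (ℕ.m⊔n≤o⇒m≤o N₃ N₄ p₃₄) (ℕ.m⊔n≤o⇒m≤o N₃ N₄ q₃₄)))
      (B-scale ℚ.∣ seq y n ∣ ℚ.∣ seq x m ℚ.- seq x n ∣ (ℚ.0≤∣p∣ (seq x m ℚ.- seq x n))
        (y≤B n (ℕ.m⊔n≤o⇒n≤o N₁ N₂ q₁₂))
        (x-close m n (ℕ.m⊔n≤o⇒n≤o N₃ N₄ p₃₄) (ℕ.m⊔n≤o⇒n≤o N₃ N₄ q₃₄)))

-- The first terms of x may vanish even though x > 0, so the sequence of
-- reciprocals starts at the index from which x is bounded below.

module Reciprocal (x : ℝ) (0<x : 0ℝ < x) where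

  δ₀ : ℚ
  δ₀ = proj₁ 0<x

  N₀ : ℕ
  N₀ = proj₁ (proj₂ (proj₂ 0<x))

  0<δ₀ : 0ℚ ℚ.< δ₀
  0<δ₀ = proj₁ (proj₂ 0<x)

  δ₀≤x : ∀ n → δ₀ ℚ.≤ seq x (N₀ ℕ.+ n)
  δ₀≤x n = ℚ.≤-trans (ℚ.≤-reflexive (sym (ℚ.+-identityˡ δ₀)))
                     (proj₂ (proj₂ (proj₂ 0<x)) (N₀ ℕ.+ n) (ℕ.m≤m+n N₀ n))

  x-nonZero : ∀ n → ℚ.NonZero (seq x (N₀ ℕ.+ n))
  x-nonZero n = ℚ.>-nonZero (ℚ.<-≤-trans 0<δ₀ (δ₀≤x n))

  1/x : ℕ → ℚ
  1/x n = (ℚ.1/ seq x (N₀ ℕ.+ n)) {{x-nonZero n}}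

  1/-close : ∀ δ → 0ℚ ℚ.< δ → ∀ a b .{{_ : ℚ.NonZero a}} .{{_ : ℚ.NonZero b}} →
             δ₀ ℚ.≤ a → δ₀ ℚ.≤ b → b ℚ.≤ a ℚ.+ δ ℚ.* (δ₀ ℚ.* δ₀) → ℚ.1/ a ℚ.≤ ℚ.1/ b ℚ.+ δ
  1/-close δ 0<δ a b δ₀≤a δ₀≤b b≤ = ℚ.*-cancelˡ-≤-pos (a ℚ.* b) (begin
    a ℚ.* b ℚ.* ℚ.1/ a            ≡⟨ eq₁ a b (ℚ.1/ a) (ℚ.*-inverseʳ a) ⟩
    b                             ≤⟨ b≤ ⟩
    a ℚ.+ δ ℚ.* (δ₀ ℚ.* δ₀)       ≤⟨ ℚ.+-monoʳ-≤ a (ℚ.*-monoˡ-≤-nonNeg δ {{ℚ.pos⇒nonNeg δ}} δ₀²≤ab) ⟩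
    a ℚ.+ δ ℚ.* (a ℚ.* b)         ≡⟨ eq₂ a b (ℚ.1/ b) δ (ℚ.*-inverseʳ b) ⟨
    a ℚ.* b ℚ.* (ℚ.1/ b ℚ.+ δ)    ∎)
    where
    open ℚ.≤-Reasoning
    instance
      _ = ℚ.positive 0<δ
      _ = ℚ.positive 0<δ₀
      _ = ℚ.positive (ℚ.<-≤-trans 0<δ₀ δ₀≤a)
      _ = ℚ.positive (ℚ.<-≤-trans 0<δ₀ δ₀≤b)
      _ = ℚ.pos*pos⇒pos a b
    δ₀²≤ab : δ₀ ℚ.* δ₀ ℚ.≤ a ℚ.* b
    δ₀²≤ab = ℚ.≤-trans (ℚ.*-monoˡ-≤-nonNeg δ₀ {{ℚ.pos⇒nonNeg δ₀}} δ₀≤b)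
                       (ℚ.*-monoʳ-≤-nonNeg b {{ℚ.pos⇒nonNeg b}} δ₀≤a)
    eq₁ : ∀ a b c → a ℚ.* c ≡ 1ℚ → a ℚ.* b ℚ.* c ≡ b
    eq₁ a b c e = trans (solve 3 (λ a b c → a :* b :* c := b :* (a :* c)) refl a b c)
                        (trans (cong (b ℚ.*_) e) (ℚ.*-identityʳ b))
      where open +-*-Solver
    eq₂ : ∀ a b c d → b ℚ.* c ≡ 1ℚ → a ℚ.* b ℚ.* (c ℚ.+ d) ≡ a ℚ.+ d ℚ.* (a ℚ.* b)
    eq₂ a b c d e = trans
      (solve 4 (λ a b c d → a :* b :* (c :+ d) := a :* (b :* c) :+ d :* (a :* b)) refl a b c d)
      (cong (ℚ._+ d ℚ.* (a ℚ.* b)) (trans (cong (a ℚ.*_) e) (ℚ.*-identityʳ a)))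
      where open +-*-Solver

  reciprocal : ℝ
  reciprocal = real 1/x λ δ 0<δ →
    let N , x-close = cauchy x (δ ℚ.* (δ₀ ℚ.* δ₀)) (η>0 δ 0<δ)
    in N , λ m n p q →
      1/-close δ 0<δ (seq x (N₀ ℕ.+ m)) (seq x (N₀ ℕ.+ n))
        {{x-nonZero m}} {{x-nonZero n}} (δ₀≤x m) (δ₀≤x n)
        (∣p-q∣≤⇒p≤q+ (seq x (N₀ ℕ.+ n)) (seq x (N₀ ℕ.+ m)) (δ ℚ.* (δ₀ ℚ.* δ₀))
          (x-close (N₀ ℕ.+ n) (N₀ ℕ.+ m) (ℕ.m≤n⇒m≤o+n N₀ q) (ℕ.m≤n⇒m≤o+n N₀ p)))
    where
    η>0 : ∀ δ → 0ℚ ℚ.< δ → 0ℚ ℚ.< δ ℚ.* (δ₀ ℚ.* δ₀)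
    η>0 δ 0<δ = ℚ.positive⁻¹ (δ ℚ.* (δ₀ ℚ.* δ₀))
      where instance
        _ = ℚ.positive 0<δ
        _ = ℚ.positive 0<δ₀
        _ = ℚ.pos*pos⇒pos δ₀ δ₀
        _ = ℚ.pos*pos⇒pos δ (δ₀ ℚ.* δ₀)

infixl 7 _/_[_]

_/_[_] : ℝ → (y : ℝ) → 0ℝ < y → ℝ
x / y [ 0<y ] = x * Reciprocal.reciprocal y 0<y

-- a / b ≤ c / d + 1 / l, cross-multiplied
/-≤-/+1/ : ∀ a b c d l → a ℕ.* (suc d ℕ.* suc l) ℕ.≤ (c ℕ.* suc l ℕ.+ suc d) ℕ.* suc b →
           + a ℚ./ suc b ℚ.≤ + c ℚ./ suc d ℚ.+ + 1 ℚ./ suc l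
/-≤-/+1/ a b c d l h = ℚ.toℚᵘ-cancel-≤ (begin
  toℚᵘ (+ a ℚ./ suc b)                           ≃⟨ ℚ.toℚᵘ-fromℚᵘ (mkℚᵘ (+ a) b) ⟩
  mkℚᵘ (+ a) b                                   ≤⟨ ℚᵘ.*≤* (subst₂ ℤ._≤_ lhs rhs (ℤ.+≤+ h)) ⟩
  mkℚᵘ (+ c) d ℚᵘ.+ mkℚᵘ (+ 1) l                 ≃⟨ ℚᵘ.+-cong (ℚ.toℚᵘ-fromℚᵘ (mkℚᵘ (+ c) d)) (ℚ.toℚᵘ-fromℚᵘ (mkℚᵘ (+ 1) l)) ⟨
  toℚᵘ (+ c ℚ./ suc d) ℚᵘ.+ toℚᵘ (+ 1 ℚ./ suc l) ≃⟨ ℚ.toℚᵘ-homo-+ (+ c ℚ./ suc d) (+ 1 ℚ./ suc l) ⟨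
  toℚᵘ (+ c ℚ./ suc d ℚ.+ + 1 ℚ./ suc l)         ∎)
  where
  open ℚᵘ.≤-Reasoning
  lhs : + (a ℕ.* (suc d ℕ.* suc l)) ≡ + a ℤ.* + (suc d ℕ.* suc l)
  lhs = ℤ.pos-* a (suc d ℕ.* suc l)
  rhs : + ((c ℕ.* suc l ℕ.+ suc d) ℕ.* suc b) ≡ (+ c ℤ.* + suc l ℤ.+ + 1 ℤ.* + suc d) ℤ.* + suc b
  rhs = trans (ℤ.pos-* (c ℕ.* suc l ℕ.+ suc d) (suc b)) (cong (ℤ._* + suc b)
    (trans (ℤ.pos-+ (c ℕ.* suc l) (suc d)) (cong₂ ℤ._+_ (ℤ.pos-* c (suc l)) (sym (ℤ.*-identityˡ (+ suc d))))))

-- p ≤ q + 1 / l, cross-multiplied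
≤-+1/⇒ : ∀ p q l → p ℚ.≤ q ℚ.+ + 1 ℚ./ suc l →
         ↥ p ℤ.* (+ ↧ₙ q ℤ.* + suc l) ℤ.≤ (↥ q ℤ.* + suc l ℤ.+ + ↧ₙ q) ℤ.* + ↧ₙ p
≤-+1/⇒ p@record{} q@record{} l h = subst₂ ℤ._≤_ lhs rhs (ℚᵘ.drop-*≤* (begin
  toℚᵘ p                            ≤⟨ ℚ.toℚᵘ-mono-≤ h ⟩
  toℚᵘ (q ℚ.+ + 1 ℚ./ suc l)        ≃⟨ ℚ.toℚᵘ-homo-+ q (+ 1 ℚ./ suc l) ⟩
  toℚᵘ q ℚᵘ.+ toℚᵘ (+ 1 ℚ./ suc l)  ≃⟨ ℚᵘ.+-congʳ (toℚᵘ q) (ℚ.toℚᵘ-fromℚᵘ (mkℚᵘ (+ 1) l)) ⟩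
  toℚᵘ q ℚᵘ.+ mkℚᵘ (+ 1) l          ∎))
  where
  open ℚᵘ.≤-Reasoning
  lhs : ↥ p ℤ.* + (↧ₙ q ℕ.* suc l) ≡ ↥ p ℤ.* (+ ↧ₙ q ℤ.* + suc l)
  lhs = cong (↥ p ℤ.*_) (ℤ.pos-* (↧ₙ q) (suc l))
  rhs : (↥ q ℤ.* + suc l ℤ.+ + 1 ℤ.* + ↧ₙ q) ℤ.* + ↧ₙ p ≡ (↥ q ℤ.* + suc l ℤ.+ + ↧ₙ q) ℤ.* + ↧ₙ p
  rhs = cong (λ t → (↥ q ℤ.* + suc l ℤ.+ t) ℤ.* + ↧ₙ p) (ℤ.*-identityˡ (+ ↧ₙ q))

archimedean : ∀ δ → 0ℚ ℚ.< δ → ∃ λ l → + 1 ℚ./ suc l ℚ.≤ δ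
archimedean δ@(mkℚ +[1+ n ] d _) _ = d , ℚ.toℚᵘ-cancel-≤ (begin
  toℚᵘ (+ 1 ℚ./ suc d)  ≃⟨ ℚ.toℚᵘ-fromℚᵘ (mkℚᵘ (+ 1) d) ⟩
  mkℚᵘ (+ 1) d          ≤⟨ ℚᵘ.*≤* (ℤ.*-monoʳ-≤-nonNeg (+ suc d) (ℤ.+≤+ (ℕ.s≤s (ℕ.z≤n {n})))) ⟩
  toℚᵘ δ                ∎)
  where open ℚᵘ.≤-Reasoning
archimedean (mkℚ (+ 0) _ _)    0<δ with ℤ.+<+ () ← ℚ.drop-*<* 0<δ
archimedean (mkℚ -[1+ _ ] _ _) 0<δ with () ← ℚ.drop-*<* 0<δ

-- It suffices to check the Cauchy condition for δ = 1 / l.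
real-1/ : (s : ℕ → ℚ) →
          (∀ l → ∃ λ N → ∀ m n → N ℕ.≤ m → N ℕ.≤ n → s m ℚ.≤ s n ℚ.+ + 1 ℚ./ suc l) → ℝ
real-1/ s h = real s λ δ 0<δ →
  let l , 1/l≤δ = archimedean δ 0<δ
      N , close = h l
  in N , λ m n p q → ℚ.≤-trans (close m n p q) (ℚ.+-monoʳ-≤ (s n) 1/l≤δ)

^-cancelˡ-≤ : ∀ e .{{_ : ℕ.NonZero e}} {m n} → m ℕ.^ e ℕ.≤ n ℕ.^ e → m ℕ.≤ n
^-cancelˡ-≤ e {m} {n} h = ℕ.≮⇒≥ λ n<m → ℕ.<⇒≱ (ℕ.^-monoˡ-< e n<m) h

2^-cancel-< : ∀ {m n} → 2 ℕ.^ m ℕ.< 2 ℕ.^ n → m ℕ.< n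
2^-cancel-< h = ℕ.≰⇒> λ n≤m → ℕ.<⇒≱ h (ℕ.^-monoʳ-≤ 2 n≤m)

2^⌊log₂n⌋≤n : ∀ n → .{{ℕ.NonZero n}} → 2 ℕ.^ ⌊log₂ n ⌋ ℕ.≤ n
2^⌊log₂n⌋≤n n = <-rec (λ n → .{{ℕ.NonZero n}} → 2 ℕ.^ ⌊log₂ n ⌋ ℕ.≤ n) step n
  where
  open ℕ.≤-Reasoning
  step : ∀ n → (∀ {m} → m ℕ.< n → .{{ℕ.NonZero m}} → 2 ℕ.^ ⌊log₂ m ⌋ ℕ.≤ m) →
         .{{ℕ.NonZero n}} → 2 ℕ.^ ⌊log₂ n ⌋ ℕ.≤ n
  step (suc zero)        _   = ℕ.≤-refl
  step n@(suc (suc k))   rec = begin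
    2 ℕ.^ ⌊log₂ n ⌋                       ≤⟨ ℕ.^-monoʳ-≤ 2 (ℕ.m≤n+m∸n ⌊log₂ n ⌋ 1) ⟩
    2 ℕ.* 2 ℕ.^ (⌊log₂ n ⌋ ℕ.∸ 1)         ≡⟨ cong (λ t → 2 ℕ.* 2 ℕ.^ t) (⌊log₂⌊n/2⌋⌋≡⌊log₂n⌋∸1 n) ⟨
    2 ℕ.* 2 ℕ.^ ⌊log₂ ℕ.⌊ n /2⌋ ⌋         ≤⟨ ℕ.*-monoʳ-≤ 2 (rec (ℕ.⌊n/2⌋<n (suc k))) ⟩
    2 ℕ.* ℕ.⌊ n /2⌋                       ≡⟨ cong (ℕ.⌊ n /2⌋ ℕ.+_) (ℕ.+-identityʳ ℕ.⌊ n /2⌋) ⟩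
    ℕ.⌊ n /2⌋ ℕ.+ ℕ.⌊ n /2⌋               ≤⟨ ℕ.+-monoʳ-≤ ℕ.⌊ n /2⌋ (ℕ.⌊n/2⌋≤⌈n/2⌉ n) ⟩
    ℕ.⌊ n /2⌋ ℕ.+ ℕ.⌈ n /2⌉               ≡⟨ ℕ.⌊n/2⌋+⌈n/2⌉≡n n ⟩
    n                                     ∎

n<2^[1+⌊log₂n⌋] : ∀ n → n ℕ.< 2 ℕ.^ suc ⌊log₂ n ⌋
n<2^[1+⌊log₂n⌋] n = ℕ.≰⇒> λ h → ℕ.<-irrefl refl
  (subst (ℕ._≤ ⌊log₂ n ⌋) (⌊log₂[2^n]⌋≡n (suc ⌊log₂ n ⌋)) (⌊log₂⌋-mono-≤ h))

⌊log₂⌋-close : ∀ n a b → ⌊log₂ (n ℕ.^ suc a) ⌋ ℕ.* suc b ℕ.≤ suc ⌊log₂ (n ℕ.^ suc b) ⌋ ℕ.* suc a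
⌊log₂⌋-close zero      a b = ℕ.z≤n
⌊log₂⌋-close n@(suc _) a b = ℕ.<⇒≤ (2^-cancel-< (begin-strict
  2 ℕ.^ (A ℕ.* suc b)             ≡⟨ ℕ.^-*-assoc 2 A (suc b) ⟨
  (2 ℕ.^ A) ℕ.^ suc b             ≤⟨ ℕ.^-monoˡ-≤ (suc b) (2^⌊log₂n⌋≤n (n ℕ.^ suc a)) ⟩
  (n ℕ.^ suc a) ℕ.^ suc b         ≡⟨ ℕ.^-*-assoc n (suc a) (suc b) ⟩
  n ℕ.^ (suc a ℕ.* suc b)         ≡⟨ cong (n ℕ.^_) (ℕ.*-comm (suc a) (suc b)) ⟩
  n ℕ.^ (suc b ℕ.* suc a)         ≡⟨ ℕ.^-*-assoc n (suc b) (suc a) ⟨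
  (n ℕ.^ suc b) ℕ.^ suc a         <⟨ ℕ.^-monoˡ-< (suc a) (n<2^[1+⌊log₂n⌋] (n ℕ.^ suc b)) ⟩
  (2 ℕ.^ suc B) ℕ.^ suc a         ≡⟨ ℕ.^-*-assoc 2 (suc B) (suc a) ⟩
  2 ℕ.^ (suc B ℕ.* suc a)         ∎))
  where
  open ℕ.≤-Reasoning
  instance _ = ℕ.m^n≢0 n (suc a)
  A B : ℕ
  A = ⌊log₂ (n ℕ.^ suc a) ⌋
  B = ⌊log₂ (n ℕ.^ suc b) ⌋

-- log₂ n = lim ⌊log₂ nᵐ⌋ / m, with an error of at most 1 / m.  The junk value
-- at n = 0 is 0.
log₂ : ℕ → ℝ
log₂ n = real-1/ (λ m → + ⌊log₂ (n ℕ.^ suc m) ⌋ ℚ./ suc m) λ l → l , λ a b _ l≤b →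
  let A = ⌊log₂ (n ℕ.^ suc a) ⌋ ; B = ⌊log₂ (n ℕ.^ suc b) ⌋ in
  /-≤-/+1/ A a B b l (begin
    A ℕ.* (suc b ℕ.* suc l)               ≡⟨ ℕ.*-assoc A (suc b) (suc l) ⟨
    A ℕ.* suc b ℕ.* suc l                 ≤⟨ ℕ.*-monoˡ-≤ (suc l) (⌊log₂⌋-close n a b) ⟩
    suc B ℕ.* suc a ℕ.* suc l             ≡⟨ regroup B (suc a) (suc l) ⟩
    (B ℕ.* suc l ℕ.+ suc l) ℕ.* suc a     ≤⟨ ℕ.*-monoˡ-≤ (suc a) (ℕ.+-monoʳ-≤ (B ℕ.* suc l) (ℕ.s≤s l≤b)) ⟩
    (B ℕ.* suc l ℕ.+ suc b) ℕ.* suc a     ∎)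
  where
  open ℕ.≤-Reasoning
  regroup : ∀ x y z → suc x ℕ.* y ℕ.* z ≡ (x ℕ.* z ℕ.+ z) ℕ.* y
  regroup = ℕ-Solver.solve-∀

^-distribʳ-* : ∀ m n e → (m ℕ.* n) ℕ.^ e ≡ m ℕ.^ e ℕ.* n ℕ.^ e
^-distribʳ-* m n zero    = refl
^-distribʳ-* m n (suc e) = trans (cong (m ℕ.* n ℕ.*_) (^-distribʳ-* m n e)) (regroup m n (m ℕ.^ e) (n ℕ.^ e))
  where
  regroup : ∀ a b c d → a ℕ.* b ℕ.* (c ℕ.* d) ≡ a ℕ.* c ℕ.* (b ℕ.* d)
  regroup = ℕ-Solver.solve-∀

_⁺ _⁻ : ℤ → ℕ
(+ n)    ⁺ = n
-[1+ n ] ⁺ = 0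
(+ n)    ⁻ = 0
-[1+ n ] ⁻ = suc n

i≡i⁺-i⁻ : ∀ i → i ≡ + (i ⁺) ℤ.- + (i ⁻)
i≡i⁺-i⁻ (+ n)    = sym (ℤ.+-identityʳ (+ n))
i≡i⁺-i⁻ -[1+ n ] = refl

greatest : ∀ {P : Pred ℕ 0ℓ} → Decidable P → ℕ → ℕ
greatest P? zero    = zero
greatest P? (suc b) = if does (P? (suc b)) then suc b else greatest P? b

greatest-holds : ∀ {P : Pred ℕ 0ℓ} (P? : Decidable P) b → P 0 → P (greatest P? b)
greatest-holds P? zero    p₀ = p₀
greatest-holds P? (suc b) p₀ with P? (suc b)
... | yes p = p
... | no  _ = greatest-holds P? b p₀

greatest-max : ∀ {P : Pred ℕ 0ℓ} (P? : Decidable P) b {j} → greatest P? b ℕ.< j → j ℕ.≤ b → ¬ P j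
greatest-max P? zero    g<j ℕ.z≤n = contradiction g<j λ ()
greatest-max P? (suc b) {j} g<j j≤1+b with P? (suc b) | j ℕ.≟ suc b
... | yes _ | _        = contradiction j≤1+b (ℕ.<⇒≱ g<j)
... | no ¬p | yes refl = ¬p
... | no _  | no j≢1+b = greatest-max P? b g<j (ℕ.s≤s⁻¹ (ℕ.≤∧≢⇒< j≤1+b j≢1+b))

-- j ≤ m · 2ᵖ, with the exponent p = u / q cleared of its denominator and sign
_≤[_·2^_] : ℕ → ℕ → ℚ → Set
j ≤[ m ·2^ p ] = j ℕ.^ ↧ₙ p ℕ.* 2 ℕ.^ ((↥ p) ⁻) ℕ.≤ m ℕ.^ ↧ₙ p ℕ.* 2 ℕ.^ ((↥ p) ⁺)

⌊_·2^_⌋ : ℕ → ℚ → ℕ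
⌊ m ·2^ p ⌋ = greatest {_≤[ m ·2^ p ]} (λ _ → _ ℕ.≤? _) (m ℕ.* 2 ℕ.^ ((↥ p) ⁺))

⌊·2^⌋-holds : ∀ m p → ⌊ m ·2^ p ⌋ ≤[ m ·2^ p ]
⌊·2^⌋-holds m p = greatest-holds {_≤[ m ·2^ p ]} (λ _ → _ ℕ.≤? _) (m ℕ.* 2 ℕ.^ ((↥ p) ⁺)) ℕ.z≤n

⌊·2^⌋-max : ∀ m p → m ℕ.^ ↧ₙ p ℕ.* 2 ℕ.^ ((↥ p) ⁺) ℕ.< suc ⌊ m ·2^ p ⌋ ℕ.^ ↧ₙ p ℕ.* 2 ℕ.^ ((↥ p) ⁻)
⌊·2^⌋-max m p with suc ⌊ m ·2^ p ⌋ ℕ.≤? m ℕ.* 2 ℕ.^ ((↥ p) ⁺)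
... | yes j≤b = ℕ.≰⇒> (greatest-max {_≤[ m ·2^ p ]} (λ _ → _ ℕ.≤? _) (m ℕ.* 2 ℕ.^ ((↥ p) ⁺)) ℕ.≤-refl j≤b)
... | no  j≰b = begin-strict
  m ℕ.^ q ℕ.* A             ≤⟨ ℕ.*-monoʳ-≤ (m ℕ.^ q) (ℕ.m≤m*n A (A ℕ.^ ℚ.denominator-1 p) {{A^≢0}}) ⟩
  m ℕ.^ q ℕ.* A ℕ.^ q       ≡⟨ ^-distribʳ-* m A q ⟨
  (m ℕ.* A) ℕ.^ q           <⟨ ℕ.^-monoˡ-< q (ℕ.≰⇒> j≰b) ⟩
  j ℕ.^ q                   ≤⟨ ℕ.m≤m*n (j ℕ.^ q) (2 ℕ.^ ((↥ p) ⁻)) {{ℕ.m^n≢0 2 ((↥ p) ⁻)}} ⟩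
  j ℕ.^ q ℕ.* 2 ℕ.^ ((↥ p) ⁻)   ∎
  where
  open ℕ.≤-Reasoning
  q A j : ℕ
  q = ↧ₙ p
  A = 2 ℕ.^ ((↥ p) ⁺)
  j = suc ⌊ m ·2^ p ⌋
  A^≢0 : ℕ.NonZero (A ℕ.^ ℚ.denominator-1 p)
  A^≢0 = ℕ.m^n≢0 A (ℚ.denominator-1 p) {{ℕ.m^n≢0 2 ((↥ p) ⁺)}}

-- 2 ≤ (1 + 1 / k)ᵏ
bernoulli : ∀ k → 2 ℕ.* suc k ℕ.^ suc k ℕ.≤ suc (suc k) ℕ.^ suc k
bernoulli k = ℕ.*-cancelˡ-≤ K (begin
  K ℕ.* (2 ℕ.* K ℕ.^ K)      ≡⟨ regroup K (K ℕ.^ K) ⟩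
  (K ℕ.+ K) ℕ.* K ℕ.^ K      ≤⟨ go K ⟩
  K ℕ.* suc K ℕ.^ K          ∎)
  where
  open ℕ.≤-Reasoning
  K : ℕ
  K = suc k
  regroup : ∀ x y → x ℕ.* (2 ℕ.* y) ≡ (x ℕ.+ x) ℕ.* y
  regroup = ℕ-Solver.solve-∀
  step : ∀ K n e → (K ℕ.+ suc n) ℕ.* (K ℕ.* e) ℕ.+ n ℕ.* e ≡ suc K ℕ.* ((K ℕ.+ n) ℕ.* e)
  step = ℕ-Solver.solve-∀
  swap : ∀ x y z → x ℕ.* (y ℕ.* z) ≡ y ℕ.* (x ℕ.* z)
  swap = ℕ-Solver.solve-∀
  go : ∀ n → (K ℕ.+ n) ℕ.* K ℕ.^ n ℕ.≤ K ℕ.* suc K ℕ.^ n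
  go zero    = ℕ.≤-reflexive (cong (ℕ._* 1) (ℕ.+-identityʳ K))
  go (suc n) = begin
    (K ℕ.+ suc n) ℕ.* (K ℕ.* K ℕ.^ n)                       ≤⟨ ℕ.m≤m+n _ (n ℕ.* K ℕ.^ n) ⟩
    (K ℕ.+ suc n) ℕ.* (K ℕ.* K ℕ.^ n) ℕ.+ n ℕ.* K ℕ.^ n     ≡⟨ step K n (K ℕ.^ n) ⟩
    suc K ℕ.* ((K ℕ.+ n) ℕ.* K ℕ.^ n)                       ≤⟨ ℕ.*-monoʳ-≤ (suc K) (go n) ⟩
    suc K ℕ.* (K ℕ.* suc K ℕ.^ n)                           ≡⟨ swap (suc K) K (suc K ℕ.^ n) ⟩
    K ℕ.* (suc K ℕ.* suc K ℕ.^ n)                           ∎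

-- p ≤ p′ + 1 / k, cross-multiplied and sorted by sign
exponents : ∀ p p′ k → p ℚ.≤ p′ ℚ.+ + 1 ℚ./ suc k →
            (↥ p) ⁺ ℕ.* (↧ₙ p′ ℕ.* suc k) ℕ.+ (↥ p′) ⁻ ℕ.* (↧ₙ p ℕ.* suc k) ℕ.≤
            (↥ p′) ⁺ ℕ.* (↧ₙ p ℕ.* suc k) ℕ.+ (↥ p) ⁻ ℕ.* (↧ₙ p′ ℕ.* suc k) ℕ.+ ↧ₙ p ℕ.* ↧ₙ p′
exponents p p′ k h = ℤ.drop‿+≤+ (begin
  + (a ℕ.* (q′ ℕ.* K) ℕ.+ b′ ℕ.* (q ℕ.* K))                              ≡⟨ cast₂ a q′ b′ q ⟩
  + a ℤ.* (+ q′ ℤ.* + K) ℤ.+ + b′ ℤ.* (+ q ℤ.* + K)                      ≡⟨ lhs (+ a) (+ b) (+ b′) (+ q) (+ q′) (+ K) ⟩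
  (+ a ℤ.- + b) ℤ.* (+ q′ ℤ.* + K) ℤ.+ c                                 ≡⟨ cong (λ i → i ℤ.* (+ q′ ℤ.* + K) ℤ.+ c) (i≡i⁺-i⁻ (↥ p)) ⟨
  ↥ p ℤ.* (+ q′ ℤ.* + K) ℤ.+ c                                           ≤⟨ ℤ.+-monoˡ-≤ c (≤-+1/⇒ p p′ k h) ⟩
  (↥ p′ ℤ.* + K ℤ.+ + q′) ℤ.* + q ℤ.+ c                                  ≡⟨ cong (λ i → (i ℤ.* + K ℤ.+ + q′) ℤ.* + q ℤ.+ c) (i≡i⁺-i⁻ (↥ p′)) ⟩
  ((+ a′ ℤ.- + b′) ℤ.* + K ℤ.+ + q′) ℤ.* + q ℤ.+ c                       ≡⟨ rhs (+ b) (+ a′) (+ b′) (+ q) (+ q′) (+ K) ⟩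
  + a′ ℤ.* (+ q ℤ.* + K) ℤ.+ + b ℤ.* (+ q′ ℤ.* + K) ℤ.+ + q ℤ.* + q′     ≡⟨ cong₂ ℤ._+_ (cast₂ a′ q b q′) (ℤ.pos-* q q′) ⟨
  + (a′ ℕ.* (q ℕ.* K) ℕ.+ b ℕ.* (q′ ℕ.* K) ℕ.+ q ℕ.* q′)                 ∎)
  where
  open ℤ.≤-Reasoning
  a b a′ b′ q q′ K : ℕ
  a = (↥ p) ⁺
  b = (↥ p) ⁻
  a′ = (↥ p′) ⁺
  b′ = (↥ p′) ⁻
  q = ↧ₙ p
  q′ = ↧ₙ p′
  K = suc k
  c : ℤ
  c = + b ℤ.* (+ q′ ℤ.* + K) ℤ.+ + b′ ℤ.* (+ q ℤ.* + K)
  cast : ∀ x y → + (x ℕ.* (y ℕ.* K)) ≡ + x ℤ.* (+ y ℤ.* + K)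
  cast x y = trans (ℤ.pos-* x (y ℕ.* K)) (cong (+ x ℤ.*_) (ℤ.pos-* y K))
  cast₂ : ∀ x y z w → + (x ℕ.* (y ℕ.* K) ℕ.+ z ℕ.* (w ℕ.* K)) ≡ + x ℤ.* (+ y ℤ.* + K) ℤ.+ + z ℤ.* (+ w ℤ.* + K)
  cast₂ x y z w = cong₂ ℤ._+_ (cast x y) (cast z w)
  lhs : ∀ a b b′ q q′ K → a ℤ.* (q′ ℤ.* K) ℤ.+ b′ ℤ.* (q ℤ.* K) ≡
        (a ℤ.- b) ℤ.* (q′ ℤ.* K) ℤ.+ (b ℤ.* (q′ ℤ.* K) ℤ.+ b′ ℤ.* (q ℤ.* K))
  lhs = ℤ-Solver.solve-∀
  rhs : ∀ b a′ b′ q q′ K →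
        ((a′ ℤ.- b′) ℤ.* K ℤ.+ q′) ℤ.* q ℤ.+ (b ℤ.* (q′ ℤ.* K) ℤ.+ b′ ℤ.* (q ℤ.* K)) ≡
        a′ ℤ.* (q ℤ.* K) ℤ.+ b ℤ.* (q′ ℤ.* K) ℤ.+ q ℤ.* q′
  rhs = ℤ-Solver.solve-∀

^-* : ∀ x y u v → (x ℕ.^ u ℕ.* 2 ℕ.^ v) ℕ.^ y ≡ x ℕ.^ (u ℕ.* y) ℕ.* 2 ℕ.^ (v ℕ.* y)
^-* x y u v = trans (^-distribʳ-* (x ℕ.^ u) (2 ℕ.^ v) y) (cong₂ ℕ._*_ (ℕ.^-*-assoc x u y) (ℕ.^-*-assoc 2 v y))

⌊·2^⌋-close : ∀ m m′ p p′ k → p ℚ.≤ p′ ℚ.+ + 1 ℚ./ suc k →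
              ⌊ m ·2^ p ⌋ ℕ.* m′ ℕ.* suc k ℕ.≤ m ℕ.* suc ⌊ m′ ·2^ p′ ⌋ ℕ.* suc (suc k)
⌊·2^⌋-close m m′ p p′ k h = ^-cancelˡ-≤ E
  (ℕ.*-cancelʳ-≤ _ _ (2 ℕ.^ (x₁ ℕ.+ x₂ ℕ.+ q ℕ.* q′)) {{ℕ.m^n≢0 2 (x₁ ℕ.+ x₂ ℕ.+ q ℕ.* q′)}} (begin
  (j ℕ.* m′ ℕ.* K) ℕ.^ E ℕ.* 2 ℕ.^ (x₁ ℕ.+ x₂ ℕ.+ q ℕ.* q′)
    ≡⟨ cong₂ ℕ._*_ (^-distrib₃ j m′ K) (2^-distrib₃ x₁ x₂ (q ℕ.* q′)) ⟩
  j ℕ.^ E ℕ.* m′ ℕ.^ E ℕ.* K ℕ.^ E ℕ.* (2 ℕ.^ x₁ ℕ.* 2 ℕ.^ x₂ ℕ.* 2 ℕ.^ (q ℕ.* q′))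
    ≡⟨ shuffle (j ℕ.^ E) (m′ ℕ.^ E) (K ℕ.^ E) (2 ℕ.^ x₁) (2 ℕ.^ x₂) (2 ℕ.^ (q ℕ.* q′)) ⟩
  (m′ ℕ.^ E ℕ.* 2 ℕ.^ x₁) ℕ.* (j ℕ.^ E ℕ.* 2 ℕ.^ x₂) ℕ.* (2 ℕ.^ (q ℕ.* q′) ℕ.* K ℕ.^ E)
    ≤⟨ ℕ.*-mono-≤ (ℕ.*-mono-≤ upper lower) two ⟩
  (j′ ℕ.^ E ℕ.* 2 ℕ.^ y₂) ℕ.* (m ℕ.^ E ℕ.* 2 ℕ.^ y₁) ℕ.* suc K ℕ.^ E
    ≡⟨ shuffle′ (j′ ℕ.^ E) (2 ℕ.^ y₂) (m ℕ.^ E) (2 ℕ.^ y₁) (suc K ℕ.^ E) ⟩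
  m ℕ.^ E ℕ.* j′ ℕ.^ E ℕ.* suc K ℕ.^ E ℕ.* (2 ℕ.^ y₁ ℕ.* 2 ℕ.^ y₂)
    ≡⟨ cong₂ ℕ._*_ (^-distrib₃ m j′ (suc K)) (ℕ.^-distribˡ-+-* 2 y₁ y₂) ⟨
  (m ℕ.* j′ ℕ.* suc K) ℕ.^ E ℕ.* 2 ℕ.^ (y₁ ℕ.+ y₂)
    ≤⟨ ℕ.*-monoʳ-≤ ((m ℕ.* j′ ℕ.* suc K) ℕ.^ E) (ℕ.^-monoʳ-≤ 2 (exponents p p′ k h)) ⟩
  (m ℕ.* j′ ℕ.* suc K) ℕ.^ E ℕ.* 2 ℕ.^ (x₁ ℕ.+ x₂ ℕ.+ q ℕ.* q′)
    ∎))
  where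
  open ℕ.≤-Reasoning
  j j′ K q q′ E x₁ x₂ y₁ y₂ : ℕ
  j  = ⌊ m ·2^ p ⌋
  j′ = suc ⌊ m′ ·2^ p′ ⌋
  K  = suc k
  q  = ↧ₙ p
  q′ = ↧ₙ p′
  E  = q ℕ.* (q′ ℕ.* K)
  x₁ = (↥ p′) ⁺ ℕ.* (q ℕ.* K)
  x₂ = (↥ p) ⁻ ℕ.* (q′ ℕ.* K)
  y₁ = (↥ p) ⁺ ℕ.* (q′ ℕ.* K)
  y₂ = (↥ p′) ⁻ ℕ.* (q ℕ.* K)
  E≡ : q′ ℕ.* (q ℕ.* K) ≡ E
  E≡ = rearrange q′ q K
    where
    rearrange : ∀ x y z → x ℕ.* (y ℕ.* z) ≡ y ℕ.* (x ℕ.* z)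
    rearrange = ℕ-Solver.solve-∀
  E≡′ : K ℕ.* (q ℕ.* q′) ≡ E
  E≡′ = rearrange K q q′
    where
    rearrange : ∀ x y z → x ℕ.* (y ℕ.* z) ≡ y ℕ.* (z ℕ.* x)
    rearrange = ℕ-Solver.solve-∀
  lower : j ℕ.^ E ℕ.* 2 ℕ.^ x₂ ℕ.≤ m ℕ.^ E ℕ.* 2 ℕ.^ y₁
  lower = subst₂ ℕ._≤_ (^-* j (q′ ℕ.* K) q ((↥ p) ⁻)) (^-* m (q′ ℕ.* K) q ((↥ p) ⁺))
    (ℕ.^-monoˡ-≤ (q′ ℕ.* K) (⌊·2^⌋-holds m p))
  upper : m′ ℕ.^ E ℕ.* 2 ℕ.^ x₁ ℕ.≤ j′ ℕ.^ E ℕ.* 2 ℕ.^ y₂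
  upper = subst (λ e → m′ ℕ.^ e ℕ.* 2 ℕ.^ x₁ ℕ.≤ j′ ℕ.^ e ℕ.* 2 ℕ.^ y₂) E≡
    (subst₂ ℕ._≤_ (^-* m′ (q ℕ.* K) q′ ((↥ p′) ⁺)) (^-* j′ (q ℕ.* K) q′ ((↥ p′) ⁻))
      (ℕ.^-monoˡ-≤ (q ℕ.* K) (ℕ.<⇒≤ (⌊·2^⌋-max m′ p′))))
  two : 2 ℕ.^ (q ℕ.* q′) ℕ.* K ℕ.^ E ℕ.≤ suc K ℕ.^ E
  two = subst (λ e → 2 ℕ.^ (q ℕ.* q′) ℕ.* K ℕ.^ e ℕ.≤ suc K ℕ.^ e) E≡′
    (subst₂ ℕ._≤_ (trans (^-distribʳ-* 2 (K ℕ.^ K) (q ℕ.* q′)) (cong (2 ℕ.^ (q ℕ.* q′) ℕ.*_) (ℕ.^-*-assoc K K (q ℕ.* q′))))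
      (ℕ.^-*-assoc (suc K) K (q ℕ.* q′)) (ℕ.^-monoˡ-≤ (q ℕ.* q′) (bernoulli k)))
  ^-distrib₃ : ∀ x y z → (x ℕ.* y ℕ.* z) ℕ.^ E ≡ x ℕ.^ E ℕ.* y ℕ.^ E ℕ.* z ℕ.^ E
  ^-distrib₃ x y z = trans (^-distribʳ-* (x ℕ.* y) z E) (cong (ℕ._* z ℕ.^ E) (^-distribʳ-* x y E))
  2^-distrib₃ : ∀ x y z → 2 ℕ.^ (x ℕ.+ y ℕ.+ z) ≡ 2 ℕ.^ x ℕ.* 2 ℕ.^ y ℕ.* 2 ℕ.^ z
  2^-distrib₃ x y z = trans (ℕ.^-distribˡ-+-* 2 (x ℕ.+ y) z) (cong (ℕ._* 2 ℕ.^ z) (ℕ.^-distribˡ-+-* 2 x y))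
  shuffle : ∀ a b c d e f → a ℕ.* b ℕ.* c ℕ.* (d ℕ.* e ℕ.* f) ≡ (b ℕ.* d) ℕ.* (a ℕ.* e) ℕ.* (f ℕ.* c)
  shuffle = ℕ-Solver.solve-∀
  shuffle′ : ∀ a b c d e → (a ℕ.* b) ℕ.* (c ℕ.* d) ℕ.* e ≡ c ℕ.* a ℕ.* e ℕ.* (d ℕ.* b)
  shuffle′ = ℕ-Solver.solve-∀

infix 8 2^_

-- 2ʸ = lim ⌊m · 2^yₘ⌋ / m
2^_ : ℝ → ℝ
2^ y = real-1/ (λ n → + e n ℚ./ suc n) λ l →
  let T = 2 ℕ.* suc (e N₀)
      k = l ℕ.+ suc T ℕ.* suc l
      N , y-close = y≤ k
  in N₀ ℕ.⊔ (N ℕ.⊔ k) , λ a b p q →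
    let N⊔k≤a = ℕ.m⊔n≤o⇒n≤o N₀ (N ℕ.⊔ k) p
        N⊔k≤b = ℕ.m⊔n≤o⇒n≤o N₀ (N ℕ.⊔ k) q
    in /-≤-/+1/ (e a) a (e b) b l
      (final T l a b (e≤ b (ℕ.m⊔n≤o⇒m≤o N₀ (N ℕ.⊔ k) q)) (ℕ.s≤s (ℕ.m⊔n≤o⇒n≤o N k N⊔k≤b))
        (⌊·2^⌋-close (suc a) (suc b) (seq y a) (seq y b) k
          (y-close a b (ℕ.m⊔n≤o⇒m≤o N k N⊔k≤a) (ℕ.m⊔n≤o⇒m≤o N k N⊔k≤b))))
  where
  open ℕ.≤-Reasoning
  e : ℕ → ℕ
  e n = ⌊ suc n ·2^ seq y n ⌋
  y≤ : ∀ k → ∃ λ N → ∀ m n → N ℕ.≤ m → N ℕ.≤ n → seq y m ℚ.≤ seq y n ℚ.+ + 1 ℚ./ suc k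
  y≤ k =
    let N , close = cauchy y (+ 1 ℚ./ suc k) (ℚ.positive⁻¹ (+ 1 ℚ./ suc k) {{ℚ.normalize-pos 1 (suc k)}})
    in N , λ m n p q → ∣p-q∣≤⇒p≤q+ (seq y m) (seq y n) (+ 1 ℚ./ suc k) (close m n p q)
  N₀ : ℕ
  N₀ = proj₁ (y≤ 0)
  e≤ : ∀ n → N₀ ℕ.≤ n → e n ℕ.≤ suc n ℕ.* (2 ℕ.* suc (e N₀))
  e≤ n N₀≤n = begin
    e n                               ≤⟨ ℕ.m≤m*n (e n) (suc N₀) ⟩
    e n ℕ.* suc N₀                    ≡⟨ ℕ.*-identityʳ (e n ℕ.* suc N₀) ⟨
    e n ℕ.* suc N₀ ℕ.* 1              ≤⟨ ⌊·2^⌋-close (suc n) (suc N₀) (seq y n) (seq y N₀) 0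
                                          (proj₂ (y≤ 0) n N₀ N₀≤n ℕ.≤-refl) ⟩
    suc n ℕ.* suc (e N₀) ℕ.* 2        ≡⟨ regroup (suc n) (suc (e N₀)) ⟩
    suc n ℕ.* (2 ℕ.* suc (e N₀))      ∎
    where
    regroup : ∀ x y → x ℕ.* y ℕ.* 2 ≡ x ℕ.* (2 ℕ.* y)
    regroup = ℕ-Solver.solve-∀
  final : ∀ T l a b → e b ℕ.≤ suc b ℕ.* T → suc (suc T) ℕ.* suc l ℕ.≤ suc b →
          e a ℕ.* suc b ℕ.* (suc (suc T) ℕ.* suc l) ℕ.≤ suc a ℕ.* suc (e b) ℕ.* suc (suc (suc T) ℕ.* suc l) →
          e a ℕ.* (suc b ℕ.* suc l) ℕ.≤ (e b ℕ.* suc l ℕ.+ suc b) ℕ.* suc a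
  final T l a b e≤ K≤b h = ℕ.*-cancelˡ-≤ (suc (suc T)) (begin
    suc (suc T) ℕ.* (e a ℕ.* (suc b ℕ.* suc l))           ≡⟨ eq₁ (suc (suc T)) (e a) (suc b) (suc l) ⟩
    e a ℕ.* suc b ℕ.* K                                   ≤⟨ h ⟩
    suc a ℕ.* suc (e b) ℕ.* suc K                         ≡⟨ eq₂ (suc a) (e b) K ⟩
    suc a ℕ.* (e b ℕ.* K ℕ.+ K ℕ.+ e b ℕ.+ 1)             ≤⟨ ℕ.*-monoʳ-≤ (suc a) (ℕ.+-mono-≤ (ℕ.+-mono-≤
                                                              (ℕ.+-monoʳ-≤ (e b ℕ.* K) K≤b) e≤) (ℕ.s≤s (ℕ.z≤n {b}))) ⟩
    suc a ℕ.* (e b ℕ.* K ℕ.+ suc b ℕ.+ suc b ℕ.* T ℕ.+ suc b)  ≡⟨ eq₃ (suc a) (e b) T (suc l) (suc b) ⟩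
    suc (suc T) ℕ.* ((e b ℕ.* suc l ℕ.+ suc b) ℕ.* suc a)     ∎)
    where
    K : ℕ
    K = suc (suc T) ℕ.* suc l
    eq₁ : ∀ t x y z → t ℕ.* (x ℕ.* (y ℕ.* z)) ≡ x ℕ.* y ℕ.* (t ℕ.* z)
    eq₁ = ℕ-Solver.solve-∀
    eq₂ : ∀ x y z → x ℕ.* suc y ℕ.* suc z ≡ x ℕ.* (y ℕ.* z ℕ.+ z ℕ.+ y ℕ.+ 1)
    eq₂ = ℕ-Solver.solve-∀
    eq₃ : ∀ x y t z w → x ℕ.* (y ℕ.* (suc (suc t) ℕ.* z) ℕ.+ w ℕ.+ w ℕ.* t ℕ.+ w) ≡
          suc (suc t) ℕ.* ((y ℕ.* z ℕ.+ w) ℕ.* x)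
    eq₃ = ℕ-Solver.solve-∀

------------------------------------------------------------------------
-- Linear algebra over the two-element field

F₂ : Set
F₂ = Bool

F₂^_ : ℕ → Set
F₂^ n = Vec F₂ n

F₂^-module : ℕ → RawLeftModule F₂ 0ℓ 0ℓ
F₂^-module n = record
  { Carrierᴹ = F₂^ n
  ; _≈ᴹ_     = _≡_
  ; _+ᴹ_     = zipWith _xor_
  ; _*ₗ_     = λ x → map (x ∧_)
  ; 0ᴹ       = replicate n false
  ; -ᴹ_      = id
  }

module _ {n : ℕ} where
  open RawLeftModule (F₂^-module n) public
    using () renaming (_+ᴹ_ to _⊕_; _*ₗ_ to _⊙_; 0ᴹ to 𝟎)

infix 7 _·_

_·_ : ∀ {n} → F₂^ n → F₂^ n → F₂
u · v = foldr′ _xor_ false (zipWith _∧_ u v)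

-- The space (F₂^h)* of linear functions F₂^h → F₂.

record Dual (h : ℕ) : Set where
  field
    apply       : F₂^ h → F₂
    additive    : ∀ α β → apply (α ⊕ β) ≡ apply α xor apply β
    homogeneous : ∀ x α → apply (x ⊙ α) ≡ x ∧ apply α

open Dual

dualModule : ℕ → RawLeftModule F₂ 0ℓ 0ℓ
dualModule h = record
  { Carrierᴹ = Dual h
  ; _≈ᴹ_     = λ a b → ∀ α → apply a α ≡ apply b α
  ; _+ᴹ_     = λ a b → record
    { apply       = λ α → apply a α xor apply b α
    ; additive    = λ α β → trans (cong₂ _xor_ (additive a α β) (additive b α β))
                                  (interchange (apply a α) (apply a β) (apply b α) (apply b β))
    ; homogeneous = λ x α → trans (cong₂ _xor_ (homogeneous a x α) (homogeneous b x α))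
                                  (sym (Bool.∧-distribˡ-xor x (apply a α) (apply b α)))
    }
  ; _*ₗ_     = λ x a → record
    { apply       = λ α → x ∧ apply a α
    ; additive    = λ α β → trans (cong (x ∧_) (additive a α β))
                                  (Bool.∧-distribˡ-xor x (apply a α) (apply a β))
    ; homogeneous = λ y α → trans (cong (x ∧_) (homogeneous a y α)) (swap x y (apply a α))
    }
  ; 0ᴹ       = record
    { apply       = λ _ → false
    ; additive    = λ _ _ → refl
    ; homogeneous = λ x _ → sym (Bool.∧-zeroʳ x)
    }
  ; -ᴹ_      = id
  }
  where
  interchange : ∀ w x y z → (w xor x) xor (y xor z) ≡ (w xor y) xor (x xor z)
  interchange w x y z = trans (Bool.xor-assoc w x (y xor z)) (trans (cong (w xor_) (
    trans (sym (Bool.xor-assoc x y z)) (trans (cong (_xor z) (Bool.xor-comm x y)) (Bool.xor-assoc y x z))))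
    (sym (Bool.xor-assoc w y (x xor z))))
  swap : ∀ x y z → x ∧ (y ∧ z) ≡ y ∧ (x ∧ z)
  swap x y z = trans (sym (Bool.∧-assoc x y z)) (trans (cong (_∧ z) (Bool.∧-comm x y)) (Bool.∧-assoc y x z))

module _ (V : RawLeftModule F₂ 0ℓ 0ℓ) where
  open RawLeftModule V

  linearCombination : ∀ {k} → (Fin k → F₂) → (Fin k → Carrierᴹ) → Carrierᴹ
  linearCombination x v = sum +ᴹ-rawMonoid λ i → x i *ₗ v i

  LinearlyIndependent : ∀ {k} → (Fin k → Carrierᴹ) → Set
  LinearlyIndependent v = ∀ x → linearCombination x v ≈ᴹ 0ᴹ → ∀ i → x i ≡ false

  Spanning : ∀ {k} → (Fin k → Carrierᴹ) → Set
  Spanning v = ∀ w → ∃ λ x → linearCombination x v ≈ᴹ w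

  -- A finite set of vectors is enumerated without repetition by v; its
  -- subsets of size m are the v ∘ ι with ι : Fin m → Fin k injective.

  Distinct : ∀ {k} → (Fin k → Carrierᴹ) → Set
  Distinct v = Injective _≡_ _≈ᴹ_ v

  WiseIndependent : ℕ → ∀ {k} → (Fin k → Carrierᴹ) → Set
  WiseIndependent d {k} v = ∀ m → m ℕ.< d → (ι : Fin m → Fin k) → Injective _≡_ _≡_ ι →
                            LinearlyIndependent (v ∘ ι)

IsMinimum : Pred ℕ 0ℓ → Pred ℕ 0ℓ
IsMinimum P m = P m × (∀ k → P k → m ℕ.≤ k)

-- A Subset N is a vector of booleans, so S also serves as the vector of
-- coefficients selecting the elements of S.
IsRank : ∀ {h N} → (Fin N → Dual h) → Dual h → ℕ → Set
IsRank {h} {N} B a = IsMinimum λ r → ∃ λ (S : Subset N) →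
  ∣ S ∣ ≡ r × (∀ α → apply (linearCombination (dualModule h) (lookup S) B) α ≡ apply a α)

------------------------------------------------------------------------
-- Probability distributions on F₂^n

∑ : ∀ {n} → (F₂^ n → ℝ) → ℝ
∑ {zero}  f = f []
∑ {suc n} f = ∑ (λ α → f (false ∷ α)) + ∑ (λ α → f (true ∷ α))

record Distribution (n : ℕ) : Set where
  field
    mass        : F₂^ n → ℝ
    nonNegative : ∀ α → 0ℝ ≤ mass α
    total       : ∑ mass ≈ 1ℝ

open Distribution

𝔼 : ∀ {n} → Distribution n → (F₂^ n → ℝ) → ℝ
𝔼 D f = ∑ λ α → mass D α * f α

Pr[_⇐_] : ∀ {n} → (F₂^ n → Bool) → Distribution n → ℝ
Pr[ event ⇐ D ] = 𝔼 D λ α → if event α then 1ℝ else 0ℝ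

------------------------------------------------------------------------
-- Linear codes and local testability

-- Closure under scalars is automatic over F₂.
record LinearCode (n : ℕ) : Set₁ where
  field
    Codeword : Pred (F₂^ n) 0ℓ
    0-closed : Codeword 𝟎
    ⊕-closed : ∀ {u v} → Codeword u → Codeword v → Codeword (u ⊕ v)

open LinearCode

HasDimension : ∀ {n} → LinearCode n → ℕ → Set
HasDimension {n} C k = ∃ λ (v : Fin k → F₂^ n) →
  (∀ i → Codeword C (v i)) ×
  LinearlyIndependent (F₂^-module n) v ×
  (∀ w → Codeword C w → ∃ λ x → linearCombination (F₂^-module n) x v ≡ w)

DualCodeword : ∀ {n} → LinearCode n → Pred (F₂^ n) 0ℓ
DualCodeword C α = ∀ c → Codeword C c → α · c ≡ false

-- The weight of u ⊕ v: ∣_∣ counts the entries that are true.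
hamming : ∀ {n} → F₂^ n → F₂^ n → ℕ
hamming u v = ∣ u ⊕ v ∣

MinimumDistance≥ : ∀ {n} → LinearCode n → ℕ → Set
MinimumDistance≥ C d = ∀ u v → Codeword C u → Codeword C v → u ≢ v → d ℕ.≤ hamming u v

IsDistanceTo : ∀ {n} → LinearCode n → F₂^ n → ℕ → Set
IsDistanceTo C v = IsMinimum λ m → ∃ λ c → Codeword C c × hamming v c ≡ m

record Tester {n} (C : LinearCode n) : Set where
  field
    distribution : Distribution n
    supported    : ∀ α → ¬ DualCodeword C α → mass distribution α ≈ 0ℝ

open Tester

Smoothness : ∀ {n} {C : LinearCode n} → Tester C → ℝ → Set
Smoothness {n} D₀ ε = ∀ i → Pr[ (λ α → lookup α i) ⇐ distribution D₀ ] ≤ ε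

Soundness : ∀ {n} {C : LinearCode n} → Tester C → ℝ → Set
Soundness {C = C} D₀ δ = ∀ v m → IsDistanceTo C v m →
  δ * fromℕ m ≤ Pr[ (λ α → α · v) ⇐ distribution D₀ ]

LocallyTestable : ∀ {n} → LinearCode n → ℝ → ℝ → Set
LocallyTestable C ε δ = ∃ λ (D₀ : Tester C) → Smoothness D₀ ε × Soundness D₀ δ

------------------------------------------------------------------------
-- Cayley graphs on F₂^h

record CayleyGraph (h : ℕ) : Set where
  constructor Cay
  field
    generators : Distribution h

  weight : F₂^ h → F₂^ h → ℝ
  weight α β = mass generators (α ⊕ β)

open CayleyGraph

[-1]^_ : F₂ → ℝ
[-1]^ false = 1ℝ
[-1]^ true  = - 1ℝ

-- The eigenvalue belonging to the character α ↦ (-1)^b(α).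
eigenvalue : ∀ {h} → CayleyGraph h → Dual h → ℝ
eigenvalue G b = 𝔼 (generators G) λ α → [-1]^ apply b α

SpectrumGenerator : ∀ {h N} → CayleyGraph h → (Fin N → Dual h) → ℝ → ℝ → Set
SpectrumGenerator G B μ ν =
  (∀ i → 1ℝ - μ ≤ eigenvalue G (B i)) ×
  (∀ a r → IsRank B a r → eigenvalue G a ≤ 1ℝ - ν * fromℕ r)

InfinitelyMany : ∀ {ℓ} → Pred ℕ ℓ → Set ℓ
InfinitelyMany P = ∀ N → ∃ λ n → N ℕ.≤ n × P n

{-# OPTIONS --safe #-}
-- Enumerate B* as b₁, …, bₙ and let φ(β) = (b₁(β), …, bₙ(β)).  If B* spans the
-- dual space, φ embeds F₂^h into F₂^n, and its image is the dual of the code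
-- C = {v | Σ vᵢ bᵢ = 0}, which has codimension h.  Codewords are the linear
-- dependencies among the bᵢ, so minimum distance becomes wise independence, and
-- the distance from v to C is the rank of b = Σ vᵢ bᵢ.  A tester for C is a
-- distribution D on F₂^h with Pr[φ(β) · v = 1] = Pr[b(β) = 1] = (1 - λ(b)) / 2.
-- The factor 2 is absorbed by the constant when passing from graphs to codes; in
-- the other direction the random walk is made lazy, which turns λ into
-- (1 + λ) / 2.

module Submission where

open import Data.Bool.Base using (Bool; true; false; _∧_; _xor_; if_then_else_)
import Data.Bool.Properties as Bool
open import Data.Bool.Solver using (module xor-∧-Solver)
open import Data.Fin.Base using (Fin; zero; suc; funToFin; finToFun; combine)
import Data.Fin.Properties as Fin
open import Data.Fin.Subset using (Subset; ∣_∣; ⁅_⁆)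
open import Data.Fin.Subset.Properties using (∣⊥∣≡0; ∣⁅x⁆∣≡1)
open import Data.Integer.Base as ℤ using (+_)
import Data.Integer.GCD as ℤ
import Data.Integer.Properties as ℤ
import Data.Integer.Tactic.RingSolver as ℤ-Solver
open import Data.Nat.Base as ℕ using (ℕ; zero; suc)
open import Data.Nat.Logarithm using (⌊log₂_⌋)
import Data.Nat.Properties as ℕ
import Data.Nat.Tactic.RingSolver as ℕ-Solver
open import Data.Product.Base using (_×_; _,_; ∃; proj₁; proj₂; map₂)
open import Data.Rational.Base as ℚ using (ℚ; 0ℚ; 1ℚ; ½; toℚᵘ; ↥_; ↧_; ↧ₙ_)
import Data.Rational.Properties as ℚ
open import Data.Rational.Solver using (module +-*-Solver)
open import Data.Rational.Unnormalised.Base as ℚᵘ using (mkℚᵘ)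
import Data.Rational.Unnormalised.Properties as ℚᵘ
open import Data.Sum.Base using (_⊎_; inj₁; inj₂; map₁)
open import Data.Vec.Base using ([]; _∷_; lookup; tabulate; _++_; take; drop)
import Data.Vec.Properties as Vec
open import Function.Base using (_∘_; id; _$_)
open import Function.Bundles using (_⇔_; mk⇔; Inverse; Equivalence)
open import Function.Definitions using (Injective)
open import Level using (0ℓ)
open import Relation.Binary.PropositionalEquality
open import Relation.Nullary.Decidable using (Dec; yes; no; does; dec-false; map′; _⊎-dec_; _×-dec_)
open import Relation.Nullary.Negation using (contradiction)
open import Relation.Unary using (Pred; Decidable)
open import Defs

open ℝ
open Dual
open LinearCode
open Distribution
open CayleyGraph
open Tester

-- The factor 2 is treated differently in the two directions because ε is shared by both sides and
-- only γ may change. Smoothness ε alone gives λ(bᵢ) ≥ 1 - 2ε, which is too weak; for the lazy walk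
-- 1 - λ(b) is Pr[b = 1] itself, so both bounds carry over with the same constants. Conversely,
-- λ(bᵢ) ≥ 1 - ε gives even Pr ≤ ε / 2, and halving γ′ pays for the soundness. The size condition is
-- the dimension condition: dim C + h = n turns n - c log₂ n ≤ dim C into h ≤ c log₂ n, that is
-- 2^(h/c) ≤ n. "Infinitely many" transfers because n ≤ 2^h (the bᵢ are distinct) and h ≤ n (they
-- span). Everything is constructive. A code is an arbitrary predicate, so membership has to be
-- decided, by a basis or by exhaustive search, before parity checks or bases can be computed. The
-- total mass of a distribution is 1 only up to `≈`, so the eigenvalue identities are stated term by
-- term and keep the total as a separate quantity.

private variable
  m n k h : ℕ

-- Linear algebra over F₂

xor-interchange : ∀ a b c d → (a xor b) xor (c xor d) ≡ (a xor c) xor (b xor d)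
xor-interchange = solve 4 (λ a b c d → (a :+ b) :+ (c :+ d) := (a :+ c) :+ (b :+ d)) refl
  where open xor-∧-Solver

xor≡false⇒≡ : ∀ a b → a xor b ≡ false → a ≡ b
xor≡false⇒≡ false false _ = refl
xor≡false⇒≡ true  true  _ = refl

⊕-assoc : (u v w : F₂^ n) → (u ⊕ v) ⊕ w ≡ u ⊕ (v ⊕ w)
⊕-assoc = Vec.zipWith-assoc Bool.xor-assoc

⊕-identityˡ : (v : F₂^ n) → 𝟎 ⊕ v ≡ v
⊕-identityˡ = Vec.zipWith-identityˡ Bool.xor-identityˡ

⊕-identityʳ : (v : F₂^ n) → v ⊕ 𝟎 ≡ v
⊕-identityʳ = Vec.zipWith-identityʳ Bool.xor-identityʳ

⊕-self : (v : F₂^ n) → v ⊕ v ≡ 𝟎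
⊕-self []      = refl
⊕-self (x ∷ v) = cong₂ _∷_ (Bool.xor-same x) (⊕-self v)

⊕-interchange : (a b c d : F₂^ n) → (a ⊕ b) ⊕ (c ⊕ d) ≡ (a ⊕ c) ⊕ (b ⊕ d)
⊕-interchange []      []      []      []      = refl
⊕-interchange (w ∷ a) (x ∷ b) (y ∷ c) (z ∷ d) = cong₂ _∷_ (xor-interchange w x y z) (⊕-interchange a b c d)

⊕-cancel : (u v : F₂^ n) → u ⊕ (u ⊕ v) ≡ v
⊕-cancel u v = trans (sym (⊕-assoc u u v)) (trans (cong (_⊕ v) (⊕-self u)) (⊕-identityˡ v))

⊕≡𝟎⇒≡ : (u v : F₂^ n) → u ⊕ v ≡ 𝟎 → u ≡ v
⊕≡𝟎⇒≡ u v eq = trans (sym (⊕-identityʳ u)) (trans (cong (u ⊕_) (sym eq)) (⊕-cancel u v))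

⊙-distribʳ : ∀ x y (v : F₂^ n) → (x xor y) ⊙ v ≡ (x ⊙ v) ⊕ (y ⊙ v)
⊙-distribʳ x y []      = refl
⊙-distribʳ x y (z ∷ v) = cong₂ _∷_ (Bool.∧-distribʳ-xor z x y) (⊙-distribʳ x y v)

true-⊙ : (v : F₂^ n) → true ⊙ v ≡ v
true-⊙ = Vec.map-id

false-⊙ : (v : F₂^ n) → false ⊙ v ≡ 𝟎
false-⊙ []      = refl
false-⊙ (x ∷ v) = cong (false ∷_) (false-⊙ v)

_≟_ : (u v : F₂^ n) → Dec (u ≡ v)
_≟_ = Vec.≡-dec Bool._≟_

any? : {P : Pred (F₂^ n) 0ℓ} → Decidable P → Dec (∃ P)
any? {zero}  P? = map′ ([] ,_) (λ { ([] , p) → p }) (P? [])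
any? {suc n} P? = map′
  (λ { (inj₁ (v , p)) → false ∷ v , p ; (inj₂ (v , p)) → true ∷ v , p })
  (λ { (false ∷ v , p) → inj₁ (v , p) ; (true ∷ v , p) → inj₂ (v , p) })
  (any? (P? ∘ (false ∷_)) ⊎-dec any? (P? ∘ (true ∷_)))

all? : {P : Pred (F₂^ n) 0ℓ} → Decidable P → Dec (∀ v → P v)
all? {zero}  P? = map′ (λ { p [] → p }) (_$ []) (P? [])
all? {suc n} P? = map′
  (λ { (p , q) (false ∷ v) → p v ; (p , q) (true ∷ v) → q v })
  (λ f → f ∘ (false ∷_) , f ∘ (true ∷_))
  (all? (P? ∘ (false ∷_)) ×-dec all? (P? ∘ (true ∷_)))

-- Over F₂ additivity implies homogeneity.

Additive : (F₂^ m → F₂^ n) → Set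
Additive f = ∀ u v → f (u ⊕ v) ≡ f u ⊕ f v

Additive-𝟎 : {f : F₂^ m → F₂^ n} → Additive f → f 𝟎 ≡ 𝟎
Additive-𝟎 {f = f} f-add = begin
  f 𝟎              ≡⟨ cong f (⊕-self 𝟎) ⟨
  f (𝟎 ⊕ 𝟎)        ≡⟨ f-add 𝟎 𝟎 ⟩
  f 𝟎 ⊕ f 𝟎        ≡⟨ ⊕-self (f 𝟎) ⟩
  𝟎                ∎
  where open ≡-Reasoning

·-comm : (u v : F₂^ n) → u · v ≡ v · u
·-comm []      []      = refl
·-comm (x ∷ u) (y ∷ v) = cong₂ _xor_ (Bool.∧-comm x y) (·-comm u v)

·-zeroʳ : (u : F₂^ n) → u · 𝟎 ≡ false
·-zeroʳ []      = refl
·-zeroʳ (x ∷ u) = cong₂ _xor_ (Bool.∧-zeroʳ x) (·-zeroʳ u)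

·-distribˡ-⊕ : (u v w : F₂^ n) → u · (v ⊕ w) ≡ (u · v) xor (u · w)
·-distribˡ-⊕ []      []      []      = refl
·-distribˡ-⊕ (x ∷ u) (y ∷ v) (z ∷ w) = begin
  (x ∧ (y xor z)) xor (u · (v ⊕ w))
    ≡⟨ cong₂ _xor_ (Bool.∧-distribˡ-xor x y z) (·-distribˡ-⊕ u v w) ⟩
  ((x ∧ y) xor (x ∧ z)) xor ((u · v) xor (u · w))
    ≡⟨ xor-interchange (x ∧ y) (x ∧ z) (u · v) (u · w) ⟩
  ((x ∧ y) xor (u · v)) xor ((x ∧ z) xor (u · w))   ∎
  where open ≡-Reasoning

·-⊙ : ∀ x (u v : F₂^ n) → u · (x ⊙ v) ≡ x ∧ (u · v)
·-⊙ false u v = trans (cong (u ·_) (false-⊙ v)) (·-zeroʳ u)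
·-⊙ true  u v = cong (u ·_) (true-⊙ v)

·-⁅⁆ : ∀ (u : F₂^ n) i → u · ⁅ i ⁆ ≡ lookup u i
·-⁅⁆ (x ∷ u) zero    = trans (cong₂ _xor_ (Bool.∧-identityʳ x) (·-zeroʳ u)) (Bool.xor-identityʳ x)
·-⁅⁆ (x ∷ u) (suc i) = trans (cong (_xor (u · ⁅ i ⁆)) (Bool.∧-zeroʳ x)) (·-⁅⁆ u i)

·-injectiveˡ : {u w : F₂^ n} → (∀ v → u · v ≡ w · v) → u ≡ w
·-injectiveˡ {u = u} {w} eq = begin
  u                       ≡⟨ Vec.tabulate∘lookup u ⟨
  tabulate (lookup u)     ≡⟨ Vec.tabulate-cong (λ i → trans (sym (·-⁅⁆ u i)) (trans (eq ⁅ i ⁆) (·-⁅⁆ w i))) ⟩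
  tabulate (lookup w)     ≡⟨ Vec.tabulate∘lookup w ⟩
  w                       ∎
  where open ≡-Reasoning

riesz : (F₂^ n → F₂) → F₂^ n
riesz f = tabulate (f ∘ ⁅_⁆)

-- Since `x ∷ v` is `(x ∷ 𝟎) ⊕ (false ∷ v)`, additivity reduces the claim to the first unit vector
-- and to the restriction of `f` to words with leading zero.
riesz-· : {f : F₂^ n → F₂} → (∀ u v → f (u ⊕ v) ≡ f u xor f v) → ∀ v → riesz f · v ≡ f v
riesz-· {f = f} f-add [] = begin
  false             ≡⟨ Bool.xor-same (f []) ⟨
  f [] xor f []     ≡⟨ f-add [] [] ⟨
  f []              ∎
  where open ≡-Reasoning
riesz-· {f = f} f-add (x ∷ v) = begin
  (f ⁅ zero ⁆ ∧ x) xor (riesz (f ∘ (false ∷_)) · v)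
    ≡⟨ cong₂ _xor_ (head x) (riesz-· (λ u w → f-add (false ∷ u) (false ∷ w)) v) ⟩
  f (x ∷ 𝟎) xor f (false ∷ v)
    ≡⟨ f-add (x ∷ 𝟎) (false ∷ v) ⟨
  f ((x xor false) ∷ (𝟎 ⊕ v))
    ≡⟨ cong f (cong₂ _∷_ (Bool.xor-identityʳ x) (⊕-identityˡ v)) ⟩
  f (x ∷ v) ∎
  where
  open ≡-Reasoning
  f𝟎 : f 𝟎 ≡ false
  f𝟎 = trans (cong f (sym (⊕-self 𝟎))) (trans (f-add 𝟎 𝟎) (Bool.xor-same (f 𝟎)))
  head : ∀ x → f ⁅ zero ⁆ ∧ x ≡ f (x ∷ 𝟎)
  head false = trans (Bool.∧-zeroʳ _) (sym f𝟎)
  head true  = Bool.∧-identityʳ _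

infix 9 _ᵀ

-- The adjoint for the dot product, obtained without matrices: `(f ᵀ) β` represents the functional v
-- ↦ β · f v.
_ᵀ : (F₂^ m → F₂^ n) → F₂^ n → F₂^ m
(f ᵀ) β = riesz (λ v → β · f v)

ᵀ-· : {f : F₂^ m → F₂^ n} → Additive f → ∀ β v → (f ᵀ) β · v ≡ β · f v
ᵀ-· {f = f} f-add β = riesz-· λ u v →
  trans (cong (β ·_) (f-add u v)) (·-distribˡ-⊕ β (f u) (f v))

lc-cong : (v : Fin k → F₂^ n) {x y : Fin k → F₂} → x ≗ y →
          linearCombination (F₂^-module n) x v ≡ linearCombination (F₂^-module n) y v
lc-cong {zero}  v x≗y = refl
lc-cong {suc k} v x≗y = cong₂ _⊕_ (cong (_⊙ v zero) (x≗y zero)) (lc-cong (v ∘ suc) (x≗y ∘ suc))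

lc-xor : (v : Fin k → F₂^ n) (x y : Fin k → F₂) →
         linearCombination (F₂^-module n) (λ i → x i xor y i) v ≡
         linearCombination (F₂^-module n) x v ⊕ linearCombination (F₂^-module n) y v
lc-xor {zero}  v x y = sym (⊕-self 𝟎)
lc-xor {suc k} v x y = trans
  (cong₂ _⊕_ (⊙-distribʳ (x zero) (y zero) (v zero)) (lc-xor (v ∘ suc) (x ∘ suc) (y ∘ suc)))
  (⊕-interchange (x zero ⊙ v zero) (y zero ⊙ v zero) _ _)

lc-∷ : ∀ (x : Fin k → F₂) (v : Fin k → F₂^ n) →
       linearCombination (F₂^-module (suc n)) x ((false ∷_) ∘ v) ≡
       false ∷ linearCombination (F₂^-module n) x v
lc-∷ {zero}  x v = refl
lc-∷ {suc k} x v = trans (cong (((x zero ∧ false) ∷ (x zero ⊙ v zero)) ⊕_) (lc-∷ (x ∘ suc) (v ∘ suc)))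
  (cong₂ _∷_ (trans (Bool.xor-identityʳ _) (Bool.∧-zeroʳ (x zero))) refl)

-- Bases and parity checks of a code

⊙-closed : (C : LinearCode n) → ∀ x {v} → Codeword C v → Codeword C (x ⊙ v)
⊙-closed C false {v} _ = subst (Codeword C) (sym (false-⊙ v)) (0-closed C)
⊙-closed C true  {v} p = subst (Codeword C) (sym (true-⊙ v)) p

lc-closed : (C : LinearCode n) (x : Fin k → F₂) {v : Fin k → F₂^ n} → (∀ i → Codeword C (v i)) →
            Codeword C (linearCombination (F₂^-module n) x v)
lc-closed {k = zero}  C x p = 0-closed C
lc-closed {k = suc k} C x p = ⊕-closed C (⊙-closed C (x zero) (p zero)) (lc-closed C (x ∘ suc) (p ∘ suc))

-- Coefficient vectors over a basis form the finite set `F₂^ k`, so the search for a representation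
-- of `w` terminates.
Codeword? : (C : LinearCode n) → HasDimension C k → Decidable (Codeword C)
Codeword? {n} C (v , v∈C , _ , span) w = map′
  (λ { (x , eq) → subst (Codeword C) eq (lc-closed C (lookup x) v∈C) })
  (λ w∈C → let x , eq = span w w∈C in tabulate x , trans (lc-cong v (Vec.lookup∘tabulate x)) eq)
  (any? λ x → linearCombination (F₂^-module n) (lookup x) v ≟ w)

-- Either no codeword starts with `true` and this subcode is all of `C`, or `C` is generated by it
-- together with any one codeword starting with `true`. Bases and parity checks are both built on
-- this dichotomy.
shorten : LinearCode (suc n) → LinearCode n
shorten C = record
  { Codeword = Codeword C ∘ (false ∷_)
  ; 0-closed = 0-closed C
  ; ⊕-closed = ⊕-closed C
  }

hasDimension : (C : LinearCode n) → Decidable (Codeword C) → ∃ λ k → HasDimension C k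
hasDimension {zero}  C C? = 0 , (λ ()) , (λ ()) , (λ _ _ ()) , λ { [] _ → (λ ()) , refl }
hasDimension {suc n} C C? with hasDimension (shorten C) (C? ∘ (false ∷_)) | any? (C? ∘ (true ∷_))
... | k , v , v∈C , indep , span | no ¬∃ =
  k , (false ∷_) ∘ v , v∈C ,
  (λ x eq → indep x (Vec.∷-injectiveʳ (trans (sym (lc-∷ x v)) eq))) ,
  λ { (false ∷ w) w∈C → map₂ (λ {x} eq → trans (lc-∷ x v) (cong (false ∷_) eq)) (span w w∈C)
    ; (true  ∷ w) w∈C → contradiction (w , w∈C) ¬∃ }
... | k , v , v∈C , indep , span | yes (u , u∈C) = suc k , v′ , v′∈C , indep′ , span′
  where
  v′ : Fin (suc k) → F₂^ (suc n)
  v′ zero    = true ∷ u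
  v′ (suc i) = false ∷ v i
  v′∈C : ∀ i → Codeword C (v′ i)
  v′∈C zero    = u∈C
  v′∈C (suc i) = v∈C i
  lc′ : ∀ x → linearCombination (F₂^-module (suc n)) x v′ ≡
              x zero ∷ ((x zero ⊙ u) ⊕ linearCombination (F₂^-module n) (x ∘ suc) v)
  lc′ x = trans (cong ((x zero ⊙ (true ∷ u)) ⊕_) (lc-∷ (x ∘ suc) v))
    (cong₂ _∷_ (trans (Bool.xor-identityʳ _) (Bool.∧-identityʳ (x zero))) refl)
  indep′ : LinearlyIndependent (F₂^-module (suc n)) v′
  indep′ x eq = λ { zero → x₀ ; (suc i) → indep (x ∘ suc) lc≡𝟎 i }
    where
    x₀ : x zero ≡ false
    x₀ = Vec.∷-injectiveˡ (trans (sym (lc′ x)) eq)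
    lc≡𝟎 : linearCombination (F₂^-module n) (x ∘ suc) v ≡ 𝟎
    lc≡𝟎 = begin
      linearCombination (F₂^-module n) (x ∘ suc) v
        ≡⟨ ⊕-identityˡ _ ⟨
      𝟎 ⊕ linearCombination (F₂^-module n) (x ∘ suc) v
        ≡⟨ cong (_⊕ _) (trans (cong (_⊙ u) x₀) (false-⊙ u)) ⟨
      (x zero ⊙ u) ⊕ linearCombination (F₂^-module n) (x ∘ suc) v
        ≡⟨ Vec.∷-injectiveʳ (trans (sym (lc′ x)) eq) ⟩
      𝟎 ∎
      where open ≡-Reasoning
  span′ : ∀ w → Codeword C w → ∃ λ x → linearCombination (F₂^-module (suc n)) x v′ ≡ w
  span′ (b ∷ w) w∈C =
    -- Adding `b ⊙ (true ∷ u)` clears the leading coordinate, which leaves a word of the shortened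
    -- code.
    let x , eq = span ((b ⊙ u) ⊕ w) (subst (λ c → Codeword C (c ∷ ((b ⊙ u) ⊕ w)))
                   (trans (cong (_xor b) (Bool.∧-identityʳ b)) (Bool.xor-same b))
                   (⊕-closed C (⊙-closed C b u∈C) w∈C))
        x′ = λ { zero → b ; (suc i) → x i }
    in x′ , trans (lc′ x′) (cong (b ∷_) (trans (cong ((b ⊙ u) ⊕_) eq) (⊕-cancel (b ⊙ u) w)))

-- A linear surjection with kernel `C`. Surjectivity is given by a linear right inverse because the
-- transpose of that inverse later carries dual codewords back to F₂^h.
record ParityCheck (C : LinearCode n) : Set where
  field
    {redundancy}     : ℕ
    syndrome         : F₂^ n → F₂^ redundancy
    syndrome-add     : Additive syndrome
    section          : F₂^ redundancy → F₂^ n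
    section-add      : Additive section
    syndrome-section : ∀ z → syndrome (section z) ≡ z
    codeword⇒        : ∀ {v} → Codeword C v → syndrome v ≡ 𝟎
    codeword⇐        : ∀ {v} → syndrome v ≡ 𝟎 → Codeword C v

open ParityCheck

-- If no codeword starts with `true`, the first coordinate is itself one more check. Otherwise a
-- codeword `true ∷ u` can clear that coordinate, and the checks of the shortened code suffice.
parityCheck : (C : LinearCode n) → Decidable (Codeword C) → ParityCheck C
parityCheck {zero} C C? = record
  { redundancy = 0 ; syndrome = id ; section = id
  ; syndrome-add = λ _ _ → refl ; section-add = λ _ _ → refl ; syndrome-section = λ _ → refl
  ; codeword⇒ = λ { {[]} _ → refl } ; codeword⇐ = λ { {[]} _ → 0-closed C } }
parityCheck {suc n} C C? with parityCheck (shorten C) (C? ∘ (false ∷_)) | any? (C? ∘ (true ∷_))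
... | P | no ¬∃ = record
  { redundancy       = suc (redundancy P)
  ; syndrome         = λ { (b ∷ v) → b ∷ syndrome P v }
  ; syndrome-add     = λ { (b ∷ u) (c ∷ v) → cong ((b xor c) ∷_) (syndrome-add P u v) }
  ; section          = λ { (b ∷ z) → b ∷ section P z }
  ; section-add      = λ { (b ∷ u) (c ∷ v) → cong ((b xor c) ∷_) (section-add P u v) }
  ; syndrome-section = λ { (b ∷ z) → cong (b ∷_) (syndrome-section P z) }
  ; codeword⇒        = λ { {false ∷ v} p → cong (false ∷_) (codeword⇒ P p)
                         ; {true ∷ v}  p → contradiction (v , p) ¬∃ }
  ; codeword⇐        = λ { {false ∷ v} eq → codeword⇐ P (Vec.∷-injectiveʳ eq) }
  }
... | P | yes (u , u∈C) = record
  { redundancy       = redundancy P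
  ; syndrome         = σ
  ; syndrome-add     = σ-add
  ; section          = λ z → false ∷ section P z
  ; section-add      = λ u v → cong (false ∷_) (section-add P u v)
  ; syndrome-section = λ z → trans (cong (syndrome P) (trans (cong (_⊕ _) (false-⊙ u)) (⊕-identityˡ _)))
                                   (syndrome-section P z)
  ; codeword⇒        = λ { {b ∷ v} p → codeword⇒ P (subst (λ c → Codeword C (c ∷ ((b ⊙ u) ⊕ v))) (head b)
                                         (⊕-closed C (⊙-closed C b u∈C) p)) }
  ; codeword⇐        = λ { {b ∷ v} eq → subst (Codeword C) (cong₂ _∷_ (tail b) (⊕-cancel (b ⊙ u) v))
                                         (⊕-closed C (⊙-closed C b u∈C) (codeword⇐ P eq)) }
  }
  where
  -- Adding a multiple of `true ∷ u` does not change membership in `C` and makes the first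
  -- coordinate zero.
  σ : F₂^ (suc n) → F₂^ (redundancy P)
  σ (b ∷ v) = syndrome P ((b ⊙ u) ⊕ v)
  σ-add : Additive σ
  σ-add (b ∷ v) (c ∷ w) = trans
    (cong (syndrome P) (trans (cong (_⊕ (v ⊕ w)) (⊙-distribʳ b c u)) (⊕-interchange (b ⊙ u) (c ⊙ u) v w)))
    (syndrome-add P ((b ⊙ u) ⊕ v) ((c ⊙ u) ⊕ w))
  head : ∀ b → (b ∧ true) xor b ≡ false
  head b = trans (cong (_xor b) (Bool.∧-identityʳ b)) (Bool.xor-same b)
  tail : ∀ b → (b ∧ true) xor false ≡ b
  tail b = trans (Bool.xor-identityʳ _) (Bool.∧-identityʳ b)

-- Comparing dimensions by counting

toFin : F₂^ n → Fin (2 ℕ.^ n)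
toFin v = funToFin (Inverse.from Fin.2↔Bool ∘ lookup v)

fromFin : Fin (2 ℕ.^ n) → F₂^ n
fromFin {n} i = tabulate (Inverse.to Fin.2↔Bool ∘ finToFun {2} {n} i)

fromFin-toFin : (v : F₂^ n) → fromFin (toFin v) ≡ v
fromFin-toFin v = trans
  (Vec.tabulate-cong λ i → trans (cong (Inverse.to Fin.2↔Bool) (Fin.finToFun-funToFin (Inverse.from Fin.2↔Bool ∘ lookup v) i))
                                 (Inverse.strictlyInverseˡ Fin.2↔Bool (lookup v i)))
  (Vec.tabulate∘lookup v)

toFin-injective : Injective _≡_ _≡_ (toFin {n})
toFin-injective {x = u} {v} eq = trans (sym (fromFin-toFin u)) (trans (cong fromFin eq) (fromFin-toFin v))

fromFin-injective : Injective _≡_ _≡_ (fromFin {n})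
fromFin-injective {n} {i} {j} eq = trans (sym (sec i)) (trans (cong toFin eq) (sec j))
  where
  funToFin-cong : ∀ {m n} {f g : Fin m → Fin n} → f ≗ g → funToFin f ≡ funToFin g
  funToFin-cong {zero}  e = refl
  funToFin-cong {suc m} e = cong₂ combine (e zero) (funToFin-cong (e ∘ suc))
  sec : ∀ i → toFin (fromFin {n} i) ≡ i
  sec i = trans
    (funToFin-cong {m = n} {g = finToFun {2} {n} i} λ j → trans
      (cong (Inverse.from Fin.2↔Bool) (Vec.lookup∘tabulate (Inverse.to Fin.2↔Bool ∘ finToFun {2} {n} i) j))
      (Inverse.strictlyInverseʳ Fin.2↔Bool (finToFun {2} {n} i j)))
    (Fin.funToFin-finToFin {n} {2} i)

-- The pigeonhole principle for 2^m and 2^n elements. It takes the place of an exchange argument and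
-- asks nothing of `f` beyond injectivity.
F₂^-injective⇒≤ : {f : F₂^ m → F₂^ n} → Injective _≡_ _≡_ f → m ℕ.≤ n
F₂^-injective⇒≤ {m} {n} inj = ℕ.≮⇒≥ λ n<m → ℕ.<⇒≱ (ℕ.^-monoʳ-< 2 (ℕ.s≤s (ℕ.s≤s ℕ.z≤n)) n<m)
  (Fin.injective⇒≤ (fromFin-injective ∘ inj ∘ toFin-injective))

-- Codes as kernels

weight-⊕ : (u v : F₂^ n) → ∣ u ⊕ v ∣ ℕ.≤ ∣ u ∣ ℕ.+ ∣ v ∣
weight-⊕ []          []          = ℕ.z≤n
weight-⊕ (false ∷ u) (false ∷ v) = weight-⊕ u v
weight-⊕ (false ∷ u) (true ∷ v)  = ℕ.≤-trans (ℕ.s≤s (weight-⊕ u v)) (ℕ.≤-reflexive (sym (ℕ.+-suc ∣ u ∣ ∣ v ∣)))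
weight-⊕ (true ∷ u)  (false ∷ v) = ℕ.s≤s (weight-⊕ u v)
weight-⊕ (true ∷ u)  (true ∷ v)  = ℕ.≤-trans (weight-⊕ u v) (ℕ.m≤n⇒m≤1+n (ℕ.+-monoʳ-≤ ∣ u ∣ (ℕ.n≤1+n ∣ v ∣)))

weight≡0⇒≡𝟎 : (v : F₂^ n) → ∣ v ∣ ≡ 0 → v ≡ 𝟎
weight≡0⇒≡𝟎 []          _  = refl
weight≡0⇒≡𝟎 (false ∷ v) eq = cong (false ∷_) (weight≡0⇒≡𝟎 v eq)

lookup-⁅⁆ : (i : Fin n) → lookup ⁅ i ⁆ i ≡ true
lookup-⁅⁆ zero    = refl
lookup-⁅⁆ (suc i) = lookup-⁅⁆ i

lookup-⁅⁆-≢ : {i j : Fin n} → i ≢ j → lookup ⁅ i ⁆ j ≡ false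
lookup-⁅⁆-≢ {i = zero}  {zero}  i≢j = contradiction refl i≢j
lookup-⁅⁆-≢ {i = zero}  {suc j} i≢j = Vec.lookup-replicate j false
lookup-⁅⁆-≢ {i = suc i} {zero}  i≢j = refl
lookup-⁅⁆-≢ {i = suc i} {suc j} i≢j = lookup-⁅⁆-≢ (i≢j ∘ cong suc)

-- Turns coefficients for the subfamily `B ∘ ι` into coefficients for all of `B`: for injective `ι`,
-- the word with `x j` at position `ι j` and zeros elsewhere.
scatter : (Fin m → F₂) → (Fin m → Fin n) → F₂^ n
scatter {n = n} x ι = linearCombination (F₂^-module n) x (⁅_⁆ ∘ ι)

scatter-weight : (x : Fin m → F₂) (ι : Fin m → Fin n) → ∣ scatter x ι ∣ ℕ.≤ m
scatter-weight {zero}  {n} x ι = ℕ.≤-reflexive (∣⊥∣≡0 n)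
scatter-weight {suc m} {n} x ι = ℕ.≤-trans (weight-⊕ (x zero ⊙ ⁅ ι zero ⁆) _)
  (ℕ.+-mono-≤ (unit (x zero)) (scatter-weight (x ∘ suc) (ι ∘ suc)))
  where
  unit : ∀ b → ∣ b ⊙ ⁅ ι zero ⁆ ∣ ℕ.≤ 1
  unit false = ℕ.≤-trans (ℕ.≤-reflexive (trans (cong ∣_∣ (false-⊙ ⁅ ι zero ⁆)) (∣⊥∣≡0 n))) ℕ.z≤n
  unit true  = ℕ.≤-reflexive (trans (cong ∣_∣ (true-⊙ ⁅ ι zero ⁆)) (∣⁅x⁆∣≡1 (ι zero)))

scatter-∉ : (x : Fin m → F₂) (ι : Fin m → Fin n) {i : Fin n} → (∀ j → ι j ≢ i) → lookup (scatter x ι) i ≡ false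
scatter-∉ {zero}  x ι {i} _ = Vec.lookup-replicate i false
scatter-∉ {suc m} x ι {i} ∉ = trans (Vec.lookup-zipWith _xor_ i (x zero ⊙ ⁅ ι zero ⁆) _)
  (cong₂ _xor_
    (trans (Vec.lookup-map i (x zero ∧_) ⁅ ι zero ⁆)
           (trans (cong (x zero ∧_) (lookup-⁅⁆-≢ (∉ zero))) (Bool.∧-zeroʳ (x zero))))
    (scatter-∉ (x ∘ suc) (ι ∘ suc) (∉ ∘ suc)))

scatter-∈ : (x : Fin m → F₂) (ι : Fin m → Fin n) → Injective _≡_ _≡_ ι → ∀ j → lookup (scatter x ι) (ι j) ≡ x j
scatter-∈ x ι inj zero = trans (Vec.lookup-zipWith _xor_ (ι zero) (x zero ⊙ ⁅ ι zero ⁆) _)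
  (trans (cong₂ _xor_
    (trans (Vec.lookup-map (ι zero) (x zero ∧_) ⁅ ι zero ⁆)
           (trans (cong (x zero ∧_) (lookup-⁅⁆ (ι zero))) (Bool.∧-identityʳ (x zero))))
    (scatter-∉ (x ∘ suc) (ι ∘ suc) λ j eq → contradiction (inj eq) λ ()))
  (Bool.xor-identityʳ (x zero)))
scatter-∈ x ι inj (suc j) = trans (Vec.lookup-zipWith _xor_ (ι (suc j)) (x zero ⊙ ⁅ ι zero ⁆) _)
  (cong₂ _xor_
    (trans (Vec.lookup-map (ι (suc j)) (x zero ∧_) ⁅ ι zero ⁆)
           (trans (cong (x zero ∧_) (lookup-⁅⁆-≢ λ eq → contradiction (inj eq) λ ())) (Bool.∧-zeroʳ (x zero))))
    (scatter-∈ (x ∘ suc) (ι ∘ suc) (Fin.suc-injective ∘ inj) j))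

scatter-· : (x : Fin m → F₂) (ι : Fin m → Fin n) (g : Fin n → F₂) →
            scatter x ι · tabulate g ≡ tabulate x · tabulate (g ∘ ι)
scatter-· {zero}  x ι g = trans (·-comm 𝟎 (tabulate g)) (·-zeroʳ (tabulate g))
scatter-· {suc m} x ι g = begin
  ((x zero ⊙ ⁅ ι zero ⁆) ⊕ scatter (x ∘ suc) (ι ∘ suc)) · v
    ≡⟨ ·-comm _ v ⟩
  v · ((x zero ⊙ ⁅ ι zero ⁆) ⊕ scatter (x ∘ suc) (ι ∘ suc))
    ≡⟨ ·-distribˡ-⊕ v _ _ ⟩
  (v · (x zero ⊙ ⁅ ι zero ⁆)) xor (v · scatter (x ∘ suc) (ι ∘ suc))
    ≡⟨ cong₂ _xor_ (·-⊙ (x zero) v ⁅ ι zero ⁆) (·-comm v _) ⟩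
  (x zero ∧ (v · ⁅ ι zero ⁆)) xor (scatter (x ∘ suc) (ι ∘ suc) · v)
    ≡⟨ cong₂ (λ a b → (x zero ∧ a) xor b)
         (trans (·-⁅⁆ v (ι zero)) (Vec.lookup∘tabulate g (ι zero))) (scatter-· (x ∘ suc) (ι ∘ suc) g) ⟩
  (x zero ∧ g (ι zero)) xor (tabulate (x ∘ suc) · tabulate (g ∘ ι ∘ suc))   ∎
  where
  open ≡-Reasoning
  v = tabulate g

-- The inverse passage: the positions of the ones of `v`, in increasing order, select a subfamily of
-- size equal to the weight.
support : (v : F₂^ n) → Fin ∣ v ∣ → Fin n
support (false ∷ v) j       = suc (support v j)
support (true ∷ v)  zero    = zero
support (true ∷ v)  (suc j) = suc (support v j)

support-injective : (v : F₂^ n) → Injective _≡_ _≡_ (support v)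
support-injective (false ∷ v) {i}     {j}     eq = support-injective v (Fin.suc-injective eq)
support-injective (true ∷ v)  {zero}  {zero}  eq = refl
support-injective (true ∷ v)  {suc i} {suc j} eq = cong suc (support-injective v (Fin.suc-injective eq))

support-· : (v : F₂^ n) (g : Fin n → F₂) →
            tabulate {n = ∣ v ∣} (λ _ → true) · tabulate (g ∘ support v) ≡ v · tabulate g
support-· []          g = refl
support-· (false ∷ v) g = support-· v (g ∘ suc)
support-· (true ∷ v)  g = cong (g zero xor_) (support-· v (g ∘ suc))

ᵀ-add : {f : F₂^ m → F₂^ n} → Additive f → Additive (f ᵀ)
ᵀ-add {f = f} f-add α β = ·-injectiveˡ λ v → begin
  (f ᵀ) (α ⊕ β) · v                    ≡⟨ ᵀ-· f-add (α ⊕ β) v ⟩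
  (α ⊕ β) · f v                        ≡⟨ ·-comm (α ⊕ β) (f v) ⟩
  f v · (α ⊕ β)                        ≡⟨ ·-distribˡ-⊕ (f v) α β ⟩
  (f v · α) xor (f v · β)              ≡⟨ cong₂ _xor_ (lemma α v) (lemma β v) ⟩
  (v · (f ᵀ) α) xor (v · (f ᵀ) β)      ≡⟨ ·-distribˡ-⊕ v ((f ᵀ) α) ((f ᵀ) β) ⟨
  v · ((f ᵀ) α ⊕ (f ᵀ) β)              ≡⟨ ·-comm v _ ⟩
  ((f ᵀ) α ⊕ (f ᵀ) β) · v              ∎
  where
  open ≡-Reasoning
  lemma : ∀ α v → f v · α ≡ v · (f ᵀ) α
  lemma α v = trans (·-comm (f v) α) (trans (sym (ᵀ-· f-add α v)) (·-comm _ v))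

-- The map φ. Evaluating Σ xᵢ bᵢ at β is the dot product of x with φ(β), so statements about sums of
-- functionals become statements about words.
values : (Fin n → Dual h) → F₂^ h → F₂^ n
values B β = tabulate λ i → apply (B i) β

tabulate-⊕ : (f g : Fin n → F₂) → tabulate (λ i → f i xor g i) ≡ tabulate f ⊕ tabulate g
tabulate-⊕ {zero}  f g = refl
tabulate-⊕ {suc n} f g = cong ((f zero xor g zero) ∷_) (tabulate-⊕ (f ∘ suc) (g ∘ suc))

values-add : (B : Fin n → Dual h) → Additive (values B)
values-add B α β = trans (Vec.tabulate-cong λ i → additive (B i) α β) (tabulate-⊕ _ _)

apply-lc : (x : Fin n → F₂) (B : Fin n → Dual h) → ∀ β →
           apply (linearCombination (dualModule h) x B) β ≡ tabulate x · values B β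
apply-lc {zero}  x B β = refl
apply-lc {suc n} x B β = cong ((x zero ∧ apply (B zero) β) xor_) (apply-lc (x ∘ suc) (B ∘ suc) β)

apply-lc-lookup : (v : F₂^ n) (B : Fin n → Dual h) → ∀ β →
           apply (linearCombination (dualModule h) (lookup v) B) β ≡ v · values B β
apply-lc-lookup v B β = trans (apply-lc (lookup v) B β) (cong (_· values B β) (Vec.tabulate∘lookup v))

module _ (B : Fin n → Dual h) where

  -- Since d ≥ 3, pairs are among the independent subsets, and a repeated element would give the
  -- dependency b + b = 0.
  wise⇒distinct : ∀ {d} → 3 ℕ.≤ d → WiseIndependent (dualModule h) d B → Distinct (dualModule h) B
  wise⇒distinct 3≤d wise {i} {j} eq with i Fin.≟ j
  ... | yes i≡j = i≡j
  ... | no  i≢j = contradiction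
    (wise 2 3≤d ι ι-injective (λ _ → true) (λ α → trans (cong (apply (B i) α xor_) (Bool.xor-identityʳ _))
       (trans (cong (_xor apply (B j) α) (eq α)) (Bool.xor-same (apply (B j) α)))) zero) λ ()
    where
    ι : Fin 2 → Fin n
    ι zero       = i
    ι (suc zero) = j
    ι-injective : Injective _≡_ _≡_ ι
    ι-injective {zero}     {zero}     _  = refl
    ι-injective {zero}     {suc zero} e  = contradiction e i≢j
    ι-injective {suc zero} {zero}     e  = contradiction (sym e) i≢j
    ι-injective {suc zero} {suc zero} _  = refl

  -- The dual space has 2^h elements, one for each representing vector. This makes h unbounded when
  -- n is.
  distinct⇒n≤2^h : Distinct (dualModule h) B → n ℕ.≤ 2 ℕ.^ h
  distinct⇒n≤2^h dist = Fin.injective⇒≤ {f = λ i → toFin (riesz (apply (B i)))} λ {i} {j} eq →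
    dist λ α → trans (sym (riesz-· (additive (B i)) α))
      (trans (cong (_· α) (toFin-injective {x = riesz (apply (B i))} {riesz (apply (B j))} eq))
             (riesz-· (additive (B j)) α))

-- C is the code whose parity checks are the vectors (b₁(β), …, bₙ(β)).
IsKernel : (C : LinearCode n) (B : Fin n → Dual h) → Set
IsKernel C B = ∀ v → Codeword C v ⇔ (∀ β → v · values B β ≡ false)

module Kernel {C : LinearCode n} {B : Fin n → Dual h} (ker : IsKernel C B) where

  open Equivalence

  values-dual : ∀ β → DualCodeword C (values B β)
  values-dual β c c∈C = trans (·-comm (values B β) c) (to (ker c) c∈C β)

  module _ (v : F₂^ n) (a : Dual h) (a≡ : ∀ β → apply a β ≡ v · values B β) where

    private
      IsSum Reaches : ℕ → Set
      IsSum r = ∃ λ (S : Subset n) → ∣ S ∣ ≡ r ×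
        (∀ α → apply (linearCombination (dualModule h) (lookup S) B) α ≡ apply a α)
      Reaches r = ∃ λ c → Codeword C c × hamming v c ≡ r

      -- For a = Σ vᵢ bᵢ, translation by `v` exchanges the sets `S` with sum a and the codewords
      -- `v ⊕ S`, and the size of `S` is the distance from `v` to `v ⊕ S`. Rank and distance are
      -- therefore minima of equivalent predicates.
      sum⇒reaches : ∀ {r} → IsSum r → Reaches r
      sum⇒reaches (S , ∣S∣≡r , eq) = v ⊕ S , from (ker (v ⊕ S)) kernel ,
        trans (cong ∣_∣ (⊕-cancel v S)) ∣S∣≡r
        where
        kernel : ∀ β → (v ⊕ S) · values B β ≡ false
        kernel β = begin
          (v ⊕ S) · φβ               ≡⟨ ·-comm (v ⊕ S) φβ ⟩
          φβ · (v ⊕ S)               ≡⟨ ·-distribˡ-⊕ φβ v S ⟩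
          (φβ · v) xor (φβ · S)      ≡⟨ cong₂ _xor_ (trans (·-comm φβ v) (sym (a≡ β)))
                                          (trans (·-comm φβ S) (trans (sym (apply-lc-lookup S B β)) (eq β))) ⟩
          apply a β xor apply a β    ≡⟨ Bool.xor-same (apply a β) ⟩
          false                      ∎
          where
          open ≡-Reasoning
          φβ = values B β

      reaches⇒sum : ∀ {r} → Reaches r → IsSum r
      reaches⇒sum (c , c∈C , eq) = v ⊕ c , eq , λ β → let φβ = values B β in begin
        apply (linearCombination (dualModule h) (lookup (v ⊕ c)) B) β   ≡⟨ apply-lc-lookup (v ⊕ c) B β ⟩
        (v ⊕ c) · φβ               ≡⟨ ·-comm (v ⊕ c) φβ ⟩
        φβ · (v ⊕ c)               ≡⟨ ·-distribˡ-⊕ φβ v c ⟩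
        (φβ · v) xor (φβ · c)      ≡⟨ cong₂ _xor_ (·-comm φβ v) (values-dual β c c∈C) ⟩
        (v · φβ) xor false         ≡⟨ Bool.xor-identityʳ _ ⟩
        v · φβ                     ≡⟨ a≡ β ⟨
        apply a β                  ∎
        where open ≡-Reasoning

    rank⇒distance : ∀ {r} → IsRank B a r → IsDistanceTo C v r
    rank⇒distance (s , min) = sum⇒reaches s , λ k → min k ∘ reaches⇒sum

    distance⇒rank : ∀ {r} → IsDistanceTo C v r → IsRank B a r
    distance⇒rank (s , min) = reaches⇒sum s , λ k → min k ∘ sum⇒reaches

  module _ {d : ℕ} where

    -- A dependency among fewer than d elements spreads out to a codeword of weight below d.
    -- Compared with the codeword `𝟎` it must vanish, and so must its coefficients.
    distance⇒wise : MinimumDistance≥ C d → WiseIndependent (dualModule h) d B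
    distance⇒wise dist m m<d ι inj x eq j with scatter x ι ≟ 𝟎
    ... | yes w≡𝟎 = trans (sym (scatter-∈ x ι inj j))
                          (trans (cong (λ w → lookup w (ι j)) w≡𝟎) (Vec.lookup-replicate (ι j) false))
    ... | no  w≢𝟎 = contradiction (dist w 𝟎 w∈C (0-closed C) w≢𝟎)
        (ℕ.<⇒≱ (ℕ.≤-<-trans (ℕ.≤-trans (ℕ.≤-reflexive (cong ∣_∣ (⊕-identityʳ w))) (scatter-weight x ι)) m<d))
      where
      w = scatter x ι
      w∈C : Codeword C w
      w∈C = from (ker w) λ β → trans (scatter-· x ι λ i → apply (B i) β)
        (trans (sym (apply-lc x (B ∘ ι) β)) (eq β))

    -- The difference of two codewords at distance below d is a dependency on its support with all
    -- coefficients `true`. Independence then leaves only the empty support.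
    wise⇒distance : WiseIndependent (dualModule h) d B → MinimumDistance≥ C d
    wise⇒distance wise u v u∈C v∈C u≢v = ℕ.≮⇒≥ λ ∣w∣<d →
      u≢v (⊕≡𝟎⇒≡ u v (weight≡0⇒≡𝟎 w (empty (wise ∣ w ∣ ∣w∣<d (support w) (support-injective w) (λ _ → true)
        λ β → trans (apply-lc (λ _ → true) (B ∘ support w) β)
                    (trans (support-· w λ i → apply (B i) β) (to (ker w) (⊕-closed C u∈C v∈C) β))))))
      where
      w = u ⊕ v
      empty : ∀ {m} → (∀ (j : Fin m) → true ≡ false) → m ≡ 0
      empty {zero}  _ = refl
      empty {suc m} f = contradiction (f zero) λ ()

  module _ (spanning : Spanning (dualModule h) B) where

    private
      P : F₂^ n → F₂^ h
      P = values B ᵀ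

      P-· : ∀ v β → P v · β ≡ v · values B β
      P-· = ᵀ-· (values-add B)

      P-add : Additive P
      P-add = ᵀ-add (values-add B)

      functional : F₂^ h → Dual h
      functional z = record
        { apply       = z ·_
        ; additive    = ·-distribˡ-⊕ z
        ; homogeneous = λ x → ·-⊙ x z
        }

      -- A right inverse of `P` read off from the spanning property. Its additivity is never
      -- established: the counting below rests on `P∘S` alone.
      S : F₂^ h → F₂^ n
      S z = tabulate (proj₁ (spanning (functional z)))

      P∘S : ∀ z → P (S z) ≡ z
      P∘S z = ·-injectiveˡ λ β → trans (P-· (S z) β)
        (trans (sym (apply-lc _ B β)) (proj₂ (spanning (functional z)) β))

      S-injective : Injective _≡_ _≡_ S
      S-injective {x = y} {z} eq = trans (sym (P∘S y)) (trans (cong P eq) (P∘S z))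

      codeword⇒P≡𝟎 : ∀ {v} → Codeword C v → P v ≡ 𝟎
      codeword⇒P≡𝟎 {v} v∈C = ·-injectiveˡ λ β → trans (P-· v β) (trans (to (ker v) v∈C β)
        (sym (trans (·-comm 𝟎 β) (·-zeroʳ β))))

      P≡𝟎⇒codeword : ∀ {v} → P v ≡ 𝟎 → Codeword C v
      P≡𝟎⇒codeword {v} eq = from (ker v) λ β → trans (sym (P-· v β))
        (trans (cong (_· β) eq) (trans (·-comm 𝟎 β) (·-zeroʳ β)))

    spanning⇒h≤n : h ℕ.≤ n
    spanning⇒h≤n = F₂^-injective⇒≤ S-injective

    -- Rank and nullity by counting: (x, z) ↦ `lc x ⊕ S z` embeds F₂^(k+h) in F₂^n, and recording
    -- `P w` with the coordinates of the codeword `w ⊕ S (P w)` embeds F₂^n in F₂^(k+h).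
    dimension : HasDimension C k → k ℕ.+ h ≡ n
    dimension {k} (g , g∈C , indep , span) = ℕ.≤-antisym (F₂^-injective⇒≤ join-injective) (F₂^-injective⇒≤ split-injective)
      where
      open ≡-Reasoning
      lc : F₂^ k → F₂^ n
      lc x = linearCombination (F₂^-module n) (lookup x) g

      lc-injective : Injective _≡_ _≡_ lc
      lc-injective {x = x} {y} eq = trans (sym (Vec.tabulate∘lookup x)) (trans
        (Vec.tabulate-cong λ i → xor≡false⇒≡ _ _ (indep (λ i → lookup x i xor lookup y i)
          (trans (lc-xor g (lookup x) (lookup y)) (trans (cong (_⊕ lc y) eq) (⊕-self (lc y)))) i))
        (Vec.tabulate∘lookup y))

      join′ : F₂^ k → F₂^ h → F₂^ n
      join′ x z = lc x ⊕ S z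

      P-join : ∀ x z → P (join′ x z) ≡ z
      P-join x z = begin
        P (lc x ⊕ S z)       ≡⟨ P-add (lc x) (S z) ⟩
        P (lc x) ⊕ P (S z)   ≡⟨ cong₂ _⊕_ (codeword⇒P≡𝟎 (lc-closed C (lookup x) g∈C)) (P∘S z) ⟩
        𝟎 ⊕ z                ≡⟨ ⊕-identityˡ z ⟩
        z                    ∎

      join : F₂^ (k ℕ.+ h) → F₂^ n
      join w = join′ (take k w) (drop k w)

      join-injective : Injective _≡_ _≡_ join
      join-injective {x = u} {v} eq = begin
        u                     ≡⟨ Vec.take++drop≡id k u ⟨
        take k u ++ drop k u  ≡⟨ cong₂ _++_ (lc-injective lc-eq) drop-eq ⟩
        take k v ++ drop k v  ≡⟨ Vec.take++drop≡id k v ⟩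
        v                     ∎
        where
        drop-eq : drop k u ≡ drop k v
        drop-eq = trans (sym (P-join (take k u) (drop k u))) (trans (cong P eq) (P-join (take k v) (drop k v)))
        lc-eq : lc (take k u) ≡ lc (take k v)
        lc-eq = begin
          lc (take k u)                                   ≡⟨ cancelʳ _ (S (drop k u)) ⟨
          join u ⊕ S (drop k u)                           ≡⟨ cong₂ _⊕_ eq (cong S drop-eq) ⟩
          join v ⊕ S (drop k v)                           ≡⟨ cancelʳ _ (S (drop k v)) ⟩
          lc (take k v)                                   ∎
          where
          cancelʳ : (a b : F₂^ n) → (a ⊕ b) ⊕ b ≡ a
          cancelʳ a b = trans (⊕-assoc a b b) (trans (cong (a ⊕_) (⊕-self b)) (⊕-identityʳ a))

      residue∈C : ∀ w → Codeword C (w ⊕ S (P w))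
      residue∈C w = P≡𝟎⇒codeword (trans (P-add w (S (P w))) (trans (cong (P w ⊕_) (P∘S (P w))) (⊕-self (P w))))

      coordinates : F₂^ n → F₂^ k
      coordinates w = tabulate (proj₁ (span (w ⊕ S (P w)) (residue∈C w)))

      lc-coordinates : ∀ w → join′ (coordinates w) (P w) ≡ w
      lc-coordinates w = begin
        lc (coordinates w) ⊕ S (P w)
          ≡⟨ cong (_⊕ S (P w)) (trans (lc-cong g (Vec.lookup∘tabulate _)) (proj₂ (span (w ⊕ S (P w)) (residue∈C w)))) ⟩
        (w ⊕ S (P w)) ⊕ S (P w)     ≡⟨ ⊕-assoc w _ _ ⟩
        w ⊕ (S (P w) ⊕ S (P w))     ≡⟨ cong (w ⊕_) (⊕-self (S (P w))) ⟩
        w ⊕ 𝟎                       ≡⟨ ⊕-identityʳ w ⟩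
        w                           ∎

      split-injective : Injective _≡_ _≡_ (λ w → coordinates w ++ P w)
      split-injective {x = u} {v} eq = trans (sym (lc-coordinates u)) (trans
        (cong₂ join′ (Vec.++-injectiveˡ (coordinates u) (coordinates v) eq)
                     (Vec.++-injectiveʳ (coordinates u) (coordinates v) eq))
        (lc-coordinates v))

-- The functionals given by a parity check

module DualBasis {C : LinearCode n} (P : ParityCheck C) where

  -- The columns of the parity-check matrix as functionals: coordinate i of the transpose applied to
  -- β is the dot product of β with column i.
  columns : Fin n → Dual (redundancy P)
  columns i = record
    { apply       = λ β → lookup ((syndrome P ᵀ) β) i
    ; additive    = λ α β → trans (cong (λ v → lookup v i) (ᵀ-add (syndrome-add P) α β))
                                  (Vec.lookup-zipWith _xor_ i ((syndrome P ᵀ) α) ((syndrome P ᵀ) β))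
    ; homogeneous = λ x β → trans (cong (λ v → lookup v i) (homogeneous′ x β)) (Vec.lookup-map i (x ∧_) ((syndrome P ᵀ) β))
    }
    where
    homogeneous′ : ∀ x β → (syndrome P ᵀ) (x ⊙ β) ≡ x ⊙ (syndrome P ᵀ) β
    homogeneous′ false β = trans (cong (syndrome P ᵀ) (false-⊙ β)) (trans (Additive-𝟎 (ᵀ-add (syndrome-add P))) (sym (false-⊙ _)))
    homogeneous′ true  β = trans (cong (syndrome P ᵀ) (true-⊙ β)) (sym (true-⊙ _))

  columns-· : ∀ v β → v · values columns β ≡ β · syndrome P v
  columns-· v β = trans (cong (v ·_) (Vec.tabulate∘lookup ((syndrome P ᵀ) β)))
    (trans (·-comm v _) (ᵀ-· (syndrome-add P) β v))

  columns-kernel : IsKernel C columns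
  columns-kernel v = mk⇔
    (λ v∈C β → trans (columns-· v β) (trans (cong (β ·_) (codeword⇒ P v∈C)) (·-zeroʳ β)))
    (λ eq → codeword⇐ P (·-injectiveˡ λ β → trans (·-comm _ β)
      (trans (sym (columns-· v β)) (trans (eq β) (sym (trans (·-comm 𝟎 β) (·-zeroʳ β)))))))

  columns-spanning : Spanning (dualModule (redundancy P)) columns
  columns-spanning a = lookup (section P z) , λ β → begin
    apply (linearCombination (dualModule (redundancy P)) (lookup (section P z)) columns) β   ≡⟨ apply-lc-lookup (section P z) columns β ⟩
    section P z · values columns β   ≡⟨ columns-· (section P z) β ⟩
    β · syndrome P (section P z)     ≡⟨ cong (β ·_) (syndrome-section P z) ⟩
    β · z                            ≡⟨ ·-comm β z ⟩
    z · β                            ≡⟨ riesz-· (additive a) β ⟩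
    apply a β                        ∎
    where
    open ≡-Reasoning
    z = riesz (apply a)

  -- `v` and `section P (syndrome P v)` have the same syndrome, so they differ by a codeword and a
  -- dual codeword cannot tell them apart. Hence the transposed section inverts φ on the dual code.
  values-sectionᵀ : ∀ {α} → DualCodeword C α → values columns ((section P ᵀ) α) ≡ α
  values-sectionᵀ {α} α∈C⊥ = ·-injectiveˡ λ v → begin
    values columns ((section P ᵀ) α) · v   ≡⟨ ·-comm _ v ⟩
    v · values columns ((section P ᵀ) α)   ≡⟨ columns-· v ((section P ᵀ) α) ⟩
    (section P ᵀ) α · syndrome P v         ≡⟨ ᵀ-· (section-add P) α (syndrome P v) ⟩
    α · section P (syndrome P v)           ≡⟨ xor≡false⇒≡ _ _ (trans (sym (·-distribˡ-⊕ α _ v)) (α∈C⊥ _ (codeword⇐ P (residue v)))) ⟩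
    α · v                                  ∎
    where
    open ≡-Reasoning
    residue : ∀ v → syndrome P (section P (syndrome P v) ⊕ v) ≡ 𝟎
    residue v = trans (syndrome-add P _ v) (trans (cong (_⊕ syndrome P v) (syndrome-section P (syndrome P v))) (⊕-self (syndrome P v)))

-- Inequalities between reals

-- Arithmetic on ℝ is pointwise and x ≤ y only involves seq x and seq y, so
-- inequalities between reals are proved for sequences of rationals.

infix 4 _≲_

record _≲_ (s t : ℕ → ℚ) : Set where
  constructor mk≲
  field eventually : ∀ δ → 0ℚ ℚ.< δ → ∃ λ N → ∀ n → N ℕ.≤ n → s n ℚ.≤ t n ℚ.+ δ

open _≲_

-- Stronger than `0ℝ ≤ x`, which lets every term be slightly negative. With the sign of all late
-- terms known, rational inequalities can be multiplied termwise.
EventuallyNonNegative : (ℕ → ℚ) → Set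
EventuallyNonNegative s = ∃ λ N → ∀ n → N ℕ.≤ n → 0ℚ ℚ.≤ s n

≤⇒≲ : ∀ x y → x ≤ y → seq x ≲ seq y
≤⇒≲ x y = mk≲

≲-reflexive : ∀ {s t} → (∀ n → s n ≡ t n) → s ≲ t
≲-reflexive {t = t} eq .eventually δ 0<δ = 0 , λ n _ → ℚ.≤-trans (ℚ.≤-reflexive (trans (eq n) (sym (ℚ.+-identityʳ (t n)))))
  (ℚ.+-monoʳ-≤ (t n) (ℚ.<⇒≤ 0<δ))

≲-+ : ∀ {s t u v} → s ≲ t → u ≲ v → (λ n → s n ℚ.+ u n) ≲ (λ n → t n ℚ.+ v n)
≲-+ {s} {t} {u} {v} s≲t u≲v .eventually δ 0<δ =
  let M , s≤ = eventually s≲t (½ ℚ.* δ) (half>0 0<δ)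
      N , u≤ = eventually u≲v (½ ℚ.* δ) (half>0 0<δ)
  in M ℕ.⊔ N , λ n p → ℚ.≤-trans
    (ℚ.+-mono-≤ (s≤ n (ℕ.m⊔n≤o⇒m≤o M N p)) (u≤ n (ℕ.m⊔n≤o⇒n≤o M N p)))
    (ℚ.≤-reflexive (trans (regroup (t n) (½ ℚ.* δ) (v n)) (cong (t n ℚ.+ v n ℚ.+_) (halves δ))))
  where
  regroup : ∀ a b c → (a ℚ.+ b) ℚ.+ (c ℚ.+ b) ≡ a ℚ.+ c ℚ.+ (b ℚ.+ b)
  regroup = solve 3 (λ a b c → (a :+ b) :+ (c :+ b) := a :+ c :+ (b :+ b)) refl
    where open +-*-Solver

-- The hypothesis says t - s = v - u termwise. Linear rearrangements of inequalities thus reduce to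
-- one ring identity in ℚ.
≲-shift : ∀ {u v t s} → u ≲ v → (∀ n → t n ℚ.+ u n ≡ s n ℚ.+ v n) → s ≲ t
≲-shift {u} {v} {t} {s} u≲v eq .eventually δ 0<δ = map₂ (λ u≤ n N≤n → bound n (u≤ n N≤n)) (eventually u≲v δ 0<δ)
  where
  open ℚ.≤-Reasoning
  lhs : ∀ a b → a ≡ a ℚ.+ b ℚ.- b
  lhs = solve 2 (λ a b → a := a :+ b :- b) refl
    where open +-*-Solver
  bound : ∀ n → u n ℚ.≤ v n ℚ.+ δ → s n ℚ.≤ t n ℚ.+ δ
  bound n u≤ = begin
    s n                                  ≡⟨ lhs (s n) (v n) ⟩
    s n ℚ.+ v n ℚ.- v n                  ≡⟨ cong (ℚ._- v n) (eq n) ⟨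
    t n ℚ.+ u n ℚ.- v n                  ≡⟨ rearrange (t n) (u n) (v n) ⟩
    (t n ℚ.- v n) ℚ.+ u n                ≤⟨ ℚ.+-monoʳ-≤ (t n ℚ.- v n) u≤ ⟩
    (t n ℚ.- v n) ℚ.+ (v n ℚ.+ δ)        ≡⟨ cancel (t n) (v n) δ ⟩
    t n ℚ.+ δ                            ∎
    where
    rearrange : ∀ a b c → a ℚ.+ b ℚ.- c ≡ (a ℚ.- c) ℚ.+ b
    rearrange = solve 3 (λ a b c → a :+ b :- c := (a :- c) :+ b) refl
      where open +-*-Solver
    cancel : ∀ a b c → (a ℚ.- b) ℚ.+ (b ℚ.+ c) ≡ a ℚ.+ c
    cancel = solve 3 (λ a b c → (a :- b) :+ (b :+ c) := a :+ c) refl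
      where open +-*-Solver

≲-trans : ∀ {s t u} → s ≲ t → t ≲ u → s ≲ u
≲-trans {s} {t} {u} s≲t t≲u = ≲-shift (≲-+ s≲t t≲u) λ n → regroup (s n) (t n) (u n)
  where
  regroup : ∀ a b c → c ℚ.+ (a ℚ.+ b) ≡ a ℚ.+ (b ℚ.+ c)
  regroup = solve 3 (λ a b c → c :+ (a :+ b) := a :+ (b :+ c)) refl
    where open +-*-Solver

-- As `z` is bounded by some B, allowing an error of only δ / B before multiplying keeps the final
-- error below δ.
≲-*ʳ : ∀ {s t} z → EventuallyNonNegative (seq z) → s ≲ t → (λ n → s n ℚ.* seq z n) ≲ (λ n → t n ℚ.* seq z n)
≲-*ʳ {s} {t} z (M , 0≤z) s≲t .eventually δ 0<δ =
  let B , 0<B , N , z≤B = bounded z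
      η , 0<η , small   = scale B 0<B δ 0<δ
      K , s≤            = eventually s≲t η 0<η
  in M ℕ.⊔ (N ℕ.⊔ K) , λ n p →
    let M≤n = ℕ.m⊔n≤o⇒m≤o M (N ℕ.⊔ K) p
        N≤n = ℕ.m⊔n≤o⇒m≤o N K (ℕ.m⊔n≤o⇒n≤o M (N ℕ.⊔ K) p)
        K≤n = ℕ.m⊔n≤o⇒n≤o N K (ℕ.m⊔n≤o⇒n≤o M (N ℕ.⊔ K) p)
    in begin
      s n ℚ.* seq z n                        ≤⟨ ℚ.*-monoʳ-≤-nonNeg (seq z n) {{ℚ.nonNegative (0≤z n M≤n)}} (s≤ n K≤n) ⟩
      (t n ℚ.+ η) ℚ.* seq z n                ≡⟨ expand (t n) η (seq z n) ⟩
      t n ℚ.* seq z n ℚ.+ seq z n ℚ.* η      ≤⟨ ℚ.+-monoʳ-≤ (t n ℚ.* seq z n) (small (seq z n) η (ℚ.<⇒≤ 0<η)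
                                                  (ℚ.≤-trans (p≤∣p∣ (seq z n)) (z≤B n N≤n)) ℚ.≤-refl) ⟩
      t n ℚ.* seq z n ℚ.+ δ                  ∎
  where
  open ℚ.≤-Reasoning
  expand : ∀ a b c → (a ℚ.+ b) ℚ.* c ≡ a ℚ.* c ℚ.+ c ℚ.* b
  expand = solve 3 (λ a b c → (a :+ b) :* c := a :* c :+ c :* b) refl
    where open +-*-Solver

≈⇒≤ : ∀ x y → x ≈ y → x ≤ y
≈⇒≤ x y x≈y δ 0<δ = map₂ (λ close n N≤n → ∣p-q∣≤⇒p≤q+ (seq x n) (seq y n) δ (close n N≤n)) (x≈y δ 0<δ)

≈-sym : ∀ x y → x ≈ y → y ≈ x
≈-sym x y x≈y δ 0<δ = map₂ (λ close n N≤n → ℚ.≤-trans (ℚ.≤-reflexive (flip (seq y n) (seq x n))) (close n N≤n)) (x≈y δ 0<δ)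
  where
  flip : ∀ a b → ℚ.∣ a ℚ.- b ∣ ≡ ℚ.∣ b ℚ.- a ∣
  flip a b = trans (cong ℚ.∣_∣ (solve 2 (λ a b → a :- b := :- (b :- a)) refl a b)) (ℚ.∣-p∣≡∣p∣ (b ℚ.- a))
    where open +-*-Solver

≤-antisym : ∀ x y → x ≤ y → y ≤ x → x ≈ y
≤-antisym x y x≤y y≤x δ 0<δ =
  let M , x≤ = x≤y δ 0<δ
      N , y≤ = y≤x δ 0<δ
  in M ℕ.⊔ N , λ n p → ∣p-q∣≤ (seq x n) (seq y n) δ (x≤ n (ℕ.m⊔n≤o⇒m≤o M N p)) (y≤ n (ℕ.m⊔n≤o⇒n≤o M N p))

positive⇒nonNegative : ∀ x → 0ℝ < x → EventuallyNonNegative (seq x)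
positive⇒nonNegative x (δ , 0<δ , N , δ≤x) = N , λ n N≤n →
  ℚ.≤-trans (ℚ.<⇒≤ 0<δ) (ℚ.≤-trans (ℚ.≤-reflexive (sym (ℚ.+-identityˡ δ))) (δ≤x n N≤n))

0≤+/ : ∀ a b → 0ℚ ℚ.≤ + a ℚ./ suc b
0≤+/ a b = ℚ.nonNegative⁻¹ (+ a ℚ./ suc b) {{ℚ.normalize-nonNeg a (suc b)}}

module _ (c : ℝ) (0<c : 0ℝ < c) where
  open Reciprocal c 0<c

  private
    -- The n-th term of the reciprocal inverts the term of `c` with index `N₀ + n`, so it cancels
    -- this shifted sequence exactly and `c` itself only up to the Cauchy error.
    c⁺ : ℕ → ℚ
    c⁺ n = seq c (N₀ ℕ.+ n)

    c≲c⁺ : seq c ≲ c⁺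
    c≲c⁺ .eventually δ 0<δ = map₂ (λ close n N≤n → ∣p-q∣≤⇒p≤q+ (seq c n) (c⁺ n) δ
      (close n (N₀ ℕ.+ n) N≤n (ℕ.m≤n⇒m≤o+n N₀ N≤n))) (cauchy c δ 0<δ)

    c⁺≲c : c⁺ ≲ seq c
    c⁺≲c .eventually δ 0<δ = map₂ (λ close n N≤n → ∣p-q∣≤⇒p≤q+ (c⁺ n) (seq c n) δ
      (close (N₀ ℕ.+ n) n (ℕ.m≤n⇒m≤o+n N₀ N≤n) N≤n)) (cauchy c δ 0<δ)

    inverse : ∀ n → c⁺ n ℚ.* 1/x n ≡ 1ℚ
    inverse n = ℚ.*-inverseʳ (c⁺ n) {{x-nonZero n}}

    1/x-nonNegative : EventuallyNonNegative 1/x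
    1/x-nonNegative = 0 , λ n _ →
      let instance
            _ = ℚ.positive (ℚ.<-≤-trans 0<δ₀ (δ₀≤x n))
            _ = x-nonZero n
      in ℚ.<⇒≤ (ℚ.positive⁻¹ (1/x n) {{ℚ.1/pos⇒pos (c⁺ n)}})

  reciprocal-*≲1 : (λ n → seq c n ℚ.* 1/x n) ≲ λ _ → 1ℚ
  reciprocal-*≲1 = ≲-trans (≲-*ʳ reciprocal 1/x-nonNegative c≲c⁺) (≲-reflexive inverse)

  1≲reciprocal-* : (λ _ → 1ℚ) ≲ λ n → seq c n ℚ.* 1/x n
  1≲reciprocal-* = ≲-trans (≲-reflexive (sym ∘ inverse)) (≲-*ʳ reciprocal 1/x-nonNegative c⁺≲c)

  ≤*⇒/≤ : ∀ x y → EventuallyNonNegative (seq y) → x ≤ c * y → x / c [ 0<c ] ≤ y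
  ≤*⇒/≤ x y 0≤y x≤cy = eventually $
    ≲-trans (≲-*ʳ reciprocal 1/x-nonNegative (≤⇒≲ x (c * y) x≤cy))
    (≲-trans (≲-reflexive λ n → regroup (seq c n) (seq y n) (1/x n))
    (≲-trans (≲-*ʳ y 0≤y reciprocal-*≲1) (≲-reflexive λ n → ℚ.*-identityˡ (seq y n))))
    where
    regroup : ∀ a b c → a ℚ.* b ℚ.* c ≡ a ℚ.* c ℚ.* b
    regroup = solve 3 (λ a b c → a :* b :* c := a :* c :* b) refl
      where open +-*-Solver

  /≤⇒≤* : ∀ x y → EventuallyNonNegative (seq x) → x / c [ 0<c ] ≤ y → x ≤ c * y
  /≤⇒≤* x y 0≤x x/c≤y = eventually $
    ≲-trans (≲-reflexive λ n → sym (ℚ.*-identityˡ (seq x n)))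
    (≲-trans (≲-*ʳ x 0≤x 1≲reciprocal-*)
    (≲-trans (≲-reflexive λ n → regroup (seq c n) (1/x n) (seq x n))
    (≲-trans (≲-*ʳ c (positive⇒nonNegative c 0<c) (≤⇒≲ (x / c [ 0<c ]) y x/c≤y)) (≲-reflexive λ n → ℚ.*-comm (seq y n) (seq c n)))))
    where
    regroup : ∀ a b c → a ℚ.* b ℚ.* c ≡ c ℚ.* b ℚ.* a
    regroup = solve 3 (λ a b c → a :* b :* c := c :* b :* a) refl
      where open +-*-Solver

-- Comparison of 2^ y ≤ n with y ≤ log₂ n

-- p = u / q ≤ c / d + 1 / l, cross-multiplied with u = u⁺ - u⁻
≤-/+1/ : ∀ p c d l →
         (↥ p) ⁺ ℕ.* (suc d ℕ.* suc l) ℕ.≤ (c ℕ.* suc l ℕ.+ suc d) ℕ.* ↧ₙ p ℕ.+ (↥ p) ⁻ ℕ.* (suc d ℕ.* suc l) →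
         p ℚ.≤ + c ℚ./ suc d ℚ.+ + 1 ℚ./ suc l
≤-/+1/ p@record{} c d l h = ℚ.toℚᵘ-cancel-≤ (begin
  toℚᵘ p                                         ≤⟨ ℚᵘ.*≤* cross ⟩
  mkℚᵘ (+ c) d ℚᵘ.+ mkℚᵘ (+ 1) l                 ≃⟨ ℚᵘ.+-cong (ℚ.toℚᵘ-fromℚᵘ (mkℚᵘ (+ c) d)) (ℚ.toℚᵘ-fromℚᵘ (mkℚᵘ (+ 1) l)) ⟨
  toℚᵘ (+ c ℚ./ suc d) ℚᵘ.+ toℚᵘ (+ 1 ℚ./ suc l) ≃⟨ ℚ.toℚᵘ-homo-+ (+ c ℚ./ suc d) (+ 1 ℚ./ suc l) ⟨
  toℚᵘ (+ c ℚ./ suc d ℚ.+ + 1 ℚ./ suc l)         ∎)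
  where
  open ℚᵘ.≤-Reasoning
  D q u⁺ u⁻ : ℕ
  D = suc d ℕ.* suc l
  q = ↧ₙ p
  u⁺ = (↥ p) ⁺
  u⁻ = (↥ p) ⁻
  rhs : + (c ℕ.* suc l ℕ.+ suc d) ≡ + c ℤ.* + suc l ℤ.+ + 1 ℤ.* + suc d
  rhs = trans (ℤ.pos-+ (c ℕ.* suc l) (suc d)) (cong₂ ℤ._+_ (ℤ.pos-* c (suc l)) (sym (ℤ.*-identityˡ (+ suc d))))
  move : ∀ a b c → (a ℤ.- b) ℤ.* c ≡ a ℤ.* c ℤ.- b ℤ.* c
  move = ℤ-Solver.solve-∀
  cancel : ∀ a b → a ℤ.+ b ℤ.- b ≡ a
  cancel = ℤ-Solver.solve-∀
  module Z = ℤ.≤-Reasoning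
  cross : ↥ p ℤ.* + D ℤ.≤ (+ c ℤ.* + suc l ℤ.+ + 1 ℤ.* + suc d) ℤ.* + q
  cross = Z.begin
    ↥ p ℤ.* + D                           Z.≡⟨ cong (ℤ._* + D) (i≡i⁺-i⁻ (↥ p)) ⟩
    (+ u⁺ ℤ.- + u⁻) ℤ.* + D               Z.≡⟨ move (+ u⁺) (+ u⁻) (+ D) ⟩
    + u⁺ ℤ.* + D ℤ.- + u⁻ ℤ.* + D         Z.≡⟨ cong₂ ℤ._-_ (ℤ.pos-* u⁺ D) (ℤ.pos-* u⁻ D) ⟨
    + (u⁺ ℕ.* D) ℤ.- + (u⁻ ℕ.* D)         Z.≤⟨ ℤ.+-monoˡ-≤ (ℤ.- + (u⁻ ℕ.* D)) (ℤ.+≤+ h) ⟩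
    + ((c ℕ.* suc l ℕ.+ suc d) ℕ.* q ℕ.+ u⁻ ℕ.* D) ℤ.- + (u⁻ ℕ.* D)
                                          Z.≡⟨ cancel (+ ((c ℕ.* suc l ℕ.+ suc d) ℕ.* q)) (+ (u⁻ ℕ.* D)) ⟩
    + ((c ℕ.* suc l ℕ.+ suc d) ℕ.* q)     Z.≡⟨ trans (ℤ.pos-* (c ℕ.* suc l ℕ.+ suc d) q) (cong (ℤ._* + q) rhs) ⟩
    (+ c ℤ.* + suc l ℤ.+ + 1 ℤ.* + suc d) ℤ.* + q   Z.∎

/-≤-/+1/⇒ : ∀ a b c d l → + a ℚ./ suc b ℚ.≤ + c ℚ./ suc d ℚ.+ + 1 ℚ./ suc l →
            a ℕ.* (suc d ℕ.* suc l) ℕ.≤ (c ℕ.* suc l ℕ.+ suc d) ℕ.* suc b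
/-≤-/+1/⇒ a b c d l h = ℤ.drop‿+≤+ (subst₂ ℤ._≤_ (sym lhs) (sym rhs) (ℚᵘ.drop-*≤* (begin
  mkℚᵘ (+ a) b                                   ≃⟨ ℚ.toℚᵘ-fromℚᵘ (mkℚᵘ (+ a) b) ⟨
  toℚᵘ (+ a ℚ./ suc b)                           ≤⟨ ℚ.toℚᵘ-mono-≤ h ⟩
  toℚᵘ (+ c ℚ./ suc d ℚ.+ + 1 ℚ./ suc l)         ≃⟨ ℚ.toℚᵘ-homo-+ (+ c ℚ./ suc d) (+ 1 ℚ./ suc l) ⟩
  toℚᵘ (+ c ℚ./ suc d) ℚᵘ.+ toℚᵘ (+ 1 ℚ./ suc l) ≃⟨ ℚᵘ.+-cong (ℚ.toℚᵘ-fromℚᵘ (mkℚᵘ (+ c) d)) (ℚ.toℚᵘ-fromℚᵘ (mkℚᵘ (+ 1) l)) ⟩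
  mkℚᵘ (+ c) d ℚᵘ.+ mkℚᵘ (+ 1) l                 ∎)))
  where
  open ℚᵘ.≤-Reasoning
  lhs : + (a ℕ.* (suc d ℕ.* suc l)) ≡ + a ℤ.* + (suc d ℕ.* suc l)
  lhs = ℤ.pos-* a (suc d ℕ.* suc l)
  rhs : + ((c ℕ.* suc l ℕ.+ suc d) ℕ.* suc b) ≡ (+ c ℤ.* + suc l ℤ.+ + 1 ℤ.* + suc d) ℤ.* + suc b
  rhs = trans (ℤ.pos-* (c ℕ.* suc l ℕ.+ suc d) (suc b)) (cong (ℤ._* + suc b)
    (trans (ℤ.pos-+ (c ℕ.* suc l) (suc d)) (cong₂ ℤ._+_ (ℤ.pos-* c (suc l)) (sym (ℤ.*-identityˡ (+ suc d))))))

-- The fraction is reduced by a gcd on construction, so its numerator and denominator need not be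
-- `a` and `suc b`; the cross-multiplied equation does not see the gcd. The negative part stands on
-- the right to avoid subtraction in ℕ.
↥⁺-/ : ∀ a b → let p = + a ℚ./ suc b in (↥ p) ⁺ ℕ.* suc b ≡ a ℕ.* ↧ₙ p ℕ.+ (↥ p) ⁻ ℕ.* suc b
↥⁺-/ a b = ℤ.+-injective (begin
  + (u⁺ ℕ.* suc b)                                ≡⟨ ℤ.pos-* u⁺ (suc b) ⟩
  + u⁺ ℤ.* + suc b                                ≡⟨ split (+ u⁺) (+ u⁻) (+ suc b) ⟩
  (+ u⁺ ℤ.- + u⁻) ℤ.* + suc b ℤ.+ + u⁻ ℤ.* + suc b ≡⟨ cong (λ i → i ℤ.* + suc b ℤ.+ + u⁻ ℤ.* + suc b) (i≡i⁺-i⁻ (↥ p)) ⟨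
  ↥ p ℤ.* + suc b ℤ.+ + u⁻ ℤ.* + suc b            ≡⟨ cong (λ i → ↥ p ℤ.* i ℤ.+ + u⁻ ℤ.* + suc b) (ℚ.↧-/ (+ a) (suc b)) ⟨
  ↥ p ℤ.* (↧ p ℤ.* g) ℤ.+ + u⁻ ℤ.* + suc b        ≡⟨ regroup (↥ p) (↧ p) g (+ u⁻ ℤ.* + suc b) ⟩
  (↥ p ℤ.* g) ℤ.* ↧ p ℤ.+ + u⁻ ℤ.* + suc b        ≡⟨ cong (λ i → i ℤ.* ↧ p ℤ.+ + u⁻ ℤ.* + suc b) (ℚ.↥-/ (+ a) (suc b)) ⟩
  + a ℤ.* ↧ p ℤ.+ + u⁻ ℤ.* + suc b                ≡⟨ cong₂ ℤ._+_ (ℤ.pos-* a (↧ₙ p)) (ℤ.pos-* u⁻ (suc b)) ⟨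
  + (a ℕ.* ↧ₙ p) ℤ.+ + (u⁻ ℕ.* suc b)             ≡⟨ ℤ.pos-+ (a ℕ.* ↧ₙ p) (u⁻ ℕ.* suc b) ⟨
  + (a ℕ.* ↧ₙ p ℕ.+ u⁻ ℕ.* suc b)                 ∎)
  where
  open ≡-Reasoning
  p = + a ℚ./ suc b
  g = ℤ.gcd (+ a) (+ suc b)
  u⁺ u⁻ : ℕ
  u⁺ = (↥ p) ⁺
  u⁻ = (↥ p) ⁻
  split : ∀ x y z → x ℤ.* z ≡ (x ℤ.- y) ℤ.* z ℤ.+ y ℤ.* z
  split = ℤ-Solver.solve-∀
  regroup : ∀ x y z w → x ℤ.* (y ℤ.* z) ℤ.+ w ≡ (x ℤ.* z) ℤ.* y ℤ.+ w
  regroup = ℤ-Solver.solve-∀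

-- The hypothesis is 2^(a/(b+1)) ≤ n without roots. Raising to the power `q ℕ.* suc b` clears both
-- the denominator of the reduced fraction and the root.
⌊·2^/⌋≤ : ∀ m a b n → 2 ℕ.^ a ℕ.≤ n ℕ.^ suc b → ⌊ m ·2^ + a ℚ./ suc b ⌋ ℕ.≤ m ℕ.* n
⌊·2^/⌋≤ m a b n h = ^-cancelˡ-≤ (q ℕ.* suc b) {{ℕ.m*n≢0 q (suc b)}}
  (ℕ.*-cancelʳ-≤ _ _ (2 ℕ.^ (u⁻ ℕ.* suc b)) {{ℕ.m^n≢0 2 (u⁻ ℕ.* suc b)}} (begin
  j ℕ.^ (q ℕ.* suc b) ℕ.* 2 ℕ.^ (u⁻ ℕ.* suc b)        ≡⟨ ^-* j (suc b) q u⁻ ⟨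
  (j ℕ.^ q ℕ.* 2 ℕ.^ u⁻) ℕ.^ suc b                    ≤⟨ ℕ.^-monoˡ-≤ (suc b) (⌊·2^⌋-holds m p) ⟩
  (m ℕ.^ q ℕ.* 2 ℕ.^ u⁺) ℕ.^ suc b                    ≡⟨ ^-* m (suc b) q u⁺ ⟩
  m ℕ.^ Q ℕ.* 2 ℕ.^ (u⁺ ℕ.* suc b)                    ≡⟨ cong (λ e → m ℕ.^ Q ℕ.* 2 ℕ.^ e) (↥⁺-/ a b) ⟩
  m ℕ.^ Q ℕ.* 2 ℕ.^ (a ℕ.* q ℕ.+ u⁻ ℕ.* suc b)        ≡⟨ cong (m ℕ.^ Q ℕ.*_) (ℕ.^-distribˡ-+-* 2 (a ℕ.* q) (u⁻ ℕ.* suc b)) ⟩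
  m ℕ.^ Q ℕ.* (2 ℕ.^ (a ℕ.* q) ℕ.* z)                 ≡⟨ cong (λ e → m ℕ.^ Q ℕ.* (e ℕ.* z)) (ℕ.^-*-assoc 2 a q) ⟨
  m ℕ.^ Q ℕ.* ((2 ℕ.^ a) ℕ.^ q ℕ.* z)                 ≤⟨ ℕ.*-monoʳ-≤ (m ℕ.^ Q) (ℕ.*-monoˡ-≤ z (ℕ.^-monoˡ-≤ q h)) ⟩
  m ℕ.^ Q ℕ.* ((n ℕ.^ suc b) ℕ.^ q ℕ.* z)             ≡⟨ cong (λ e → m ℕ.^ Q ℕ.* (e ℕ.* z)) (trans (ℕ.^-*-assoc n (suc b) q) (cong (n ℕ.^_) (ℕ.*-comm (suc b) q))) ⟩
  m ℕ.^ Q ℕ.* (n ℕ.^ Q ℕ.* z)                         ≡⟨ ℕ.*-assoc (m ℕ.^ Q) (n ℕ.^ Q) z ⟨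
  m ℕ.^ Q ℕ.* n ℕ.^ Q ℕ.* z                           ≡⟨ cong (ℕ._* z) (^-distribʳ-* m n Q) ⟨
  (m ℕ.* n) ℕ.^ Q ℕ.* z                               ∎))
  where
  open ℕ.≤-Reasoning
  p = + a ℚ./ suc b
  j q u⁺ u⁻ z Q : ℕ
  j = ⌊ m ·2^ p ⌋
  q = ↧ₙ p
  u⁺ = (↥ p) ⁺
  u⁻ = (↥ p) ⁻
  z = 2 ℕ.^ (u⁻ ℕ.* suc b)
  Q = q ℕ.* suc b

-- The counterpart of `bernoulli`: for T = 2K the inequality (1 + 1/T)^K (1 - K/T) ≤ 1 has second
-- factor 1/2.
[1+1/2K]^K≤2 : ∀ K → .{{ℕ.NonZero K}} → suc (K ℕ.+ K) ℕ.^ K ℕ.≤ 2 ℕ.* (K ℕ.+ K) ℕ.^ K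
[1+1/2K]^K≤2 K = ℕ.*-cancelˡ-≤ K (ℕ.≤-trans (go K K) (ℕ.≤-reflexive (regroup K ((K ℕ.+ K) ℕ.^ K))))
  where
  open ℕ.≤-Reasoning
  regroup : ∀ x y → (x ℕ.+ x) ℕ.* y ≡ x ℕ.* (2 ℕ.* y)
  regroup = ℕ-Solver.solve-∀
  step : ∀ i s → s ℕ.* (suc (suc i ℕ.+ s)) ℕ.+ suc i ≡ suc s ℕ.* (suc i ℕ.+ s)
  step = ℕ-Solver.solve-∀
  -- (1 + 1 / T)^i (1 - i / T) ≤ 1 with T = i + s
  go : ∀ i s → s ℕ.* suc (i ℕ.+ s) ℕ.^ i ℕ.≤ (i ℕ.+ s) ℕ.* (i ℕ.+ s) ℕ.^ i
  go zero    s = ℕ.≤-refl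
  go (suc i) s = begin
    s ℕ.* (suc T ℕ.* suc T ℕ.^ i)           ≡⟨ ℕ.*-assoc s (suc T) (suc T ℕ.^ i) ⟨
    s ℕ.* suc T ℕ.* suc T ℕ.^ i             ≤⟨ ℕ.*-monoˡ-≤ (suc T ℕ.^ i) (ℕ.≤-trans (ℕ.m≤m+n (s ℕ.* suc T) (suc i)) (ℕ.≤-reflexive (step i s))) ⟩
    suc s ℕ.* T ℕ.* suc T ℕ.^ i             ≡⟨ swap (suc s) T (suc T ℕ.^ i) ⟩
    T ℕ.* (suc s ℕ.* suc T ℕ.^ i)           ≤⟨ ℕ.*-monoʳ-≤ T (subst (λ t → suc s ℕ.* suc t ℕ.^ i ℕ.≤ t ℕ.* t ℕ.^ i) (ℕ.+-suc i s) (go i (suc s))) ⟩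
    T ℕ.* (T ℕ.* T ℕ.^ i)                   ∎
    where
    T = suc i ℕ.+ s
    swap : ∀ x y z → x ℕ.* y ℕ.* z ≡ y ℕ.* (x ℕ.* z)
    swap = ℕ-Solver.solve-∀

-- Contrapositively, 2^p > 2^(a / M + 1 / K) ≥ n · 2^(1 / K) forces
-- ⌊M · 2^p⌋ + 1 ≥ M n (1 + 1 / T), as (1 + 1 / T)^K ≤ 2.
⌊·2^⌋<⇒≤ : ∀ m p a n k → let M = suc m ; K = suc k ; T = K ℕ.+ K in
           n ℕ.^ M ℕ.≤ 2 ℕ.^ a → suc ⌊ M ·2^ p ⌋ ℕ.* T ℕ.< M ℕ.* n ℕ.* suc T →
           p ℚ.≤ + a ℚ./ suc m ℚ.+ + 1 ℚ./ suc k
⌊·2^⌋<⇒≤ m p a n k n^M≤2^a small = ≤-/+1/ p a m k (ℕ.≮⇒≥ λ large → ℕ.<⇒≱ small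
  (^-cancelˡ-≤ E {{E≢0}} (ℕ.*-cancelʳ-≤ _ _ (2 ℕ.^ (u⁻ ℕ.* F)) {{ℕ.m^n≢0 2 (u⁻ ℕ.* F)}} (begin
  (M ℕ.* n ℕ.* suc T) ℕ.^ E ℕ.* y                 ≡⟨ cong (ℕ._* y) (trans (^-distribʳ-* (M ℕ.* n) (suc T) E) (cong (ℕ._* suc T ℕ.^ E) (^-distribʳ-* M n E))) ⟩
  M ℕ.^ E ℕ.* n ℕ.^ E ℕ.* suc T ℕ.^ E ℕ.* y       ≤⟨ ℕ.*-monoˡ-≤ y (ℕ.*-mono-≤ (ℕ.*-monoʳ-≤ (M ℕ.^ E) n^E≤) T^E≤) ⟩
  M ℕ.^ E ℕ.* 2 ℕ.^ (a ℕ.* K ℕ.* q) ℕ.* (2 ℕ.^ (M ℕ.* q) ℕ.* T ℕ.^ E) ℕ.* y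
                                                  ≡⟨ regroup (M ℕ.^ E) (2 ℕ.^ (a ℕ.* K ℕ.* q)) (2 ℕ.^ (M ℕ.* q)) (T ℕ.^ E) y ⟩
  M ℕ.^ E ℕ.* (2 ℕ.^ (a ℕ.* K ℕ.* q) ℕ.* 2 ℕ.^ (M ℕ.* q) ℕ.* y) ℕ.* T ℕ.^ E
                                                  ≡⟨ cong (λ e → M ℕ.^ E ℕ.* e ℕ.* T ℕ.^ E) powers ⟩
  M ℕ.^ E ℕ.* 2 ℕ.^ ((a ℕ.* K ℕ.+ M) ℕ.* q ℕ.+ u⁻ ℕ.* F) ℕ.* T ℕ.^ E
                                                  ≤⟨ ℕ.*-monoˡ-≤ (T ℕ.^ E) (ℕ.*-monoʳ-≤ (M ℕ.^ E) (ℕ.^-monoʳ-≤ 2 (ℕ.<⇒≤ large))) ⟩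
  M ℕ.^ E ℕ.* 2 ℕ.^ (u⁺ ℕ.* F) ℕ.* T ℕ.^ E        ≡⟨ cong (ℕ._* T ℕ.^ E) (^-* M F q u⁺) ⟨
  (M ℕ.^ q ℕ.* 2 ℕ.^ u⁺) ℕ.^ F ℕ.* T ℕ.^ E        ≤⟨ ℕ.*-monoˡ-≤ (T ℕ.^ E) (ℕ.^-monoˡ-≤ F (ℕ.<⇒≤ (⌊·2^⌋-max M p))) ⟩
  (j ℕ.^ q ℕ.* 2 ℕ.^ u⁻) ℕ.^ F ℕ.* T ℕ.^ E        ≡⟨ cong (ℕ._* T ℕ.^ E) (^-* j F q u⁻) ⟩
  j ℕ.^ E ℕ.* y ℕ.* T ℕ.^ E                       ≡⟨ swap (j ℕ.^ E) y (T ℕ.^ E) ⟩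
  j ℕ.^ E ℕ.* T ℕ.^ E ℕ.* y                       ≡⟨ cong (ℕ._* y) (^-distribʳ-* j T E) ⟨
  (j ℕ.* T) ℕ.^ E ℕ.* y                           ∎))))
  where
  open ℕ.≤-Reasoning
  M K T F q E j u⁺ u⁻ y : ℕ
  M = suc m
  K = suc k
  T = K ℕ.+ K
  F = M ℕ.* K
  q = ↧ₙ p
  E = q ℕ.* F
  j = suc ⌊ M ·2^ p ⌋
  u⁺ = (↥ p) ⁺
  u⁻ = (↥ p) ⁻
  y = 2 ℕ.^ (u⁻ ℕ.* F)
  E≢0 : ℕ.NonZero E
  E≢0 = ℕ.m*n≢0 q F
  regroup : ∀ a b c d e → a ℕ.* b ℕ.* (c ℕ.* d) ℕ.* e ≡ a ℕ.* (b ℕ.* c ℕ.* e) ℕ.* d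
  regroup = ℕ-Solver.solve-∀
  swap : ∀ a b c → a ℕ.* b ℕ.* c ≡ a ℕ.* c ℕ.* b
  swap = ℕ-Solver.solve-∀
  E≡₁ : M ℕ.* (K ℕ.* q) ≡ E
  E≡₁ = lemma M K q
    where
    lemma : ∀ a b c → a ℕ.* (b ℕ.* c) ≡ c ℕ.* (a ℕ.* b)
    lemma = ℕ-Solver.solve-∀
  E≡₂ : K ℕ.* (M ℕ.* q) ≡ E
  E≡₂ = lemma M K q
    where
    lemma : ∀ a b c → b ℕ.* (a ℕ.* c) ≡ c ℕ.* (a ℕ.* b)
    lemma = ℕ-Solver.solve-∀
  n^E≤ : n ℕ.^ E ℕ.≤ 2 ℕ.^ (a ℕ.* K ℕ.* q)
  n^E≤ = begin
    n ℕ.^ E                       ≡⟨ trans (ℕ.^-*-assoc n M (K ℕ.* q)) (cong (n ℕ.^_) E≡₁) ⟨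
    (n ℕ.^ M) ℕ.^ (K ℕ.* q)       ≤⟨ ℕ.^-monoˡ-≤ (K ℕ.* q) n^M≤2^a ⟩
    (2 ℕ.^ a) ℕ.^ (K ℕ.* q)       ≡⟨ trans (ℕ.^-*-assoc 2 a (K ℕ.* q)) (cong (2 ℕ.^_) (sym (ℕ.*-assoc a K q))) ⟩
    2 ℕ.^ (a ℕ.* K ℕ.* q)         ∎
  T^E≤ : suc T ℕ.^ E ℕ.≤ 2 ℕ.^ (M ℕ.* q) ℕ.* T ℕ.^ E
  T^E≤ = begin
    suc T ℕ.^ E                             ≡⟨ trans (ℕ.^-*-assoc (suc T) K (M ℕ.* q)) (cong (suc T ℕ.^_) E≡₂) ⟨
    (suc T ℕ.^ K) ℕ.^ (M ℕ.* q)             ≤⟨ ℕ.^-monoˡ-≤ (M ℕ.* q) ([1+1/2K]^K≤2 K) ⟩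
    (2 ℕ.* T ℕ.^ K) ℕ.^ (M ℕ.* q)           ≡⟨ ^-distribʳ-* 2 (T ℕ.^ K) (M ℕ.* q) ⟩
    2 ℕ.^ (M ℕ.* q) ℕ.* (T ℕ.^ K) ℕ.^ (M ℕ.* q)   ≡⟨ cong (2 ℕ.^ (M ℕ.* q) ℕ.*_) (trans (ℕ.^-*-assoc T K (M ℕ.* q)) (cong (T ℕ.^_) E≡₂)) ⟩
    2 ℕ.^ (M ℕ.* q) ℕ.* T ℕ.^ E             ∎
  powers : 2 ℕ.^ (a ℕ.* K ℕ.* q) ℕ.* 2 ℕ.^ (M ℕ.* q) ℕ.* y ≡ 2 ℕ.^ ((a ℕ.* K ℕ.+ M) ℕ.* q ℕ.+ u⁻ ℕ.* F)
  powers = sym (trans (ℕ.^-distribˡ-+-* 2 ((a ℕ.* K ℕ.+ M) ℕ.* q) (u⁻ ℕ.* F)) (cong (ℕ._* y)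
    (trans (cong (2 ℕ.^_) (ℕ.*-distribʳ-+ q (a ℕ.* K) M)) (ℕ.^-distribˡ-+-* 2 (a ℕ.* K ℕ.* q) (M ℕ.* q)))))

-- The terms of log₂ n are A / M with 2^A ≤ n^M, so K · 2^(A/M) ≤ K n. An exponent at most 1/K
-- larger costs a factor of about 1 + 1/K.
≤log₂⇒2^≤ : ∀ y n → .{{ℕ.NonZero n}} → y ≤ log₂ n → 2^ y ≤ fromℕ n
≤log₂⇒2^≤ y n y≤ δ 0<δ =
  let l , 1/l≤δ = archimedean δ 0<δ
      -- K = suc k is (n+2)(l+1). The estimate is (n + 1/K)(1 + 1/K), whose excess over n is at most
      -- (n+2)/K = 1/(l+1).
      k = l ℕ.+ suc n ℕ.* suc l
      N , y≤L = y≤ (+ 1 ℚ./ suc k) (ℚ.positive⁻¹ (+ 1 ℚ./ suc k) {{ℚ.normalize-pos 1 (suc k)}})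
  in N , λ m N≤m →
    let M = suc m
        A = ⌊log₂ (n ℕ.^ M) ⌋
        instance _ = ℕ.m^n≢0 n M
    in ℚ.≤-trans
      (/-≤-/+1/ ⌊ M ·2^ seq y m ⌋ m n 0 l
        (bound l m ⌊ M ·2^ seq y m ⌋ ⌊ suc k ·2^ + A ℚ./ M ⌋
          (⌊·2^⌋-close M (suc k) (seq y m) (+ A ℚ./ M) k (y≤L m N≤m))
          (⌊·2^/⌋≤ (suc k) A m n (2^⌊log₂n⌋≤n (n ℕ.^ M)))))
      (ℚ.+-monoʳ-≤ (+ n ℚ./ 1) 1/l≤δ)
  where
  open ℕ.≤-Reasoning
  bound : ∀ l m e f → let k = l ℕ.+ suc n ℕ.* suc l in
          e ℕ.* suc k ℕ.* suc k ℕ.≤ suc m ℕ.* suc f ℕ.* suc (suc k) → f ℕ.≤ suc k ℕ.* n →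
          e ℕ.* (1 ℕ.* suc l) ℕ.≤ (n ℕ.* suc l ℕ.+ 1) ℕ.* suc m
  bound l m e f close f≤ = ℕ.*-cancelˡ-≤ (suc (suc n) ℕ.* K) (begin
    suc (suc n) ℕ.* K ℕ.* (e ℕ.* (1 ℕ.* suc l))      ≡⟨ lhs n l e K ⟩
    e ℕ.* K ℕ.* (suc (suc n) ℕ.* suc l)              ≤⟨ close ⟩
    suc m ℕ.* suc f ℕ.* suc K                        ≤⟨ ℕ.*-monoˡ-≤ (suc K) (ℕ.*-monoʳ-≤ (suc m) (ℕ.s≤s f≤)) ⟩
    suc m ℕ.* suc (K ℕ.* n) ℕ.* suc K                ≡⟨ mid m K n ⟩
    suc m ℕ.* (K ℕ.* (n ℕ.* K ℕ.+ n) ℕ.+ K ℕ.+ 1)    ≤⟨ ℕ.*-monoʳ-≤ (suc m) (ℕ.+-monoʳ-≤ (K ℕ.* (n ℕ.* K ℕ.+ n) ℕ.+ K) (ℕ.s≤s ℕ.z≤n)) ⟩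
    suc m ℕ.* (K ℕ.* (n ℕ.* K ℕ.+ n) ℕ.+ K ℕ.+ K)    ≡⟨ rhs m n l ⟩
    suc (suc n) ℕ.* K ℕ.* ((n ℕ.* suc l ℕ.+ 1) ℕ.* suc m)  ∎)
    where
    K : ℕ
    K = suc (suc n) ℕ.* suc l
    lhs : ∀ n l e K → suc (suc n) ℕ.* K ℕ.* (e ℕ.* (1 ℕ.* suc l)) ≡ e ℕ.* K ℕ.* (suc (suc n) ℕ.* suc l)
    lhs = ℕ-Solver.solve-∀
    mid : ∀ m K n → suc m ℕ.* suc (K ℕ.* n) ℕ.* suc K ≡ suc m ℕ.* (K ℕ.* (n ℕ.* K ℕ.+ n) ℕ.+ K ℕ.+ 1)
    mid = ℕ-Solver.solve-∀
    rhs : ∀ m n l → let K = suc (suc n) ℕ.* suc l in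
          suc m ℕ.* (K ℕ.* (n ℕ.* K ℕ.+ n) ℕ.+ K ℕ.+ K) ≡ suc (suc n) ℕ.* K ℕ.* ((n ℕ.* suc l ℕ.+ 1) ℕ.* suc m)
    rhs = ℕ-Solver.solve-∀

-- Now n^M < 2^(A+1) is the useful half of the floor. It bounds the exponent by (A+1)/M + 1/K, and
-- for m > k the extra 1/M is absorbed by a second 1/K.
2^≤⇒≤log₂ : ∀ y n → .{{ℕ.NonZero n}} → 2^ y ≤ fromℕ n → y ≤ log₂ n
2^≤⇒≤log₂ y n@(suc n′) 2^y≤ δ 0<δ =
  let k , 1/k≤½δ = archimedean (½ ℚ.* δ) (half>0 0<δ)
      T = suc k ℕ.+ suc k
      -- Here suc t = 2T. With accuracy 1/(2T) and M > 2T, the quantity (e+1) T stays below M n T +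
      -- M/2 + M/2, which is at most M n (T+1) as n ≥ 1.
      t = k ℕ.+ suc k ℕ.+ T
      N , e≤ = 2^y≤ (+ 1 ℚ./ suc t) (ℚ.positive⁻¹ (+ 1 ℚ./ suc t) {{ℚ.normalize-pos 1 (suc t)}})
  in N ℕ.⊔ suc t , λ m p →
    let M = suc m
        N≤m = ℕ.m⊔n≤o⇒m≤o N (suc t) p
        t<m = ℕ.m⊔n≤o⇒n≤o N (suc t) p
        A = ⌊log₂ (n ℕ.^ M) ⌋
        k≤m = ℕ.≤-trans (ℕ.m≤m+n (suc k) (suc k ℕ.+ T)) (ℕ.≤-trans (ℕ.≤-reflexive (sym (ℕ.+-assoc (suc k) (suc k) T))) t<m)
    in begin
      seq y m                                         ≤⟨ ⌊·2^⌋<⇒≤ m (seq y m) (suc A) n k (ℕ.<⇒≤ (n<2^[1+⌊log₂n⌋] (n ℕ.^ M)))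
                                                           (bound k m ⌊ M ·2^ seq y m ⌋ (/-≤-/+1/⇒ ⌊ M ·2^ seq y m ⌋ m n 0 t (e≤ m N≤m)) t<m) ⟩
      + suc A ℚ./ M ℚ.+ + 1 ℚ./ suc k                 ≤⟨ ℚ.+-monoˡ-≤ (+ 1 ℚ./ suc k) (/-≤-/+1/ (suc A) m A m k (increment A m k k≤m)) ⟩
      + A ℚ./ M ℚ.+ + 1 ℚ./ suc k ℚ.+ + 1 ℚ./ suc k   ≤⟨ ℚ.+-mono-≤ (ℚ.+-monoʳ-≤ (+ A ℚ./ M) 1/k≤½δ) 1/k≤½δ ⟩
      + A ℚ./ M ℚ.+ ½ ℚ.* δ ℚ.+ ½ ℚ.* δ               ≡⟨ ℚ.+-assoc (+ A ℚ./ M) (½ ℚ.* δ) (½ ℚ.* δ) ⟩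
      + A ℚ./ M ℚ.+ (½ ℚ.* δ ℚ.+ ½ ℚ.* δ)             ≡⟨ cong (+ A ℚ./ M ℚ.+_) (halves δ) ⟩
      + A ℚ./ M ℚ.+ δ                                 ∎
  where
  open ℚ.≤-Reasoning
  increment : ∀ A m k → suc k ℕ.≤ m → suc A ℕ.* (suc m ℕ.* suc k) ℕ.≤ (A ℕ.* suc k ℕ.+ suc m) ℕ.* suc m
  increment A m k k≤m = ℕ.≤-trans (ℕ.≤-reflexive (lemma A (suc m) (suc k)))
    (ℕ.*-monoˡ-≤ (suc m) (ℕ.+-monoʳ-≤ (A ℕ.* suc k) (ℕ.m≤n⇒m≤1+n k≤m)))
    where
    lemma : ∀ A M K → suc A ℕ.* (M ℕ.* K) ≡ (A ℕ.* K ℕ.+ K) ℕ.* M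
    lemma = ℕ-Solver.solve-∀
  bound : ∀ k m e → let T = suc k ℕ.+ suc k ; t = k ℕ.+ suc k ℕ.+ T in
          e ℕ.* (1 ℕ.* suc t) ℕ.≤ (n ℕ.* suc t ℕ.+ 1) ℕ.* suc m → suc t ℕ.≤ m →
          suc e ℕ.* T ℕ.< suc m ℕ.* n ℕ.* suc T
  bound k m e h t<m = ℕ.*-cancelˡ-< 2 _ _ (R.begin-strict
    2 ℕ.* (suc e ℕ.* T)                               R.≡⟨ lhs e T ⟩
    e ℕ.* (1 ℕ.* (T ℕ.+ T)) ℕ.+ (T ℕ.+ T)             R.<⟨ ℕ.+-mono-≤-< h (ℕ.s≤s t<m) ⟩
    (n ℕ.* (T ℕ.+ T) ℕ.+ 1) ℕ.* suc m ℕ.+ suc m       R.≤⟨ ℕ.m≤m+n _ (2 ℕ.* (n′ ℕ.* suc m)) ⟩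
    (n ℕ.* (T ℕ.+ T) ℕ.+ 1) ℕ.* suc m ℕ.+ suc m ℕ.+ 2 ℕ.* (n′ ℕ.* suc m)   R.≡⟨ rhs n′ T m ⟩
    2 ℕ.* (suc m ℕ.* n ℕ.* suc T)                     R.∎)
    where
    module R = ℕ.≤-Reasoning
    T = suc k ℕ.+ suc k
    lhs : ∀ e T → 2 ℕ.* (suc e ℕ.* T) ≡ e ℕ.* (1 ℕ.* (T ℕ.+ T)) ℕ.+ (T ℕ.+ T)
    lhs = ℕ-Solver.solve-∀
    rhs : ∀ n′ T m → (suc n′ ℕ.* (T ℕ.+ T) ℕ.+ 1) ℕ.* suc m ℕ.+ suc m ℕ.+ 2 ℕ.* (n′ ℕ.* suc m) ≡
          2 ℕ.* (suc m ℕ.* suc n′ ℕ.* suc T)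
    rhs = ℕ-Solver.solve-∀

-- Probability distributions

∑ℚ : (F₂^ n → ℚ) → ℚ
∑ℚ {zero}  f = f []
∑ℚ {suc n} f = ∑ℚ (λ α → f (false ∷ α)) ℚ.+ ∑ℚ (λ α → f (true ∷ α))

seq-∑ : (f : F₂^ n → ℝ) → ∀ i → seq (∑ f) i ≡ ∑ℚ λ α → seq (f α) i
seq-∑ {zero}  f i = refl
seq-∑ {suc n} f i = cong₂ ℚ._+_ (seq-∑ (f ∘ (false ∷_)) i) (seq-∑ (f ∘ (true ∷_)) i)

∑ℚ-cong : {f g : F₂^ n → ℚ} → (∀ α → f α ≡ g α) → ∑ℚ f ≡ ∑ℚ g
∑ℚ-cong {zero}  eq = eq []
∑ℚ-cong {suc n} eq = cong₂ ℚ._+_ (∑ℚ-cong (eq ∘ (false ∷_))) (∑ℚ-cong (eq ∘ (true ∷_)))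

∑ℚ-+ : (f g : F₂^ n → ℚ) → ∑ℚ (λ α → f α ℚ.+ g α) ≡ ∑ℚ f ℚ.+ ∑ℚ g
∑ℚ-+ {zero}  f g = refl
∑ℚ-+ {suc n} f g = trans
  (cong₂ ℚ._+_ (∑ℚ-+ (f ∘ (false ∷_)) (g ∘ (false ∷_))) (∑ℚ-+ (f ∘ (true ∷_)) (g ∘ (true ∷_))))
  (interchange (∑ℚ (f ∘ (false ∷_))) (∑ℚ (g ∘ (false ∷_))) (∑ℚ (f ∘ (true ∷_))) (∑ℚ (g ∘ (true ∷_))))
  where
  interchange : ∀ a b c d → (a ℚ.+ b) ℚ.+ (c ℚ.+ d) ≡ (a ℚ.+ c) ℚ.+ (b ℚ.+ d)
  interchange = solve 4 (λ a b c d → (a :+ b) :+ (c :+ d) := (a :+ c) :+ (b :+ d)) refl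
    where open +-*-Solver

∑ℚ-*ˡ : ∀ c (f : F₂^ n → ℚ) → ∑ℚ (λ α → c ℚ.* f α) ≡ c ℚ.* ∑ℚ f
∑ℚ-*ˡ {zero}  c f = refl
∑ℚ-*ˡ {suc n} c f = trans (cong₂ ℚ._+_ (∑ℚ-*ˡ c (f ∘ (false ∷_))) (∑ℚ-*ˡ c (f ∘ (true ∷_))))
  (sym (ℚ.*-distribˡ-+ c _ _))

∑ℚ-zero : {f : F₂^ n → ℚ} → (∀ α → f α ≡ 0ℚ) → ∑ℚ f ≡ 0ℚ
∑ℚ-zero {zero}  eq = eq []
∑ℚ-zero {suc n} eq = cong₂ ℚ._+_ (∑ℚ-zero (eq ∘ (false ∷_))) (∑ℚ-zero (eq ∘ (true ∷_)))

∑ℚ-swap : (f : F₂^ m → F₂^ n → ℚ) → ∑ℚ (λ α → ∑ℚ (f α)) ≡ ∑ℚ (λ β → ∑ℚ λ α → f α β)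
∑ℚ-swap {zero}  f = refl
∑ℚ-swap {suc m} f = trans (cong₂ ℚ._+_ (∑ℚ-swap (f ∘ (false ∷_))) (∑ℚ-swap (f ∘ (true ∷_))))
  (sym (∑ℚ-+ (λ β → ∑ℚ λ α → f (false ∷ α) β) (λ β → ∑ℚ λ α → f (true ∷ α) β)))

indicator : Bool → ℚ
indicator b = if b then 1ℚ else 0ℚ

-- The rewriting is done in ℚ, since a comparison of two reals would compare
-- their Cauchy proofs.
seq-𝔼 : ∀ (D : Distribution n) (f : F₂^ n → ℝ) i → seq (𝔼 D f) i ≡ ∑ℚ λ α → seq (mass D α) i ℚ.* seq (f α) i
seq-𝔼 D f i = seq-∑ (λ α → mass D α * f α) i

seq-if : ∀ b i → seq (if b then 1ℝ else 0ℝ) i ≡ indicator b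
seq-if false i = refl
seq-if true  i = refl

seq-Pr : ∀ (D : Distribution n) (e : F₂^ n → Bool) i → seq Pr[ e ⇐ D ] i ≡ ∑ℚ λ α → seq (mass D α) i ℚ.* indicator (e α)
seq-Pr D e i = trans (seq-𝔼 D (λ α → if e α then 1ℝ else 0ℝ) i)
  (∑ℚ-cong λ α → cong (seq (mass D α) i ℚ.*_) (seq-if (e α) i))

∑ℚ-point : ∀ (β : F₂^ n) (g : F₂^ n → ℚ) → ∑ℚ (λ α → indicator (does (β ≟ α)) ℚ.* g α) ≡ g β
∑ℚ-point {zero}  []      g = ℚ.*-identityˡ (g [])
∑ℚ-point {suc n} (false ∷ β) g = trans
  (cong₂ ℚ._+_ (∑ℚ-point β (g ∘ (false ∷_))) (∑ℚ-zero λ α → ℚ.*-zeroˡ (g (true ∷ α))))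
  (ℚ.+-identityʳ (g (false ∷ β)))
∑ℚ-point {suc n} (true ∷ β) g = trans
  (cong₂ ℚ._+_ (∑ℚ-zero λ α → ℚ.*-zeroˡ (g (false ∷ α))) (∑ℚ-point β (g ∘ (true ∷_))))
  (ℚ.+-identityˡ (g (true ∷ β)))

-- Change of variables: after exchanging the sums, the indicator collapses the inner one to the
-- single point α = φ(β).
∑ℚ-image : (φ : F₂^ m → F₂^ n) (d : F₂^ m → ℚ) (g : F₂^ n → ℚ) →
           ∑ℚ (λ α → ∑ℚ (λ β → d β ℚ.* indicator (does (φ β ≟ α))) ℚ.* g α) ≡ ∑ℚ λ β → d β ℚ.* g (φ β)
∑ℚ-image {m} {n} φ d g = begin
  ∑ℚ (λ α → ∑ℚ (λ β → d β ℚ.* δ β α) ℚ.* g α)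
    ≡⟨ ∑ℚ-cong expand ⟩
  ∑ℚ (λ α → ∑ℚ λ β → d β ℚ.* (δ β α ℚ.* g α))
    ≡⟨ ∑ℚ-swap (λ α β → d β ℚ.* (δ β α ℚ.* g α)) ⟩
  ∑ℚ (λ β → ∑ℚ λ α → d β ℚ.* (δ β α ℚ.* g α))
    ≡⟨ ∑ℚ-cong (λ β → trans (∑ℚ-*ˡ (d β) (λ α → δ β α ℚ.* g α)) (cong (d β ℚ.*_) (∑ℚ-point (φ β) g))) ⟩
  ∑ℚ (λ β → d β ℚ.* g (φ β)) ∎
  where
  open ≡-Reasoning
  δ : F₂^ m → F₂^ n → ℚ
  δ β α = indicator (does (φ β ≟ α))
  rotate : ∀ a b c → a ℚ.* (b ℚ.* c) ≡ b ℚ.* (c ℚ.* a)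
  rotate = solve 3 (λ a b c → a :* (b :* c) := b :* (c :* a)) refl
    where open +-*-Solver
  expand : ∀ α → ∑ℚ (λ β → d β ℚ.* δ β α) ℚ.* g α ≡ ∑ℚ λ β → d β ℚ.* (δ β α ℚ.* g α)
  expand α = begin
    ∑ℚ (λ β → d β ℚ.* δ β α) ℚ.* g α           ≡⟨ ℚ.*-comm (∑ℚ (λ β → d β ℚ.* δ β α)) (g α) ⟩
    g α ℚ.* ∑ℚ (λ β → d β ℚ.* δ β α)           ≡⟨ ∑ℚ-*ˡ (g α) (λ β → d β ℚ.* δ β α) ⟨
    ∑ℚ (λ β → g α ℚ.* (d β ℚ.* δ β α))         ≡⟨ ∑ℚ-cong (λ β → rotate (g α) (d β) (δ β α)) ⟩
    ∑ℚ (λ β → d β ℚ.* (δ β α ℚ.* g α))         ∎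

∑-mono : {f g : F₂^ n → ℝ} → (∀ α → seq (f α) ≲ seq (g α)) → seq (∑ f) ≲ seq (∑ g)
∑-mono {zero}  f≲g = f≲g []
∑-mono {suc n} f≲g = ≲-+ (∑-mono (f≲g ∘ (false ∷_))) (∑-mono (f≲g ∘ (true ∷_)))

∑-nonNegative : {f : F₂^ n → ℝ} → (∀ α → seq 0ℝ ≲ seq (f α)) → seq 0ℝ ≲ seq (∑ f)
∑-nonNegative {zero}  0≲f = 0≲f []
∑-nonNegative {suc n} 0≲f = ≲-+ (∑-nonNegative (0≲f ∘ (false ∷_))) (∑-nonNegative (0≲f ∘ (true ∷_)))

*-indicator-nonNegative : ∀ x b → seq 0ℝ ≲ seq x → seq 0ℝ ≲ seq (x * (if b then 1ℝ else 0ℝ))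
*-indicator-nonNegative x false _   = ≲-reflexive λ i → sym (ℚ.*-zeroʳ (seq x i))
*-indicator-nonNegative x true  0≲x = ≲-trans 0≲x (≲-reflexive λ i → sym (ℚ.*-identityʳ (seq x i)))

Pr-nonNegative : ∀ (D : Distribution n) (e : F₂^ n → Bool) → seq 0ℝ ≲ seq Pr[ e ⇐ D ]
Pr-nonNegative D e = ∑-nonNegative {f = λ α → mass D α * (if e α then 1ℝ else 0ℝ)}
  λ α → *-indicator-nonNegative (mass D α) (e α) (mk≲ (nonNegative D α))

total≲1 : (D : Distribution n) → seq (∑ (mass D)) ≲ seq 1ℝ
total≲1 D = mk≲ (≈⇒≤ (∑ (mass D)) 1ℝ (total D))

1≲total : (D : Distribution n) → seq 1ℝ ≲ seq (∑ (mass D))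
1≲total D = mk≲ (≈⇒≤ 1ℝ (∑ (mass D)) (≈-sym (∑ (mass D)) 1ℝ (total D)))

total-from : (mass : F₂^ n → ℝ) → seq (∑ mass) ≲ seq 1ℝ → seq 1ℝ ≲ seq (∑ mass) → ∑ mass ≈ 1ℝ
total-from mass upper lower = ≤-antisym (∑ mass) 1ℝ (eventually upper) (eventually lower)

∑ℚ-*1 : (f : F₂^ n → ℝ) → ∀ i → seq (∑ f) i ≡ ∑ℚ λ α → seq (f α) i ℚ.* 1ℚ
∑ℚ-*1 f i = trans (seq-∑ f i) (∑ℚ-cong λ α → sym (ℚ.*-identityʳ (seq (f α) i)))

opaque

  -- The image measure: the mass of α is the probability of its fibre. Later steps need only its
  -- terms and its sign, so the definition stays sealed.
  image : (F₂^ m → F₂^ n) → Distribution m → F₂^ n → ℝ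
  image φ D α = Pr[ (λ β → does (φ β ≟ α)) ⇐ D ]

  seq-image : ∀ (φ : F₂^ m → F₂^ n) D α i →
              seq (image φ D α) i ≡ ∑ℚ λ β → seq (mass D β) i ℚ.* indicator (does (φ β ≟ α))
  seq-image φ D α = seq-Pr D (λ β → does (φ β ≟ α))

  image-nonNegative : ∀ (φ : F₂^ m → F₂^ n) D α → seq 0ℝ ≲ seq (image φ D α)
  image-nonNegative φ D α = Pr-nonNegative D λ β → does (φ β ≟ α)

module _ (φ : F₂^ m → F₂^ n) (D : Distribution m) where

  image-𝔼 : ∀ (g : F₂^ n → ℚ) i → ∑ℚ (λ α → seq (image φ D α) i ℚ.* g α) ≡ ∑ℚ λ β → seq (mass D β) i ℚ.* g (φ β)
  image-𝔼 g i = trans (∑ℚ-cong λ α → cong (ℚ._* g α) (seq-image φ D α i))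
    (∑ℚ-image φ (λ β → seq (mass D β) i) g)

  private
    image-total : ∀ i → seq (∑ (image φ D)) i ≡ seq (∑ (mass D)) i
    image-total i = trans (∑ℚ-*1 (image φ D) i) (trans (image-𝔼 (λ _ → 1ℚ) i) (sym (∑ℚ-*1 (mass D) i)))

  pushforward : Distribution n
  pushforward = record
    { mass        = image φ D
    ; nonNegative = λ α → eventually (image-nonNegative φ D α)
    ; total       = total-from (image φ D)
        (≲-trans (≲-reflexive image-total) (total≲1 D))
        (≲-trans (1≲total D) (≲-reflexive (λ i → sym (image-total i))))
    }

  pushforward-Pr : ∀ (e : F₂^ n → Bool) i → seq Pr[ e ⇐ pushforward ] i ≡ seq Pr[ (λ β → e (φ β)) ⇐ D ] i
  pushforward-Pr e i = trans (seq-Pr pushforward e i)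
    (trans (image-𝔼 (λ α → indicator (e α)) i) (sym (seq-Pr D (λ β → e (φ β)) i)))

  pushforward-∉ : ∀ {α} → (∀ β → φ β ≢ α) → ∀ i → seq (mass pushforward α) i ≡ 0ℚ
  pushforward-∉ {α} ∉ i = trans (seq-image φ D α i)
    (∑ℚ-zero λ β → trans (cong (λ b → seq (mass D β) i ℚ.* indicator b) (dec-false (φ β ≟ α) (∉ β)))
                         (ℚ.*-zeroʳ (seq (mass D β) i)))

-- Lazy walks and eigenvalues

≲-½* : ∀ {s t} → s ≲ t → (λ i → ½ ℚ.* s i) ≲ (λ i → ½ ℚ.* t i)
≲-½* {s} {t} s≲t = ≲-trans (≲-reflexive λ i → ℚ.*-comm ½ (s i))
  (≲-trans (≲-*ʳ (rational ½) (0 , λ _ _ → ℚ.nonNegative⁻¹ ½) s≲t) (≲-reflexive λ i → ℚ.*-comm (t i) ½))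

module _ (D : Distribution n) where

  private
    -- The walk stays put with probability 1/2: an equal mixture of `D` and the point mass at `𝟎`.
    slow : F₂^ n → ℝ
    slow α = rational ½ * mass D α + rational ½ * (if does (𝟎 ≟ α) then 1ℝ else 0ℝ)

  slow-𝔼 : ∀ (g : F₂^ n → ℚ) i → ∑ℚ (λ α → seq (slow α) i ℚ.* g α) ≡ ½ ℚ.* ∑ℚ (λ α → seq (mass D α) i ℚ.* g α) ℚ.+ ½ ℚ.* g 𝟎
  slow-𝔼 g i = begin
    ∑ℚ (λ α → seq (slow α) i ℚ.* g α)
      ≡⟨ ∑ℚ-cong (λ α → trans (cong (λ x → (½ ℚ.* d α ℚ.+ ½ ℚ.* x) ℚ.* g α) (seq-if (does (𝟎 ≟ α)) i))
                              (distrib ½ (d α) (δ α) (g α))) ⟩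
    ∑ℚ (λ α → ½ ℚ.* (d α ℚ.* g α) ℚ.+ ½ ℚ.* (δ α ℚ.* g α))
      ≡⟨ ∑ℚ-+ (λ α → ½ ℚ.* (d α ℚ.* g α)) (λ α → ½ ℚ.* (δ α ℚ.* g α)) ⟩
    ∑ℚ (λ α → ½ ℚ.* (d α ℚ.* g α)) ℚ.+ ∑ℚ (λ α → ½ ℚ.* (δ α ℚ.* g α))
      ≡⟨ cong₂ ℚ._+_ (∑ℚ-*ˡ ½ (λ α → d α ℚ.* g α)) (∑ℚ-*ˡ ½ (λ α → δ α ℚ.* g α)) ⟩
    ½ ℚ.* ∑ℚ (λ α → d α ℚ.* g α) ℚ.+ ½ ℚ.* ∑ℚ (λ α → δ α ℚ.* g α)
      ≡⟨ cong (λ b → ½ ℚ.* ∑ℚ (λ α → d α ℚ.* g α) ℚ.+ ½ ℚ.* b) (∑ℚ-point 𝟎 g) ⟩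
    ½ ℚ.* ∑ℚ (λ α → d α ℚ.* g α) ℚ.+ ½ ℚ.* g 𝟎 ∎
    where
    open ≡-Reasoning
    d δ : F₂^ n → ℚ
    d α = seq (mass D α) i
    δ α = indicator (does (𝟎 ≟ α))
    distrib : ∀ h a b c → (h ℚ.* a ℚ.+ h ℚ.* b) ℚ.* c ≡ h ℚ.* (a ℚ.* c) ℚ.+ h ℚ.* (b ℚ.* c)
    distrib = solve 4 (λ h a b c → (h :* a :+ h :* b) :* c := h :* (a :* c) :+ h :* (b :* c)) refl
      where open +-*-Solver

  private
    slow-total : ∀ i → seq (∑ slow) i ≡ ½ ℚ.* seq (∑ (mass D)) i ℚ.+ ½ ℚ.* 1ℚ
    slow-total i = trans (∑ℚ-*1 slow i) (trans (slow-𝔼 (λ _ → 1ℚ) i)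
      (cong (λ t → ½ ℚ.* t ℚ.+ ½ ℚ.* 1ℚ) (sym (∑ℚ-*1 (mass D) i))))

    ½-refl : (λ (_ : ℕ) → ½ ℚ.* 1ℚ) ≲ λ _ → ½ ℚ.* 1ℚ
    ½-refl = ≲-reflexive λ _ → refl

    0≲½ : seq 0ℝ ≲ seq (rational ½)
    0≲½ = mk≲ λ δ 0<δ → 0 , λ _ _ → ℚ.≤-trans (ℚ.nonNegative⁻¹ ½)
      (ℚ.≤-trans (ℚ.≤-reflexive (sym (ℚ.+-identityʳ ½))) (ℚ.+-monoʳ-≤ ½ (ℚ.<⇒≤ 0<δ)))

    slow-nonNegative : ∀ α → seq 0ℝ ≲ seq (slow α)
    slow-nonNegative α = ≲-trans (≲-reflexive λ _ → refl)
      (≲-+ (≲-½* {seq 0ℝ} {seq (mass D α)} (mk≲ (nonNegative D α)))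
           (*-indicator-nonNegative (rational ½) (does (𝟎 ≟ α)) 0≲½))

  lazy : Distribution n
  lazy = record
    { mass        = slow
    ; nonNegative = λ α → eventually (slow-nonNegative α)
    ; total       = total-from slow
        (≲-trans (≲-reflexive slow-total) (≲-trans (≲-+ (≲-½* (total≲1 D)) ½-refl) (≲-reflexive λ _ → refl)))
        (≲-trans (≲-trans (≲-reflexive λ _ → refl) (≲-+ (≲-½* (1≲total D)) ½-refl)) (≲-reflexive λ i → sym (slow-total i)))
    }

sign : Bool → ℚ
sign false = 1ℚ
sign true  = ℚ.- 1ℚ

seq-eigenvalue : ∀ (D : Distribution h) b i →
                 seq (eigenvalue (Cay D) b) i ≡ ∑ℚ λ α → seq (mass D α) i ℚ.* sign (apply b α)
seq-eigenvalue D b i = trans (seq-𝔼 D (λ α → [-1]^ apply b α) i)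
  (∑ℚ-cong λ α → cong (seq (mass D α) i ℚ.*_) (seq-sign (apply b α)))
  where
  seq-sign : ∀ b → seq ([-1]^ b) i ≡ sign b
  seq-sign false = refl
  seq-sign true  = refl

-- Pointwise (-1)^x + 2x = 1 for a bit x. Weighting by the masses gives λ + 2 Pr = total mass,
-- exactly at every index, although the total is 1 only in the limit.
eigenvalue-Pr : ∀ (D : Distribution h) b i →
                seq (eigenvalue (Cay D) b) i ℚ.+ (seq Pr[ apply b ⇐ D ] i ℚ.+ seq Pr[ apply b ⇐ D ] i) ≡
                seq (∑ (mass D)) i
eigenvalue-Pr {h} D b i = begin
  seq (eigenvalue (Cay D) b) i ℚ.+ (seq Pr[ apply b ⇐ D ] i ℚ.+ seq Pr[ apply b ⇐ D ] i)
    ≡⟨ cong₂ (λ x y → x ℚ.+ (y ℚ.+ y)) (seq-eigenvalue D b i) (seq-Pr D (apply b) i) ⟩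
  ∑ℚ s ℚ.+ (∑ℚ p ℚ.+ ∑ℚ p)
    ≡⟨ trans (∑ℚ-+ s (λ α → p α ℚ.+ p α)) (cong (∑ℚ s ℚ.+_) (∑ℚ-+ p p)) ⟨
  ∑ℚ (λ α → s α ℚ.+ (p α ℚ.+ p α))
    ≡⟨ ∑ℚ-cong (λ α → pointwise (seq (mass D α) i) (apply b α)) ⟩
  ∑ℚ (λ α → seq (mass D α) i)
    ≡⟨ seq-∑ (mass D) i ⟨
  seq (∑ (mass D)) i ∎
  where
  open ≡-Reasoning
  s p : F₂^ h → ℚ
  s α = seq (mass D α) i ℚ.* sign (apply b α)
  p α = seq (mass D α) i ℚ.* indicator (apply b α)
  pointwise : ∀ d b → d ℚ.* sign b ℚ.+ (d ℚ.* indicator b ℚ.+ d ℚ.* indicator b) ≡ d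
  pointwise d false = solve 1 (λ d → d :* con 1ℚ :+ (d :* con 0ℚ :+ d :* con 0ℚ) := d) refl d
    where open +-*-Solver
  pointwise d true  = solve 1 (λ d → d :* con (ℚ.- 1ℚ) :+ (d :* con 1ℚ :+ d :* con 1ℚ) := d) refl d
    where open +-*-Solver

apply-𝟎 : (b : Dual h) → apply b 𝟎 ≡ false
apply-𝟎 {h} b = trans (cong (apply b) (sym (false-⊙ {h} 𝟎))) (homogeneous b false 𝟎)

-- Halving the previous identity and adding the contribution 1/2 of the point mass at `𝟎`, where
-- every character is 1, removes the factor 2 in front of the probability.
eigenvalue-lazy : ∀ (D : Distribution h) b i →
                  seq (eigenvalue (Cay (lazy D)) b) i ℚ.+ seq Pr[ apply b ⇐ D ] i ≡
                  ½ ℚ.* seq (∑ (mass D)) i ℚ.+ ½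
eigenvalue-lazy D b i = begin
  seq (eigenvalue (Cay (lazy D)) b) i ℚ.+ p
    ≡⟨ cong (ℚ._+ p) (trans (seq-eigenvalue (lazy D) b i) (slow-𝔼 D (λ α → sign (apply b α)) i)) ⟩
  ½ ℚ.* ∑ℚ (λ α → seq (mass D α) i ℚ.* sign (apply b α)) ℚ.+ ½ ℚ.* sign (apply b 𝟎) ℚ.+ p
    ≡⟨ cong₂ (λ e x → ½ ℚ.* e ℚ.+ ½ ℚ.* sign x ℚ.+ p) (sym (seq-eigenvalue D b i)) (apply-𝟎 b) ⟩
  ½ ℚ.* e ℚ.+ ½ ℚ.* 1ℚ ℚ.+ p
    ≡⟨ regroup e p ⟩
  ½ ℚ.* (e ℚ.+ (p ℚ.+ p)) ℚ.+ ½
    ≡⟨ cong (λ t → ½ ℚ.* t ℚ.+ ½) (eigenvalue-Pr D b i) ⟩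
  ½ ℚ.* seq (∑ (mass D)) i ℚ.+ ½ ∎
  where
  open ≡-Reasoning
  p e : ℚ
  p = seq Pr[ apply b ⇐ D ] i
  e = seq (eigenvalue (Cay D) b) i
  regroup : ∀ e p → ½ ℚ.* e ℚ.+ ½ ℚ.* 1ℚ ℚ.+ p ≡ ½ ℚ.* (e ℚ.+ (p ℚ.+ p)) ℚ.+ ½
  regroup = solve 2 (λ e p → con ½ :* e :+ con ½ :* con 1ℚ :+ p := con ½ :* (e :+ (p :+ p)) :+ con ½) refl
    where open +-*-Solver

-- Testers and spectrum generators

module _ {p λ′ T : ℕ → ℚ} where

  -- For the lazy walk p = 1 - λ once the total `T` is replaced by 1, so bounds on `p` and on λ
  -- correspond without loss.
  large-eigenvalue : ∀ {x : ℕ → ℚ} → (∀ i → λ′ i ℚ.+ p i ≡ ½ ℚ.* T i ℚ.+ ½) → (λ _ → 1ℚ) ≲ T → p ≲ x → (λ i → 1ℚ ℚ.- x i) ≲ λ′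
  large-eigenvalue {x} eq 1≲T p≲x = ≲-shift (≲-+ p≲x (≲-½* 1≲T)) λ i → begin
    λ′ i ℚ.+ (p i ℚ.+ ½ ℚ.* 1ℚ)                ≡⟨ ℚ.+-assoc (λ′ i) (p i) (½ ℚ.* 1ℚ) ⟨
    λ′ i ℚ.+ p i ℚ.+ ½ ℚ.* 1ℚ                  ≡⟨ cong (ℚ._+ ½ ℚ.* 1ℚ) (eq i) ⟩
    ½ ℚ.* T i ℚ.+ ½ ℚ.+ ½ ℚ.* 1ℚ               ≡⟨ regroup (T i) (x i) ⟩
    (1ℚ ℚ.- x i) ℚ.+ (x i ℚ.+ ½ ℚ.* T i)       ∎
    where
    open ≡-Reasoning
    regroup : ∀ t x → ½ ℚ.* t ℚ.+ ½ ℚ.+ ½ ℚ.* 1ℚ ≡ (1ℚ ℚ.- x) ℚ.+ (x ℚ.+ ½ ℚ.* t)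
    regroup = solve 2 (λ t x → con ½ :* t :+ con ½ :+ con ½ :* con 1ℚ := (con 1ℚ :- x) :+ (x :+ con ½ :* t)) refl
      where open +-*-Solver

  small-eigenvalue : ∀ {x : ℕ → ℚ} → (∀ i → λ′ i ℚ.+ p i ≡ ½ ℚ.* T i ℚ.+ ½) → T ≲ (λ _ → 1ℚ) → x ≲ p → λ′ ≲ λ i → 1ℚ ℚ.- x i
  small-eigenvalue {x} eq T≲1 x≲p = ≲-shift (≲-+ x≲p (≲-½* T≲1)) λ i → sym (begin
    λ′ i ℚ.+ (p i ℚ.+ ½ ℚ.* 1ℚ)                ≡⟨ ℚ.+-assoc (λ′ i) (p i) (½ ℚ.* 1ℚ) ⟨
    λ′ i ℚ.+ p i ℚ.+ ½ ℚ.* 1ℚ                  ≡⟨ cong (ℚ._+ ½ ℚ.* 1ℚ) (eq i) ⟩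
    ½ ℚ.* T i ℚ.+ ½ ℚ.+ ½ ℚ.* 1ℚ               ≡⟨ regroup (T i) (x i) ⟩
    (1ℚ ℚ.- x i) ℚ.+ (x i ℚ.+ ½ ℚ.* T i)       ∎)
    where
    open ≡-Reasoning
    regroup : ∀ t x → ½ ℚ.* t ℚ.+ ½ ℚ.+ ½ ℚ.* 1ℚ ≡ (1ℚ ℚ.- x) ℚ.+ (x ℚ.+ ½ ℚ.* t)
    regroup = solve 2 (λ t x → con ½ :* t :+ con ½ :+ con ½ :* con 1ℚ := (con 1ℚ :- x) :+ (x :+ con ½ :* t)) refl
      where open +-*-Solver

  -- Without laziness the bound obtained is 2p ≤ x; adding 0 ≤ p weakens it to p ≤ x.
  small-probability : ∀ {x : ℕ → ℚ} → (∀ i → λ′ i ℚ.+ (p i ℚ.+ p i) ≡ T i) → T ≲ (λ _ → 1ℚ) → (λ _ → 0ℚ) ≲ p →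
                      (λ i → 1ℚ ℚ.- x i) ≲ λ′ → p ≲ x
  small-probability {x} eq T≲1 0≲p x≲λ = ≲-shift (≲-+ (≲-+ x≲λ T≲1) 0≲p) λ i → begin
    x i ℚ.+ ((1ℚ ℚ.- x i) ℚ.+ T i ℚ.+ 0ℚ)                   ≡⟨ cong (λ t → x i ℚ.+ ((1ℚ ℚ.- x i) ℚ.+ t ℚ.+ 0ℚ)) (eq i) ⟨
    x i ℚ.+ ((1ℚ ℚ.- x i) ℚ.+ (λ′ i ℚ.+ (p i ℚ.+ p i)) ℚ.+ 0ℚ) ≡⟨ regroup (x i) (λ′ i) (p i) ⟩
    p i ℚ.+ (λ′ i ℚ.+ 1ℚ ℚ.+ p i)                           ∎
    where
    open ≡-Reasoning
    regroup : ∀ x l p → x ℚ.+ ((1ℚ ℚ.- x) ℚ.+ (l ℚ.+ (p ℚ.+ p)) ℚ.+ 0ℚ) ≡ p ℚ.+ (l ℚ.+ 1ℚ ℚ.+ p)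
    regroup = solve 3 (λ x l p → x :+ ((con 1ℚ :- x) :+ (l :+ (p :+ p)) :+ con 0ℚ) := p :+ (l :+ con 1ℚ :+ p)) refl
      where open +-*-Solver

  -- From 2p = T - λ ≥ x. This is where the constant 1/2 in front of γ′ originates.
  large-probability : ∀ {x : ℕ → ℚ} → (∀ i → λ′ i ℚ.+ (p i ℚ.+ p i) ≡ T i) → (λ _ → 1ℚ) ≲ T →
                      λ′ ≲ (λ i → 1ℚ ℚ.- x i) → (λ i → ½ ℚ.* x i) ≲ p
  large-probability {x} eq 1≲T λ≲x = ≲-shift (≲-½* (≲-+ λ≲x 1≲T)) λ i → begin
    p i ℚ.+ ½ ℚ.* (λ′ i ℚ.+ 1ℚ)                                 ≡⟨ regroup (x i) (λ′ i) (p i) ⟩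
    ½ ℚ.* x i ℚ.+ ½ ℚ.* (1ℚ ℚ.- x i ℚ.+ (λ′ i ℚ.+ (p i ℚ.+ p i)))   ≡⟨ cong (λ t → ½ ℚ.* x i ℚ.+ ½ ℚ.* (1ℚ ℚ.- x i ℚ.+ t)) (eq i) ⟩
    ½ ℚ.* x i ℚ.+ ½ ℚ.* (1ℚ ℚ.- x i ℚ.+ T i)                    ∎
    where
    open ≡-Reasoning
    regroup : ∀ x l p → p ℚ.+ ½ ℚ.* (l ℚ.+ 1ℚ) ≡ ½ ℚ.* x ℚ.+ ½ ℚ.* (1ℚ ℚ.- x ℚ.+ (l ℚ.+ (p ℚ.+ p)))
    regroup = solve 3 (λ x l p → p :+ con ½ :* (l :+ con 1ℚ) := con ½ :* x :+ con ½ :* (con 1ℚ :- x :+ (l :+ (p :+ p)))) refl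
      where open +-*-Solver

*-if-mono : ∀ x b b′ → b ≡ b′ ⊎ x ≈ 0ℝ → 0ℝ ≤ x →
            seq (x * (if b then 1ℝ else 0ℝ)) ≲ seq (x * (if b′ then 1ℝ else 0ℝ))
*-if-mono x b     b     (inj₁ refl) _ = ≲-reflexive λ _ → refl
*-if-mono x false false (inj₂ _)    _ = ≲-reflexive λ _ → refl
*-if-mono x true  true  (inj₂ _)    _ = ≲-reflexive λ _ → refl
*-if-mono x true  false (inj₂ x≈0)  _ =
  ≲-trans (≲-reflexive λ i → ℚ.*-identityʳ (seq x i))
  (≲-trans (≤⇒≲ x 0ℝ (≈⇒≤ x 0ℝ x≈0)) (≲-reflexive λ i → sym (ℚ.*-zeroʳ (seq x i))))
*-if-mono x false true  (inj₂ _)  0≤x =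
  ≲-trans (≲-reflexive λ i → ℚ.*-zeroʳ (seq x i))
  (≲-trans (≤⇒≲ 0ℝ x 0≤x) (≲-reflexive λ i → sym (ℚ.*-identityʳ (seq x i))))

-- A tester's mass off the dual code is only `≈ 0ℝ`. Changing an event there costs an error that
-- tends to zero, which `≲` absorbs.
Pr-mono : ∀ (D : Distribution n) (e e′ : F₂^ n → Bool) → (∀ α → e α ≡ e′ α ⊎ mass D α ≈ 0ℝ) →
          seq Pr[ e ⇐ D ] ≲ seq Pr[ e′ ⇐ D ]
Pr-mono D e e′ agree =
  ∑-mono {f = λ α → mass D α * (if e α then 1ℝ else 0ℝ)} {g = λ α → mass D α * (if e′ α then 1ℝ else 0ℝ)}
    λ α → *-if-mono (mass D α) (e α) (e′ α) (agree α) (nonNegative D α)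

module _ {C : LinearCode n} {B : Fin n → Dual h} (ker : IsKernel C B) where
  open Kernel {C = C} {B} ker

  module _ (ρ : F₂^ n → F₂^ h) (values-ρ : ∀ {α} → DualCodeword C α → values B (ρ α) ≡ α) (D₀ : Tester C) where

    private
      -- The decision is whether φ(ρ(α)) = α, an equality of words. If it fails, α cannot be a dual
      -- codeword and carries no mass, so the values of ρ off the dual code do not matter.
      agree : ∀ (f : F₂^ n → Bool) (b : Dual h) → (∀ β → apply b β ≡ f (values B β)) →
              ∀ α → apply b (ρ α) ≡ f α ⊎ mass (distribution D₀) α ≈ 0ℝ
      agree f b eq α with values B (ρ α) ≟ α
      ... | yes fix = inj₁ (trans (eq (ρ α)) (cong f fix))
      ... | no ¬fix = inj₂ (supported D₀ α (¬fix ∘ values-ρ))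

      Pr≲ : ∀ (f : F₂^ n → Bool) (b : Dual h) → (∀ β → apply b β ≡ f (values B β)) →
            seq Pr[ apply b ⇐ pushforward ρ (distribution D₀) ] ≲ seq Pr[ f ⇐ distribution D₀ ]
      Pr≲ f b eq = ≲-trans (≲-reflexive (pushforward-Pr ρ (distribution D₀) (apply b)))
        (Pr-mono (distribution D₀) (λ α → apply b (ρ α)) f (agree f b eq))

      Pr≳ : ∀ (f : F₂^ n → Bool) (b : Dual h) → (∀ β → apply b β ≡ f (values B β)) →
            seq Pr[ f ⇐ distribution D₀ ] ≲ seq Pr[ apply b ⇐ pushforward ρ (distribution D₀) ]
      Pr≳ f b eq = ≲-trans
        (Pr-mono (distribution D₀) f (λ α → apply b (ρ α)) (λ α → map₁ sym (agree f b eq α)))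
        (≲-reflexive λ i → sym (pushforward-Pr ρ (distribution D₀) (apply b) i))

    testable⇒spectrum : Spanning (dualModule h) B → ∀ ε δ → Smoothness D₀ ε → Soundness D₀ δ →
                        SpectrumGenerator (Cay (lazy (pushforward ρ (distribution D₀)))) B ε δ
    testable⇒spectrum spanning ε δ smooth sound =
      (λ i → eventually (large-eigenvalue {λ′ = seq (eigenvalue (Cay (lazy (pushforward ρ (distribution D₀)))) (B i))} (eigenvalue-lazy (pushforward ρ (distribution D₀)) (B i)) (1≲total (pushforward ρ (distribution D₀)))
        (≲-trans (Pr≲ (λ α → lookup α i) (B i) (λ β → sym (Vec.lookup∘tabulate (λ i → apply (B i) β) i)))
                 (≤⇒≲ Pr[ (λ α → lookup α i) ⇐ distribution D₀ ] ε (smooth i))))) ,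
      λ a r rank →
        -- Every functional is Σ vᵢ bᵢ for some word v, and its eigenvalue is controlled by the test
        -- of that word.
        let x , x-a = spanning a
            v = tabulate x
            a≡ = λ β → trans (sym (x-a β)) (apply-lc x B β)
        in eventually (small-eigenvalue {λ′ = seq (eigenvalue (Cay (lazy (pushforward ρ (distribution D₀)))) a)} (eigenvalue-lazy (pushforward ρ (distribution D₀)) a) (total≲1 (pushforward ρ (distribution D₀)))
          (≲-trans (≤⇒≲ (δ * fromℕ r) Pr[ (λ α → α · v) ⇐ distribution D₀ ] (sound v r (rank⇒distance v a a≡ rank)))
                   (Pr≳ (λ α → α · v) a λ β → trans (a≡ β) (·-comm v (values B β)))))

  module _ (D : Distribution h) where

    -- φ takes values in the dual code, so a word outside it has an empty fibre and mass zero.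
    tester : Tester C
    tester .distribution   = pushforward (values B) D
    tester .supported α α∉ = ≤-antisym (mass (pushforward (values B) D) α) 0ℝ
      (eventually (≲-reflexive zero′)) (eventually (≲-reflexive (λ i → sym (zero′ i))))
      where
      zero′ : ∀ i → seq (mass (pushforward (values B) D) α) i ≡ 0ℚ
      zero′ = pushforward-∉ (values B) D λ β eq → α∉ (subst (DualCodeword C) eq (values-dual β))

    tester-Pr : ∀ (e : F₂^ n → Bool) (b : Dual h) → (∀ β → e (values B β) ≡ apply b β) →
                ∀ i → seq Pr[ e ⇐ distribution tester ] i ≡ seq Pr[ apply b ⇐ D ] i
    tester-Pr e b eq i = begin
      seq Pr[ e ⇐ distribution tester ] i
        ≡⟨ seq-Pr (distribution tester) e i ⟩
      ∑ℚ (λ α → seq (mass (distribution tester) α) i ℚ.* indicator (e α))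
        ≡⟨ image-𝔼 (values B) D (λ α → indicator (e α)) i ⟩
      ∑ℚ (λ β → seq (mass D β) i ℚ.* indicator (e (values B β)))
        ≡⟨ ∑ℚ-cong (λ β → cong (λ b → seq (mass D β) i ℚ.* indicator b) (eq β)) ⟩
      ∑ℚ (λ β → seq (mass D β) i ℚ.* indicator (apply b β))
        ≡⟨ seq-Pr D (apply b) i ⟨
      seq Pr[ apply b ⇐ D ] i ∎
      where open ≡-Reasoning

    smooth : ∀ ε → (∀ i → 1ℝ - ε ≤ eigenvalue (Cay D) (B i)) → Smoothness tester ε
    smooth ε large i = eventually (≲-trans
      (≲-reflexive (tester-Pr (λ α → lookup α i) (B i) λ β → Vec.lookup∘tabulate (λ i → apply (B i) β) i))
      (small-probability {λ′ = seq (eigenvalue (Cay D) (B i))} {x = seq ε} (eigenvalue-Pr D (B i)) (total≲1 D) (Pr-nonNegative D (apply (B i)))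
        (≤⇒≲ (1ℝ - ε) (eigenvalue (Cay D) (B i)) (large i))))

    -- The word v is matched with a = Σ vᵢ bᵢ: testing v at φ(β) evaluates a at β, and the distance
    -- of v is the rank of a.
    sound : ∀ γ ε → (∀ a r → IsRank B a r → eigenvalue (Cay D) a ≤ 1ℝ - γ * ε * fromℕ r) → Soundness tester (rational ½ * γ * ε)
    sound γ ε small v r dist =
      let a = linearCombination (dualModule h) (lookup v) B
          a≡ = apply-lc-lookup v B
      in eventually (≲-trans
        (≲-reflexive λ i → regroup (seq γ i) (seq ε i) (+ r ℚ./ 1))
        (≲-trans
          (large-probability {λ′ = seq (eigenvalue (Cay D) a)} {x = seq (γ * ε * fromℕ r)} (eigenvalue-Pr D a) (1≲total D)
            (≤⇒≲ (eigenvalue (Cay D) a) (1ℝ - γ * ε * fromℕ r) (small a r (distance⇒rank v a a≡ dist))))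
          (≲-reflexive λ i → sym (tester-Pr (λ α → α · v) a (λ β → trans (·-comm (values B β) v) (sym (a≡ β))) i))))
      where
      regroup : ∀ x y z → ½ ℚ.* x ℚ.* y ℚ.* z ≡ ½ ℚ.* (x ℚ.* y ℚ.* z)
      regroup x y z = trans (cong (ℚ._* z) (ℚ.*-assoc ½ x y)) (ℚ.*-assoc ½ (x ℚ.* y) z)

    spectrum⇒testable : ∀ γ ε → SpectrumGenerator (Cay D) B ε (γ * ε) → LocallyTestable C ε (rational ½ * γ * ε)
    spectrum⇒testable γ ε (large , small) = tester , smooth ε large , sound γ ε small

-- Dimension of the code and number of generators

/1-+ : ∀ a b → + (a ℕ.+ b) ℚ./ 1 ≡ + a ℚ./ 1 ℚ.+ + b ℚ./ 1
/1-+ a b = ℚ.toℚᵘ-injective (begin-equality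
  toℚᵘ (+ (a ℕ.+ b) ℚ./ 1)                ≃⟨ ℚ.toℚᵘ-fromℚᵘ (mkℚᵘ (+ (a ℕ.+ b)) 0) ⟩
  mkℚᵘ (+ (a ℕ.+ b)) 0                    ≃⟨ ℚᵘ.*≡* (cong (ℤ._* + 1) (cong₂ ℤ._+_ (sym (ℤ.*-identityʳ (+ a))) (sym (ℤ.*-identityʳ (+ b))))) ⟩
  mkℚᵘ (+ a) 0 ℚᵘ.+ mkℚᵘ (+ b) 0          ≃⟨ ℚᵘ.+-cong (ℚ.toℚᵘ-fromℚᵘ (mkℚᵘ (+ a) 0)) (ℚ.toℚᵘ-fromℚᵘ (mkℚᵘ (+ b) 0)) ⟨
  toℚᵘ (+ a ℚ./ 1) ℚᵘ.+ toℚᵘ (+ b ℚ./ 1)  ≃⟨ ℚ.toℚᵘ-homo-+ (+ a ℚ./ 1) (+ b ℚ./ 1) ⟨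
  toℚᵘ (+ a ℚ./ 1 ℚ.+ + b ℚ./ 1)          ∎)
  where open ℚᵘ.≤-Reasoning

module _ (c : ℝ) (0<c : 0ℝ < c) {n k h : ℕ} .{{_ : ℕ.NonZero n}} (k+h≡n : k ℕ.+ h ≡ n) where

  private
    n≡k+h : + n ℚ./ 1 ≡ + k ℚ./ 1 ℚ.+ + h ℚ./ 1
    n≡k+h = trans (cong (λ m → + m ℚ./ 1) (sym k+h≡n)) (/1-+ k h)

    L : ℕ → ℚ
    L = seq (c * log₂ n)

    log₂-nonNegative : EventuallyNonNegative (seq (log₂ n))
    log₂-nonNegative = 0 , λ i _ → 0≤+/ ⌊log₂ (n ℕ.^ suc i) ⌋ i

  -- By k + h = n the hypothesis is h ≤ c log₂ n; dividing by c leaves the comparison of logarithm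
  -- and exponential.
  dimension⇒size : fromℕ n - c * log₂ n ≤ fromℕ k → 2^ (fromℕ h / c [ 0<c ]) ≤ fromℕ n
  dimension⇒size dim = ≤log₂⇒2^≤ (fromℕ h / c [ 0<c ]) n (≤*⇒/≤ c 0<c (fromℕ h) (log₂ n) log₂-nonNegative
    (eventually (≲-shift {t = L} {s = seq (fromℕ h)} (≤⇒≲ (fromℕ n - c * log₂ n) (fromℕ k) dim) λ i →
      trans (cong (λ x → L i ℚ.+ (x ℚ.- L i)) n≡k+h) (regroup (L i) (+ k ℚ./ 1) (+ h ℚ./ 1)))))
    where
    regroup : ∀ l k h → l ℚ.+ (k ℚ.+ h ℚ.- l) ≡ h ℚ.+ k
    regroup = solve 3 (λ l k h → l :+ (k :+ h :- l) := h :+ k) refl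
      where open +-*-Solver

  size⇒dimension : 2^ (fromℕ h / c [ 0<c ]) ≤ fromℕ n → fromℕ n - c * log₂ n ≤ fromℕ k
  size⇒dimension size = eventually (≲-shift {t = seq (fromℕ k)} {s = λ i → seq (fromℕ n) i ℚ.- L i}
    (≤⇒≲ (fromℕ h) (c * log₂ n) (/≤⇒≤* c 0<c (fromℕ h) (log₂ n) (0 , λ _ _ → 0≤+/ h 0)
      (2^≤⇒≤log₂ (fromℕ h / c [ 0<c ]) n size)))
    λ i → sym (trans (cong (λ x → x ℚ.- L i ℚ.+ L i) n≡k+h) (regroup (L i) (+ k ℚ./ 1) (+ h ℚ./ 1))))
    where
    regroup : ∀ l k h → k ℚ.+ h ℚ.- l ℚ.+ l ≡ k ℚ.+ h
    regroup = solve 3 (λ l k h → k :+ h :- l :+ l := k :+ h) refl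
      where open +-*-Solver

-- The two directions of the equivalence

half-positive : ∀ x → 0ℝ < x → 0ℝ < rational ½ * x
half-positive x (δ , 0<δ , N , δ≤x) = ½ ℚ.* δ , half>0 0<δ , N , λ n N≤n →
  ℚ.≤-trans (ℚ.≤-reflexive (trans (ℚ.+-identityˡ (½ ℚ.* δ)) (cong (½ ℚ.*_) (sym (ℚ.+-identityˡ δ)))))
            (ℚ.*-monoˡ-≤-nonNeg ½ (δ≤x n N≤n))

kernelCode : (Fin n → Dual h) → LinearCode n
kernelCode B = record
  { Codeword = λ v → ∀ β → v · values B β ≡ false
  ; 0-closed = λ β → trans (·-comm 𝟎 (values B β)) (·-zeroʳ (values B β))
  ; ⊕-closed = λ {u} {v} u∈ v∈ β → trans (·-comm (u ⊕ v) (values B β)) (trans (·-distribˡ-⊕ (values B β) u v)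
      (cong₂ _xor_ (trans (·-comm (values B β) u) (u∈ β)) (trans (·-comm (values B β) v) (v∈ β))))
  }

module _ (d : ℕ) (3≤d : 3 ℕ.≤ d) (c : ℝ) (0<c : 0ℝ < c) (ε : ℝ) where

  GoodCode : ℝ → ℕ → Set₁
  GoodCode γ n = ∃ λ (C : LinearCode n) →
    (∃ λ k → HasDimension C k × fromℕ n - c * log₂ n ≤ fromℕ k) ×
    MinimumDistance≥ C d ×
    LocallyTestable C ε (γ * ε)

  GoodGraph : ℝ → ℕ → Set
  GoodGraph γ′ h = ∃ λ (G : CayleyGraph h) → ∃ λ (N : ℕ) → ∃ λ (B : Fin N → Dual h) →
    Distinct (dualModule h) B ×
    Spanning (dualModule h) B ×
    WiseIndependent (dualModule h) d B ×
    2^ (fromℕ h / c [ 0<c ]) ≤ fromℕ N ×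
    SpectrumGenerator G B ε (γ′ * ε)

  module _ {n h : ℕ} .{{_ : ℕ.NonZero n}} {C : LinearCode n} (B : Fin n → Dual h) (ker : IsKernel C B)
           (spanning : Spanning (dualModule h) B)
           (ρ : F₂^ n → F₂^ h) (values-ρ : ∀ {α} → DualCodeword C α → values B (ρ α) ≡ α) where

    open Kernel {C = C} {B} ker

    kernel⇒graph : ∀ γ {k} → HasDimension C k → fromℕ n - c * log₂ n ≤ fromℕ k → MinimumDistance≥ C d →
                   LocallyTestable C ε (γ * ε) → n ℕ.≤ 2 ℕ.^ h × GoodGraph γ h
    kernel⇒graph γ {k} dim n-clog≤k dist (D₀ , smooth , sound) =
      distinct⇒n≤2^h B distinct , Cay (lazy (pushforward ρ (distribution D₀))) , n , B , distinct , spanning , wise ,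
      dimension⇒size c 0<c {n} {k} {h} (dimension spanning dim) n-clog≤k ,
      testable⇒spectrum {B = B} ker ρ values-ρ D₀ spanning ε (γ * ε) smooth sound
      where
      wise : WiseIndependent (dualModule h) d B
      wise = distance⇒wise dist
      distinct : Distinct (dualModule h) B
      distinct = wise⇒distinct B 3≤d wise

  code⇒graph : ∀ γ n → .{{ℕ.NonZero n}} → GoodCode γ n → ∃ λ h → n ℕ.≤ 2 ℕ.^ h × GoodGraph γ h
  code⇒graph γ n (C , (k , dim , n-clog≤k) , dist , testable) =
    ParityCheck.redundancy P ,
    kernel⇒graph (columns P) (columns-kernel P) (columns-spanning P) (ParityCheck.section P ᵀ) (values-sectionᵀ P) γ dim n-clog≤k dist testable
    where
    open DualBasis
    P : ParityCheck C
    P = parityCheck C (Codeword? C dim)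

  graph⇒code : ∀ γ h → .{{ℕ.NonZero h}} → GoodGraph γ h → ∃ λ n → h ℕ.≤ n × GoodCode (rational ½ * γ) n
  graph⇒code γ h (G , n , B , _ , spanning , wise , 2^≤n , spectrum) =
    n , h≤n , C , (K , dim , size⇒dimension c 0<c {n} {K} {h} {{n≢0}} (dimension spanning dim) 2^≤n) , wise⇒distance wise ,
    spectrum⇒testable {B = B} ker (generators G) γ ε spectrum
    where
    C = kernelCode B
    -- Exhaustive search over β decides membership, from which a basis of the kernel code is
    -- computed.
    C? = λ v → all? λ β → (v · values B β) Bool.≟ false
    ker : IsKernel C B
    ker v = mk⇔ id id
    open Kernel {C = C} {B} ker
    h≤n = spanning⇒h≤n spanning
    K = proj₁ (hasDimension C C?)
    dim = proj₂ (hasDimension C C?)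
    n≢0 : ℕ.NonZero n
    n≢0 = ℕ.>-nonZero (ℕ.<-≤-trans (ℕ.>-nonZero⁻¹ h) h≤n)

corollary17 : (d : ℕ) → 3 ℕ.≤ d →
    (c : ℝ) (0<c : 0ℝ < c) →
    (ε : ℝ) → 0ℝ < ε → ε ≤ 1ℝ →
    (∃ λ (γ : ℝ) → 0ℝ < γ × InfinitelyMany λ n →
    ∃ λ (C : LinearCode n) →
    (∃ λ k → HasDimension C k × fromℕ n - c * log₂ n ≤ fromℕ k) ×
    MinimumDistance≥ C d ×
    LocallyTestable C ε (γ * ε))
    ⇔
    (∃ λ (γ′ : ℝ) → 0ℝ < γ′ × InfinitelyMany λ h →
    ∃ λ (G : CayleyGraph h) → ∃ λ (N : ℕ) → ∃ λ (B : Fin N → Dual h) →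
    Distinct (dualModule h) B ×
    Spanning (dualModule h) B ×
    WiseIndependent (dualModule h) d B ×
    2^ (fromℕ h / c [ 0<c ]) ≤ fromℕ N ×
    SpectrumGenerator G B ε (γ′ * ε))
corollary17 d 3≤d c 0<c ε _ _ = mk⇔
  (λ { (γ , 0<γ , codes) → γ , 0<γ , λ H →
    -- A code length of at least 2^H together with n ≤ 2^h forces h ≥ H.
    let n , 2^H≤n , code = codes (2 ℕ.^ H)
        instance _ = ℕ.>-nonZero (ℕ.<-≤-trans (ℕ.m^n>0 2 H) 2^H≤n)
        h , n≤2^h , graph = code⇒graph d 3≤d c 0<c ε γ n code
    in h , 2^-cancel-≤ (ℕ.≤-trans 2^H≤n n≤2^h) , graph })
  (λ { (γ , 0<γ , graphs) → rational ½ * γ , half-positive γ 0<γ , λ M →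
    -- Asking for h > M rather than h ≥ M makes h positive, hence also n ≥ h, as the logarithm
    -- requires.
    let h , M<h , graph = graphs (suc M)
        instance _ = ℕ.>-nonZero (ℕ.≤-<-trans ℕ.z≤n M<h)
        n , h≤n , code = graph⇒code d 3≤d c 0<c ε γ h graph
    in n , ℕ.≤-trans (ℕ.<⇒≤ M<h) h≤n , code })
  where
  2^-cancel-≤ : ∀ {m n} → 2 ℕ.^ m ℕ.≤ 2 ℕ.^ n → m ℕ.≤ n
  2^-cancel-≤ le = ℕ.≮⇒≥ λ n<m → ℕ.<⇒≱ (ℕ.^-monoʳ-< 2 (ℕ.s≤s (ℕ.s≤s ℕ.z≤n)) n<m) le
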